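{- Let $A\subseteq\mathbb{N}$ and let $S_A:=\{(n,\top)\mid n\in A\}\cup\{(n,\bot)\mid n\notin A\}$, regarded as a subspace of $\mathbb{N}\times\mathbb{S}$. The following are equivalent: (1) $S_A$ is computably isomorphic to $\mathbb{N}$. (2) $S_A$ is a complete computable metric space. (3) $S_A$ is computably Quasi-Polish. (4) $S_A$ is computably separable. (5) $S_A$ is computably overt. (6) $A$ is computably enumerable.
   Context: A represented space $\mathbf{X}=(X,\delta_{\mathbf{X}})$ is a set $X$ with a partial surjection $\delta_{\mathbf{X}}:\subseteq\mathbb{N}^{\mathbb{N}}\to X$; any $p$ with $\delta_{\mathbf X}(p)=x$ is a name of $x$. A subspace is a subset with the restricted representation (a point keeps all its names). A realiser of a map $f:\mathbf{X}\to\mathbf{Y}$ is a partial map $R_f:\subseteq\mathbb{N}^{\mathbb{N}}\to\mathbb{N}^{\mathbb{N}}$ sending every name of every $x\in X$ to a name of $f(x)$; $f$ is computable (continuously realisable) if it has a computable (continuous) realiser. A computable isomorphism is a computable bijection with computable inverse. $\mathbb{N}$ is represented by $\delta_{\mathbb N}(p)=p(0)$. $\mathbf{Y}^{\mathbf{X}}$ is the represented space of total continuously realisable functions; a name of $f$ is a $p\in\mathbb N^{\mathbb N}$ coding a realiser of $f$, with $p(0)$ the index of a Turing machine using the oracle $n\mapsto p(n+1)$. In the product $\mathbf{X}\times\mathbf{Y}$, $p$ names $(x,y)$ iff $n\mapsto p(2n)$ names $x$ and $n\mapsto p(2n+1)$ names $y$. Sierpinski space $\mathbb{S}=\{\top,\bot\}$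 is represented so that $0^\omega$ names $\bot$ and every other sequence names $\top$. The space $\mathcal{O}(\mathbf{X})$ of open sets is $\mathbb{S}^{\mathbf{X}}$, identifying $U$ with its characteristic function ($x\mapsto\top$ iff $x\in U$); $U$ is computably open if it has a computable name. $\mathbf{X}$ is computably overt if $\{U\in\mathcal{O}(\mathbf{X})\mid U\neq\emptyset\}$ is computably open in $\mathcal{O}(\mathbf{X})$. $\mathbf{X}$ is computably separable if there is a computable map $s:\mathbb{N}\to\mathbf{X}$ whose image is dense, i.e. meets every non-empty $U\in\mathcal{O}(\mathbf{X})$. For a transitive relation $\ll$ on $\mathbb{N}$, an ideal is a non-empty $I\subseteq\mathbb{N}$ such that $x\ll y\in I$ implies $x\in I$, and for all $x,y\in I$ there is $z\in I$ with $x\ll z$ and $y\ll z$. $\mathbf{I}(\ll)$ is the represented space of ideals, where $p$ names $I$ iff $I=\{p(k)\mid k\in\mathbb{N}\}$. A represented space is precomputably Quasi-Polish if it is computably isomorphic to $\mathbf{I}(\ll)$ for some computably enumerable transitive $\ll$ on $\mathbb N$; it is computably Quasi-Polish if it is moreover computably overt. For a computable pseudometric $d:\mathbb{N}\times\mathbb{N}\to\mathbb{R}$, $\mathbf{X}_d$ is the Cauchy completion of $(\mathbb{N},d)$, where $p$ names $x$ iff $d(p(n),x)<2^{ -n}$ for all $n$. A represented space is a complete computable metric space if it is computably isomorphic to some such $\mathbf{X}_d$. -}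

module Defs where

open import Axiom.ExcludedMiddle using (ExcludedMiddle)
open import Data.Bool.Base using (if_then_else_)
open import Data.Integer.Base using (_⊖_)
import Data.Integer.Base as ℤ
import Data.Integer.Properties as ℤ
open import Data.List.Base using (List; []; _∷_; length; replicate)
open import Data.Maybe.Base using (Maybe; just; nothing; map)
open import Data.Maybe.Properties using (just-injective)
open import Data.Nat.Base using (ℕ; zero; suc; z≤n; s≤s; _^_)
import Data.Nat.Base as ℕ
import Data.Nat.Properties as ℕ
open import Data.Product.Base using (Σ; ∃₂; _×_; _,_; proj₁; proj₂; Σ-syntax; ∃-syntax)
open import Data.Product.Relation.Binary.Pointwise.NonDependent using (×-setoid)
open import Data.Rational.Base using (ℚ; mkℚ; 0ℚ; _/_; _+_; _-_; -_; _≤_; _<_; ∣_∣; toℚᵘ; *<*)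
import Data.Rational.Properties as ℚ
open import Data.Rational.Solver using (module +-*-Solver)
open import Data.Rational.Unnormalised.Base using (mkℚᵘ; *≡*)
import Data.Rational.Unnormalised.Base as ℚᵘ
import Data.Rational.Unnormalised.Properties as ℚᵘ
open import Data.Sum.Base using (_⊎_; inj₁; inj₂)
open import Function.Base using (_∘_; const; case_of_)
open import Function.Bundles using (Func; Inverse; _⇔_; mk⇔; Equivalence)
open import Level using (Level; 0ℓ; _⊔_) renaming (suc to lsuc)
open import Relation.Binary.Bundles using (Setoid)
open import Relation.Binary.Core using (Rel)
open import Relation.Binary.Definitions using (Transitive)
open import Relation.Binary.PropositionalEquality using (_≡_; refl; sym; trans; cong; cong₂; _≗_; setoid)
open import Relation.Nullary.Decidable.Core using (Dec; yes; no; does)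
open import Relation.Nullary.Negation.Core using (¬_; contradiction)
open import Relation.Unary using (Pred)

private
  variable
    c e n c′ e′ n′ ℓ : Level

-- Enumerates ℕ × ℕ along the anti-diagonals.
unpair : ℕ → ℕ × ℕ
unpair zero = 0 , 0
unpair (suc k) with unpair k
... | a , zero  = 0 , suc a
... | a , suc b = suc a , b

triangle : ℕ → ℕ
triangle zero    = 0
triangle (suc s) = suc (s ℕ.+ triangle s)

unpair-along : ∀ k s a → unpair k ≡ (0 , a ℕ.+ s) → unpair (a ℕ.+ k) ≡ (a , s)
unpair-along k s zero    eq = eq
unpair-along k s (suc a) eq
  rewrite unpair-along k (suc s) a (trans eq (cong (0 ,_) (sym (ℕ.+-suc a s)))) = refl

unpair-triangle : ∀ s → unpair (triangle s) ≡ (0 , s)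
unpair-triangle zero    = refl
unpair-triangle (suc s)
  rewrite unpair-along (triangle s) 0 s
            (trans (unpair-triangle s) (cong (0 ,_) (sym (ℕ.+-identityʳ s)))) = refl

pair : ℕ → ℕ → ℕ
pair a b = a ℕ.+ triangle (a ℕ.+ b)

unpair-pair : ∀ a b → unpair (pair a b) ≡ (a , b)
unpair-pair a b = unpair-along (triangle (a ℕ.+ b)) b a (unpair-triangle (a ℕ.+ b))

Baire : Set
Baire = ℕ → ℕ

data Symbol : Set where
  blank mark : Symbol

data Move : Set where
  left right stay : Move

-- Both lists start next to the scanned cell; cells beyond them are blank.
record Tape : Set where
  constructor tape
  field
    leftPart  : List Symbol
    scanned   : Symbol
    rightPart : List Symbol

record Action : Set where
  constructor action
  field
    write : Symbol
    move  : Move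
    next  : ℕ

-- A machine has tapes 0, 1, 2, …, of which its finite program mentions only
-- finitely many.  States are positions in the program.  In a state
-- `scan t b m` the machine reads tape t and performs action b or m according
-- to whether it sees a blank or a mark; in a state `query t q` it asks the
-- oracle about the number on tape t and goes to state q.
data Instruction : Set where
  scan  : (t : ℕ) (onBlank onMark : Action) → Instruction
  query : (t : ℕ) (next : ℕ) → Instruction

Machine : Set
Machine = List Instruction

record Config : Set where
  constructor config
  field
    state : ℕ
    tapes : ℕ → Tape

marksFrom : Symbol → List Symbol → ℕ
marksFrom blank _       = 0
marksFrom mark []       = 1
marksFrom mark (s ∷ ss) = suc (marksFrom s ss)

-- The number on a tape is the length of the block of marks that starts at the
-- scanned cell and extends to the right.
value : Tape → ℕ
value (tape _ s r) = marksFrom s r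

unary : ℕ → Tape
unary zero    = tape [] blank []
unary (suc k) = tape [] mark (replicate k mark)

shift : Move → Tape → Tape
shift stay  t                   = t
shift left  (tape [] s r)       = tape [] blank (s ∷ r)
shift left  (tape (x ∷ l) s r)  = tape l x (s ∷ r)
shift right (tape l s [])       = tape (s ∷ l) blank []
shift right (tape l s (x ∷ r))  = tape (s ∷ l) x r

act : Action → Tape → Tape
act (action w m _) (tape l _ r) = shift m (tape l w r)

_[_≔_] : (ℕ → Tape) → ℕ → Tape → (ℕ → Tape)
(ts [ t ≔ x ]) u = if does (u ℕ.≟ t) then x else ts u

fetch : Machine → ℕ → Maybe Instruction
fetch []      _       = nothing
fetch (i ∷ _) zero    = just i
fetch (_ ∷ M) (suc q) = fetch M q

execute : Baire → Instruction → (ℕ → Tape) → Config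
execute α (scan t b m) ts = perform (case Tape.scanned (ts t) of λ { blank → b ; mark → m })
  where
  perform : Action → Config
  perform a = config (Action.next a) (ts [ t ≔ act a (ts t) ])
-- The answer replaces the whole contents of the tape.
execute α (query t q) ts = config q (ts [ t ≔ unary (α (value (ts t))) ])

-- The machine halts when its state is not a position in the program.
step : Machine → Baire → Config → Maybe Config
step M α (config q ts) = map (λ i → execute α i ts) (fetch M q)

data Halts (M : Machine) (α : Baire) : Config → ℕ → Set where
  halted : ∀ {k} → step M α k ≡ nothing → Halts M α k (value (Config.tapes k 0))
  steps  : ∀ {k k′ m} → step M α k ≡ just k′ → Halts M α k′ m → Halts M α k m

initial : ℕ → Config
initial n = config 0 λ { zero → unary n ; (suc _) → unary 0 }

-- The graph of the partial map on Baire space computed by M: with oracle α,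
-- M outputs β n on every input n.
Φ : Machine → Baire → Baire → Set
Φ M α β = ∀ n → Halts M α (initial n) (β n)

Halts-deterministic : ∀ {M α k m m′} → Halts M α k m → Halts M α k m′ → m ≡ m′
Halts-deterministic (halted _)  (halted _)  = refl
Halts-deterministic (halted s)  (steps t _) = contradiction (trans (sym s) t) λ ()
Halts-deterministic (steps s _) (halted t)  = contradiction (trans (sym t) s) λ ()
Halts-deterministic (steps s h) (steps t h′)
  rewrite just-injective (trans (sym s) t) = Halts-deterministic h h′

step-cong : ∀ M {α β} → α ≗ β → ∀ k → step M α k ≡ step M β k
step-cong M α≗β (config q ts) with fetch M q
... | nothing          = refl
... | just (scan t b m) = refl
... | just (query t r)  =
  cong (λ v → just (config r (ts [ t ≔ unary v ]))) (α≗β (value (ts t)))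

Halts-cong : ∀ {M α β k m} → α ≗ β → Halts M α k m → Halts M β k m
Halts-cong {M} α≗β (halted s)  = halted (trans (sym (step-cong M α≗β _)) s)
Halts-cong {M} α≗β (steps s h) = steps (trans (sym (step-cong M α≗β _)) s) (Halts-cong α≗β h)

toSymbol : ℕ → Symbol
toSymbol zero    = blank
toSymbol (suc _) = mark

toMove : ℕ → Move
toMove 0 = left
toMove 1 = right
toMove _ = stay

toAction : ℕ → Action
toAction a = let (wm , q) = unpair a
                 (w , m)  = unpair wm
             in action (toSymbol w) (toMove m) q

toInstruction : ℕ → Instruction
toInstruction i with unpair i
... | zero  , j = let (t , q) = unpair j in query t q
... | suc _ , j = let (t , bm) = unpair j
                      (b , m)  = unpair bm
                  in scan t (toAction b) (toAction m)

toProgram : (length : ℕ) → ℕ → Machine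
toProgram zero    _ = []
toProgram (suc l) p = let (i , p′) = unpair p in toInstruction i ∷ toProgram l p′


machine : ℕ → Machine
machine i = let (l , p) = unpair i in toProgram l p

symbolIndex : ∀ s → ∃[ i ] toSymbol i ≡ s
symbolIndex blank = 0 , refl
symbolIndex mark  = 1 , refl

moveIndex : ∀ m → ∃[ i ] toMove i ≡ m
moveIndex left  = 0 , refl
moveIndex right = 1 , refl
moveIndex stay  = 2 , refl

actionIndex : ∀ a → ∃[ i ] toAction i ≡ a
actionIndex (action w m q) with symbolIndex w | moveIndex m
... | i , refl | j , refl = pair (pair i j) q , lemma
  where
  lemma : toAction (pair (pair i j) q) ≡ action (toSymbol i) (toMove j) q
  lemma rewrite unpair-pair (pair i j) q | unpair-pair i j = refl

instructionIndex : ∀ x → ∃[ i ] toInstruction i ≡ x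
instructionIndex (query t q) = pair 0 (pair t q) , lemma
  where
  lemma : toInstruction (pair 0 (pair t q)) ≡ query t q
  lemma rewrite unpair-pair 0 (pair t q) | unpair-pair t q = refl
instructionIndex (scan t b m) with actionIndex b | actionIndex m
... | i , refl | j , refl = pair 1 (pair t (pair i j)) , lemma
  where
  lemma : toInstruction (pair 1 (pair t (pair i j))) ≡ scan t (toAction i) (toAction j)
  lemma rewrite unpair-pair 1 (pair t (pair i j)) | unpair-pair t (pair i j) | unpair-pair i j = refl

programIndex : ∀ M → ∃[ p ] toProgram (length M) p ≡ M
programIndex []      = 0 , refl
programIndex (x ∷ M) with instructionIndex x | programIndex M
... | i , eq | p , eq′ = pair i p , lemma
  where
  lemma : toProgram (suc (length M)) (pair i p) ≡ x ∷ M
  lemma rewrite unpair-pair i p = cong₂ _∷_ eq eq′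

machineIndex : ∀ M → ∃[ i ] machine i ≡ M
machineIndex M with programIndex M
... | p , eq = pair (length M) p , lemma
  where
  lemma : machine (pair (length M) p) ≡ M
  lemma rewrite unpair-pair (length M) p = eq

ComputableSequence : Baire → Set
ComputableSequence p = ∃[ M ] Φ M (const 0) p

ComputablyEnumerable : Pred ℕ ℓ → Set ℓ
ComputablyEnumerable A =
  (∀ n → ¬ A n) ⊎
  (∃[ f ] ComputableSequence f × (∀ n → A n ⇔ (∃[ k ] f k ≡ n)))

ComputablyEnumerable₂ : Rel ℕ ℓ → Set ℓ
ComputablyEnumerable₂ _~_ =
  (∀ x y → ¬ x ~ y) ⊎
  (∃₂ λ f g → ComputableSequence f × ComputableSequence g ×
              (∀ x y → x ~ y ⇔ (∃[ k ] f k ≡ x × g k ≡ y)))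

-- `names p x` is the graph of the partial surjection from Baire space.
-- Sequences are identified when pointwise equal.
record RepresentedSpace c e n : Set (lsuc (c ⊔ e ⊔ n)) where
  field
    points : Setoid c e
  open Setoid points public using (Carrier; _≈_)
  field
    names             : Baire → Carrier → Set n
    names-resp        : ∀ {p q x y} → p ≗ q → x ≈ y → names p x → names q y
    names-singleValued : ∀ {p x y} → names p x → names p y → x ≈ y
    names-surjective  : ∀ x → ∃[ p ] names p x

open RepresentedSpace

module _ (X : RepresentedSpace c e n) (Y : RepresentedSpace c′ e′ n′) where

  Map : Set (c ⊔ e ⊔ c′ ⊔ e′)
  Map = Func (points X) (points Y)

  -- F is the graph of a partial map on Baire space.
  Realises : (F : Baire → Baire → Set) → Map → Set (c ⊔ n ⊔ n′)
  Realises F f = ∀ {x p} → names X p x → ∃[ q ] F p q × names Y q (Func.to f x)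

  Computable : Map → Set (c ⊔ n ⊔ n′)
  Computable f = ∃[ M ] Realises (Φ M) f

infix 4 _≅_

_≅_ : RepresentedSpace c e n → RepresentedSpace c′ e′ n′ → Set (c ⊔ e ⊔ n ⊔ c′ ⊔ e′ ⊔ n′)
X ≅ Y = Σ[ i ∈ Inverse (points X) (points Y) ]
          Computable X Y (record { to = Inverse.to i ; cong = Inverse.to-cong i }) ×
          Computable Y X (record { to = Inverse.from i ; cong = Inverse.from-cong i })

Subspace : (X : RepresentedSpace c e n) → Pred (Carrier X) ℓ → RepresentedSpace (c ⊔ ℓ) e n
Subspace X P = record
  { points = record
    { Carrier       = Σ (Carrier X) P
    ; _≈_           = λ x y → proj₁ x ≈ˣ proj₁ y
    ; isEquivalence = record { refl = X.refl ; sym = X.sym ; trans = X.trans }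
    }
  ; names              = λ p x → names X p (proj₁ x)
  ; names-resp         = names-resp X
  ; names-singleValued = names-singleValued X
  ; names-surjective   = λ x → names-surjective X (proj₁ x)
  }
  where
  module X = Setoid (points X)
  _≈ˣ_ = _≈_ X

ℕʳ : RepresentedSpace 0ℓ 0ℓ 0ℓ
ℕʳ = record
  { points             = setoid ℕ
  ; names              = λ p k → p 0 ≡ k
  ; names-resp         = λ p≗q x≡y eq → trans (sym (p≗q 0)) (trans eq x≡y)
  ; names-singleValued = λ eq eq′ → trans (sym eq) eq′
  ; names-surjective   = λ k → const k , refl
  }

data Sierpinski : Set where
  ⊤ˢ ⊥ˢ : Sierpinski

data SierpinskiName (p : Baire) : Sierpinski → Set where
  names-⊥ : p ≗ const 0 → SierpinskiName p ⊥ˢ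
  names-⊤ : ¬ p ≗ const 0 → SierpinskiName p ⊤ˢ

𝕊 : RepresentedSpace 0ℓ 0ℓ 0ℓ
𝕊 = record
  { points             = setoid Sierpinski
  ; names              = SierpinskiName
  ; names-resp         = λ { p≗q refl (names-⊥ z) → names-⊥ λ k → trans (sym (p≗q k)) (z k)
                           ; p≗q refl (names-⊤ z) → names-⊤ λ z′ → z λ k → trans (p≗q k) (z′ k) }
  ; names-singleValued = λ { (names-⊥ _) (names-⊥ _) → refl
                           ; (names-⊥ z) (names-⊤ w) → contradiction z w
                           ; (names-⊤ w) (names-⊥ z) → contradiction z w
                           ; (names-⊤ _) (names-⊤ _) → refl }
  ; names-surjective   = λ { ⊥ˢ → const 0 , names-⊥ λ _ → refl
                           ; ⊤ˢ → const 1 , names-⊤ λ z → contradiction (z 0) λ () }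
  }

evens odds : Baire → Baire
evens p k = p (2 ℕ.* k)
odds  p k = p (suc (2 ℕ.* k))

⟨_,_⟩ : Baire → Baire → Baire
⟨ p , q ⟩ 0             = p 0
⟨ p , q ⟩ 1             = q 0
⟨ p , q ⟩ (suc (suc k)) = ⟨ p ∘ suc , q ∘ suc ⟩ k

evens-⟨⟩ : ∀ p q → evens ⟨ p , q ⟩ ≗ p
evens-⟨⟩ p q zero    = refl
evens-⟨⟩ p q (suc k) rewrite ℕ.+-suc k (k ℕ.+ 0) = evens-⟨⟩ (p ∘ suc) (q ∘ suc) k

odds-⟨⟩ : ∀ p q → odds ⟨ p , q ⟩ ≗ q
odds-⟨⟩ p q zero    = refl
odds-⟨⟩ p q (suc k) rewrite ℕ.+-suc k (k ℕ.+ 0) = odds-⟨⟩ (p ∘ suc) (q ∘ suc) k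

⟨⟩-cong : ∀ {p p′ q q′} → p ≗ p′ → q ≗ q′ → ⟨ p , q ⟩ ≗ ⟨ p′ , q′ ⟩
⟨⟩-cong p≗ q≗ 0             = p≗ 0
⟨⟩-cong p≗ q≗ 1             = q≗ 0
⟨⟩-cong p≗ q≗ (suc (suc k)) = ⟨⟩-cong (p≗ ∘ suc) (q≗ ∘ suc) k

infixr 2 _×ʳ_

_×ʳ_ : RepresentedSpace c e n → RepresentedSpace c′ e′ n′ →
       RepresentedSpace (c ⊔ c′) (e ⊔ e′) (n ⊔ n′)
X ×ʳ Y = record
  { points             = ×-setoid (points X) (points Y)
  ; names              = λ p (x , y) → names X (evens p) x × names Y (odds p) y
  ; names-resp         = λ p≗q (x≈ , y≈) (nx , ny) →
      names-resp X (λ k → p≗q (2 ℕ.* k)) x≈ nx , names-resp Y (λ k → p≗q (suc (2 ℕ.* k))) y≈ ny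
  ; names-singleValued = λ (nx , ny) (nx′ , ny′) →
      names-singleValued X nx nx′ , names-singleValued Y ny ny′
  ; names-surjective   = λ (x , y) →
      let (p , nx) = names-surjective X x
          (q , ny) = names-surjective Y y
      in ⟨ p , q ⟩ , names-resp X (sym ∘ evens-⟨⟩ p q) (Setoid.refl (points X)) nx
                   , names-resp Y (sym ∘ odds-⟨⟩ p q) (Setoid.refl (points Y)) ny
  }

module _ (X : RepresentedSpace c e n) (Y : RepresentedSpace c′ e′ n′) where

  -- A partial map on Baire space is continuous iff it is a restriction of a
  -- map computed by a machine relative to some oracle.
  ContinuouslyRealisable : Map X Y → Set (c ⊔ n ⊔ n′)
  ContinuouslyRealisable f = ∃₂ λ M α → Realises X Y (λ p → Φ M ⟨ α , p ⟩) f

  -- The oracle p ∘ suc is at the even positions, the name of the argument at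
  -- the odd ones.
  CodesRealiser : Baire → Map X Y → Set (c ⊔ n ⊔ n′)
  CodesRealiser p = Realises X Y (λ q → Φ (machine (p 0)) ⟨ p ∘ suc , q ⟩)

infixl 8 _^ʳ_

_^ʳ_ : RepresentedSpace c′ e′ n′ → RepresentedSpace c e n →
       RepresentedSpace (c ⊔ e ⊔ n ⊔ c′ ⊔ e′ ⊔ n′) (c ⊔ e′) (c ⊔ n ⊔ n′)
Y ^ʳ X = record
  { points = record
    { Carrier       = Σ (Map X Y) (ContinuouslyRealisable X Y)
    ; _≈_           = λ (f , _) (g , _) → ∀ x → Func.to f x ≈ʸ Func.to g x
    ; isEquivalence = record
      { refl  = λ _ → Y.refl
      ; sym   = λ eq x → Y.sym (eq x)
      ; trans = λ eq eq′ x → Y.trans (eq x) (eq′ x)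
      }
    }
  ; names              = λ p (f , _) → CodesRealiser X Y p f
  ; names-resp         = λ {p} {q} {f} {g} → resp {p} {q} {proj₁ f} {proj₁ g}
  ; names-singleValued = λ {p} {f} {g} → unique {p} {proj₁ f} {proj₁ g}
  ; names-surjective   = λ (f , M , α , r) → surjective f M α r
  }
  where
  module Y = Setoid (points Y)
  _≈ʸ_ = _≈_ Y

  resp : ∀ {p q} {f g : Map X Y} → p ≗ q → (∀ x → Func.to f x ≈ʸ Func.to g x) →
         CodesRealiser X Y p f → CodesRealiser X Y q g
  resp {p} {q} p≗q f≈g r {x} {s} nx rewrite sym (p≗q 0) =
    let (t , h , ny) = r nx
    in t , (λ k → Halts-cong (⟨⟩-cong (p≗q ∘ suc) (λ _ → refl)) (h k))
         , names-resp Y (λ _ → refl) (f≈g x) ny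

  unique : ∀ {p} {f g : Map X Y} → CodesRealiser X Y p f → CodesRealiser X Y p g →
           ∀ x → Func.to f x ≈ʸ Func.to g x
  unique r r′ x =
    let (s , nx)       = names-surjective X x
        (t , h , ny)    = r nx
        (t′ , h′ , ny′) = r′ nx
    in names-singleValued Y
         (names-resp Y (λ k → Halts-deterministic (h k) (h′ k)) Y.refl ny) ny′

  surjective : ∀ f M α → Realises X Y (λ p → Φ M ⟨ α , p ⟩) f → ∃[ p ] CodesRealiser X Y p f
  surjective f M α r with machineIndex M
  ... | i , refl = (λ { zero → i ; (suc k) → α k }) , r

𝒪 : (X : RepresentedSpace c e n) → RepresentedSpace (c ⊔ e ⊔ n) c (c ⊔ n)
𝒪 X = 𝕊 ^ʳ X

module _ (X : RepresentedSpace c e n) where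

  infix 4 _∈_

  _∈_ : Carrier X → Carrier (𝒪 X) → Set
  x ∈ (χ , _) = Func.to χ x ≡ ⊤ˢ

  NonEmpty : Carrier (𝒪 X) → Set c
  NonEmpty U = ∃[ x ] x ∈ U

module _ (X : RepresentedSpace c e n) where

  ComputablyOpen : Pred (Carrier X) ℓ → Set (c ⊔ e ⊔ n ⊔ ℓ)
  ComputablyOpen P = Σ[ U ∈ Carrier (𝒪 X) ]
    (∀ x → _∈_ X x U ⇔ P x) × (∃[ p ] ComputableSequence p × names (𝒪 X) p U)

module _ (X : RepresentedSpace c e n) where

  ComputablyOvert : Set (c ⊔ e ⊔ n)
  ComputablyOvert = ComputablyOpen (𝒪 X) (NonEmpty X)

  ComputablySeparable : Set (c ⊔ e ⊔ n)
  ComputablySeparable = Σ[ s ∈ Map ℕʳ X ] Computable ℕʳ X s ×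
    (∀ U → NonEmpty X U → ∃[ k ] _∈_ X (Func.to s k) U)

record Ideal (_≪_ : Rel ℕ 0ℓ) : Set₁ where
  field
    member   : Pred ℕ 0ℓ
    nonEmpty : ∃[ x ] member x
    lower    : ∀ {x y} → x ≪ y → member y → member x
    directed : ∀ {x y} → member x → member y → ∃[ z ] member z × x ≪ z × y ≪ z

-- That every ideal has an enumeration is not provable constructively.
module _ (lem : ExcludedMiddle 0ℓ) where

  𝐈 : Rel ℕ 0ℓ → RepresentedSpace (lsuc 0ℓ) 0ℓ 0ℓ
  𝐈 _≪_ = record
    { points = record
      { Carrier       = Ideal _≪_
      ; _≈_           = λ I J → ∀ k → member I k ⇔ member J k
      ; isEquivalence = record
        { refl  = λ _ → mk⇔ (λ x → x) (λ x → x)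
        ; sym   = λ eq k → mk⇔ (from (eq k)) (to (eq k))
        ; trans = λ eq eq′ k → mk⇔ (to (eq′ k) ∘ to (eq k)) (from (eq k) ∘ from (eq′ k))
        }
      }
    ; names              = λ p I → ∀ k → member I k ⇔ (∃[ i ] p i ≡ k)
    ; names-resp         = λ p≗q I≈J eq k → mk⇔
        (λ m → let (i , h) = to (eq k) (from (I≈J k) m) in i , trans (sym (p≗q i)) h)
        (λ (i , h) → to (I≈J k) (from (eq k) (i , trans (p≗q i) h)))
    ; names-singleValued = λ eq eq′ k →
        mk⇔ (from (eq′ k) ∘ to (eq k)) (from (eq k) ∘ to (eq′ k))
    ; names-surjective   = λ I → enumerate I , λ k → mk⇔ (complete I k) (sound I k)
    }
    where
    open Equivalence using (to; from)
    open Ideal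

    choose : (I : Ideal _≪_) (i : ℕ) → Dec (member I i) → ℕ
    choose I i (yes _) = i
    choose I i (no _)  = proj₁ (nonEmpty I)

    enumerate : Ideal _≪_ → Baire
    enumerate I i = choose I i lem

    complete : ∀ I k → member I k → ∃[ i ] enumerate I i ≡ k
    complete I k m = k , go lem
      where
      go : (d : Dec (member I k)) → choose I k d ≡ k
      go (yes _) = refl
      go (no ¬m) = contradiction m ¬m

    sound : ∀ I k → (∃[ i ] enumerate I i ≡ k) → member I k
    sound I k (i , refl) = go lem
      where
      go : (d : Dec (member I i)) → member I (choose I i d)
      go (yes m) = m
      go (no _)  = proj₂ (nonEmpty I)

  module _ (X : RepresentedSpace c e n) where

    PrecomputablyQuasiPolish : Set (lsuc 0ℓ ⊔ c ⊔ e ⊔ n)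
    PrecomputablyQuasiPolish = Σ (Rel ℕ 0ℓ) λ _≪_ →
      ComputablyEnumerable₂ _≪_ × Transitive _≪_ × X ≅ 𝐈 _≪_

    ComputablyQuasiPolish : Set (lsuc 0ℓ ⊔ c ⊔ e ⊔ n)
    ComputablyQuasiPolish = PrecomputablyQuasiPolish × ComputablyOvert X

infix 8 2⁻_

2⁻_ : ℕ → ℚ
2⁻ k = (ℤ.+ 1 / (2 ^ k)) {{ℕ.m^n≢0 2 k}}

open +-*-Solver

-- Linear arithmetic: an inequality follows from one with the same difference.
by-difference : ∀ {p q a b} → p ≤ q → b - a ≡ q - p → a ≤ b
by-difference {p} {q} {a} {b} p≤q eq = begin
  a             ≡⟨ solve 2 (λ a p → a := p :+ (a :- p)) refl a p ⟩
  p + (a - p)   ≤⟨ ℚ.+-monoˡ-≤ (a - p) p≤q ⟩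
  q + (a - p)   ≡⟨ solve 3 (λ a p q → q :+ (a :- p) := a :+ (q :- p)) refl a p q ⟩
  a + (q - p)   ≡⟨ cong (a +_) (sym eq) ⟩
  a + (b - a)   ≡⟨ solve 2 (λ a b → a :+ (b :- a) := b) refl a b ⟩
  b             ∎
  where open ℚ.≤-Reasoning

by-difference-< : ∀ {p q a b} → p < q → b - a ≡ q - p → a < b
by-difference-< {p} {q} {a} {b} p<q eq = begin-strict
  a             ≡⟨ solve 2 (λ a p → a := p :+ (a :- p)) refl a p ⟩
  p + (a - p)   <⟨ ℚ.+-monoˡ-< (a - p) p<q ⟩
  q + (a - p)   ≡⟨ solve 3 (λ a p q → q :+ (a :- p) := a :+ (q :- p)) refl a p q ⟩
  a + (q - p)   ≡⟨ cong (a +_) (sym eq) ⟩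
  a + (b - a)   ≡⟨ solve 2 (λ a b → a :+ (b :- a) := b) refl a b ⟩
  b             ∎
  where open ℚ.≤-Reasoning

toℚᵘ-2⁻ : ∀ k → toℚᵘ (2⁻ k) ℚᵘ.≃ (ℤ.+ 1 ℚᵘ./ (2 ^ k)) {{ℕ.m^n≢0 2 k}}
toℚᵘ-2⁻ k with 2 ^ k | ℕ.m^n≢0 2 k
... | suc d | _ = ℚ.toℚᵘ-fromℚᵘ (mkℚᵘ (ℤ.+ 1) d)

n<2^n : ∀ k → k ℕ.< 2 ^ k
n<2^n zero    = s≤s z≤n
n<2^n (suc k) = ℕ.≤-trans (ℕ.+-mono-≤ (ℕ.m^n>0 2 k) (n<2^n k))
                  (ℕ.≤-reflexive (cong (2 ^ k ℕ.+_) (sym (ℕ.+-identityʳ (2 ^ k)))))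

2⁻-positive : ∀ k → 0ℚ < 2⁻ k
2⁻-positive k = ℚ.toℚᵘ-cancel-< (ℚᵘ.<-respʳ-≃ (ℚᵘ.≃-sym (toℚᵘ-2⁻ k)) lemma)
  where
  lemma : toℚᵘ 0ℚ ℚᵘ.< (ℤ.+ 1 ℚᵘ./ (2 ^ k)) {{ℕ.m^n≢0 2 k}}
  lemma with 2 ^ k | ℕ.m^n≢0 2 k
  ... | suc d | _ = ℚᵘ.*<* (ℤ.+<+ (s≤s z≤n))

2⁻-half : ∀ k → 2⁻ suc k + 2⁻ suc k ≡ 2⁻ k
2⁻-half k = ℚ.toℚᵘ-injective (begin
  toℚᵘ (2⁻ suc k + 2⁻ suc k)              ≈⟨ ℚ.toℚᵘ-homo-+ (2⁻ suc k) (2⁻ suc k) ⟩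
  toℚᵘ (2⁻ suc k) ℚᵘ.+ toℚᵘ (2⁻ suc k)    ≈⟨ ℚᵘ.+-cong (toℚᵘ-2⁻ (suc k)) (toℚᵘ-2⁻ (suc k)) ⟩
  h ℚᵘ.+ h                                ≈⟨ lemma ⟩
  (ℤ.+ 1 ℚᵘ./ (2 ^ k)) {{ℕ.m^n≢0 2 k}}      ≈⟨ ℚᵘ.≃-sym (toℚᵘ-2⁻ k) ⟩
  toℚᵘ (2⁻ k)                             ∎)
  where
  open import Relation.Binary.Reasoning.Setoid ℚᵘ.≃-setoid
  h = (ℤ.+ 1 ℚᵘ./ (2 ^ suc k)) {{ℕ.m^n≢0 2 (suc k)}}
  lemma : h ℚᵘ.+ h ℚᵘ.≃ (ℤ.+ 1 ℚᵘ./ (2 ^ k)) {{ℕ.m^n≢0 2 k}}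
  lemma with 2 ^ k | ℕ.m^n≢0 2 k | ℕ.m^n≢0 2 (suc k)
  ... | suc d | _ | _ = *≡* (cong ℤ.+_ (eq (suc d)))
    where
    open import Data.Nat.Tactic.RingSolver using (solve-∀)
    eq : ∀ m → (1 ℕ.* (m ℕ.+ (m ℕ.+ 0)) ℕ.+ 1 ℕ.* (m ℕ.+ (m ℕ.+ 0))) ℕ.* m
             ≡ 1 ℕ.* ((m ℕ.+ (m ℕ.+ 0)) ℕ.* (m ℕ.+ (m ℕ.+ 0)))
    eq = solve-∀

archimedean : ∀ {q} → 0ℚ < q → ∃[ k ] 2⁻ k < q
archimedean {q@(mkℚ (ℤ.+ suc a) d _)} 0<q =
  suc d , ℚ.toℚᵘ-cancel-< (ℚᵘ.<-respˡ-≃ (ℚᵘ.≃-sym (toℚᵘ-2⁻ (suc d))) lemma)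
  where
  lemma : (ℤ.+ 1 ℚᵘ./ (2 ^ suc d)) {{ℕ.m^n≢0 2 (suc d)}} ℚᵘ.< toℚᵘ q
  lemma with 2 ^ suc d | ℕ.m^n≢0 2 (suc d) | n<2^n (suc d)
  ... | suc m | _ | d<m = ℚᵘ.*<* (ℤ.+<+ (ℕ.<-≤-trans
          (ℕ.≤-<-trans (ℕ.≤-reflexive (ℕ.+-identityʳ (suc d))) d<m) (ℕ.m≤m+n (suc m) (a ℕ.* suc m))))
archimedean {mkℚ (ℤ.+ 0) d _}      (*<* (ℤ.+<+ ()))
archimedean {mkℚ ℤ.-[1+ a ] d _} (*<* ())

≤-limit : ∀ {a b} → (∀ k → a ≤ b + 2⁻ k) → a ≤ b
≤-limit {a} {b} bound with ℚ._≤?_ a b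
... | yes a≤b = a≤b
... | no a≰b =
  let 0<a-b = by-difference-< {a = 0ℚ} {b = a - b} (ℚ.≰⇒> a≰b)
                (solve 2 (λ a b → a :- b :- con 0ℚ := a :- b) refl a b)
      (k , small) = archimedean 0<a-b
      b+2⁻k<a      = by-difference-< small
                       (solve 3 (λ a b e → a :- (b :+ e) := a :- b :- e) refl a b (2⁻ k))
  in contradiction (ℚ.<-≤-trans b+2⁻k<a (bound k)) (ℚ.<-irrefl refl)

∣-∣≤⇒≤ : ∀ {p q r} → ∣ p - q ∣ ≤ r → p ≤ q + r
∣-∣≤⇒≤ {p} {q} {r} h = by-difference (ℚ.≤-trans p≤∣p∣ h)
    (solve 3 (λ p q r → q :+ r :- p := r :- (p :- q)) refl p q r)
  where
  p≤∣p∣ : p - q ≤ ∣ p - q ∣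
  p≤∣p∣ with ℚ.∣p∣≡p∨∣p∣≡-p (p - q)
  ... | inj₁ eq = ℚ.≤-reflexive (sym eq)
  ... | inj₂ eq = ℚ.≤-trans (by-difference {p = 0ℚ} {q = ∣ p - q ∣ + ∣ p - q ∣}
                     (ℚ.+-mono-≤ (ℚ.0≤∣p∣ (p - q)) (ℚ.0≤∣p∣ (p - q)))
                     (trans (cong (λ z → z - (p - q)) eq) (trans
                        (solve 1 (λ x → :- x :- x := (:- x :+ :- x) :- con 0ℚ) refl (p - q))
                        (cong (λ z → z + z - 0ℚ) (sym eq))))) ℚ.≤-refl

≤⇒∣-∣≤ : ∀ {p q r} → p ≤ q + r → q ≤ p + r → ∣ p - q ∣ ≤ r
≤⇒∣-∣≤ {p} {q} {r} h h′ with ℚ.∣p∣≡p∨∣p∣≡-p (p - q)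
... | inj₁ eq rewrite eq = by-difference h
        (solve 3 (λ p q r → r :- (p :- q) := q :+ r :- p) refl p q r)
... | inj₂ eq rewrite eq = by-difference h′
        (solve 3 (λ p q r → r :- :- (p :- q) := p :+ r :- q) refl p q r)

0≤2⁻ : ∀ k → 0ℚ ≤ 2⁻ k
0≤2⁻ k = ℚ.<⇒≤ (2⁻-positive k)

2⁻-quarter : ∀ k → 2⁻ k ≡ (2⁻ (2 ℕ.+ k) + 2⁻ (2 ℕ.+ k)) + (2⁻ (2 ℕ.+ k) + 2⁻ (2 ℕ.+ k))
2⁻-quarter k = sym (trans (cong₂ _+_ (2⁻-half (suc k)) (2⁻-half (suc k))) (2⁻-half k))

2⁻-suc-< : ∀ k → 2⁻ suc k < 2⁻ k
2⁻-suc-< k = ℚ.<-≤-trans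
  (by-difference-< {a = 2⁻ suc k} {b = 2⁻ suc k + 2⁻ suc k} (2⁻-positive (suc k)) (solve 1 (λ h → h :+ h :- h := h :- con 0ℚ) refl (2⁻ suc k)))
  (ℚ.≤-reflexive (2⁻-half k))

2⁻-suc²-≤ : ∀ k → 2⁻ (2 ℕ.+ k) ≤ 2⁻ k
2⁻-suc²-≤ k = ℚ.<⇒≤ (ℚ.<-trans (2⁻-suc-< (suc k)) (2⁻-suc-< k))

≤-limit₂ : ∀ {a b} → (∀ k → a ≤ b + (2⁻ k + 2⁻ k)) → a ≤ b
≤-limit₂ {a} {b} bound = ≤-limit λ k →
  ℚ.≤-trans (bound (suc k)) (ℚ.≤-reflexive (cong (b +_) (2⁻-half k)))

≤-limit₈ : ∀ {a b} → (∀ k → a ≤ b + (((2⁻ k + 2⁻ k) + (2⁻ k + 2⁻ k)) + ((2⁻ k + 2⁻ k) + (2⁻ k + 2⁻ k)))) → a ≤ b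
≤-limit₈ {a} {b} bound = ≤-limit₂ λ k →
  ℚ.≤-trans (bound (2 ℕ.+ k)) (ℚ.≤-reflexive (cong (λ z → b + (z + z)) (sym (2⁻-quarter k))))

∣-∣-shift : ∀ p q r v → p ≤ q + r → q ≤ p + r → ∣ p - v ∣ ≤ ∣ q - v ∣ + r
∣-∣-shift p q r v h h′ = ≤⇒∣-∣≤ {p} {v}
  (by-difference (ℚ.+-mono-≤ h q≤) (solve 5 (λ p q r v w →
     v :+ (w :+ r) :- p := (q :+ r :+ (v :+ w)) :- (p :+ q)) refl p q r v ∣ q - v ∣))
  (by-difference (ℚ.+-mono-≤ h′ v≤) (solve 5 (λ p q r v w →
     p :+ (w :+ r) :- v := (p :+ r :+ (q :+ w)) :- (q :+ v)) refl p q r v ∣ q - v ∣))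
  where
  q≤ : q ≤ v + ∣ q - v ∣
  q≤ = ∣-∣≤⇒≤ {q} {v} ℚ.≤-refl
  v≤ : v ≤ q + ∣ q - v ∣
  v≤ = ∣-∣≤⇒≤ {v} {q} (ℚ.≤-reflexive (trans (sym (ℚ.∣-p∣≡∣p∣ (v - q)))
         (cong ∣_∣ (solve 2 (λ v q → :- (v :- q) := q :- v) refl v q))))

-- The real number presented is the limit of seq, which is within 2⁻ k of
-- seq k.
record ℝ : Set where
  constructor real
  field
    seq     : ℕ → ℚ
    regular : ∀ m n → ∣ seq m - seq n ∣ ≤ 2⁻ m + 2⁻ n

open ℝ

infix 4 _≤ᴿ_ _<ᴿ_ _≈ᴿ_
infixl 6 _+ᴿ_

-- x ≤ᴿ y says that no lower bound seq x m - 2⁻ m of x exceeds an upper bound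
-- seq y n + 2⁻ n of y; x <ᴿ y is its negation with the arguments swapped.
_≤ᴿ_ _<ᴿ_ _≈ᴿ_ : ℝ → ℝ → Set
x ≤ᴿ y = ∀ m n → seq x m ≤ seq y n + (2⁻ m + 2⁻ n)
x <ᴿ y = ∃₂ λ m n → seq x m + (2⁻ m + 2⁻ n) < seq y n
x ≈ᴿ y = x ≤ᴿ y × y ≤ᴿ x

regular-≤ : ∀ x m n → seq x m ≤ seq x n + (2⁻ m + 2⁻ n)
regular-≤ x m n = ∣-∣≤⇒≤ (regular x m n)

real-≤ : (s : ℕ → ℚ) → (∀ m n → s m ≤ s n + (2⁻ m + 2⁻ n)) → ℝ
real-≤ s r = real s λ m n →
  ≤⇒∣-∣≤ (r m n) (ℚ.≤-trans (r n m) (ℚ.≤-reflexive (cong (s m +_) (ℚ.+-comm (2⁻ n) (2⁻ m)))))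

ι : ℚ → ℝ
ι q = real-≤ (const q) λ m n → by-difference (ℚ.+-mono-≤ (0≤2⁻ m) (0≤2⁻ n))
  (solve 3 (λ q a b → q :+ (a :+ b) :- q := a :+ b :- (con 0ℚ :+ con 0ℚ)) refl q (2⁻ m) (2⁻ n))

_+ᴿ_ : ℝ → ℝ → ℝ
x +ᴿ y = real-≤ (λ k → seq x (suc k) + seq y (suc k)) λ m n →
  lemma (seq x (suc m)) (seq y (suc m)) (seq x (suc n)) (seq y (suc n)) (2⁻ suc m) (2⁻ suc n)
    (2⁻-half m) (2⁻-half n) (regular-≤ x (suc m) (suc n)) (regular-≤ y (suc m) (suc n))
  where
  lemma : ∀ a b a′ b′ e f {m n} → e + e ≡ m → f + f ≡ n → a ≤ a′ + (e + f) → b ≤ b′ + (e + f) →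
          a + b ≤ a′ + b′ + (m + n)
  lemma a b a′ b′ e f refl refl h h′ = by-difference (ℚ.+-mono-≤ h h′)
    (solve 6 (λ a b a′ b′ e f → a′ :+ b′ :+ (e :+ e :+ (f :+ f)) :- (a :+ b)
                := a′ :+ (e :+ f) :+ (b′ :+ (e :+ f)) :- (a :+ b)) refl a b a′ b′ e f)

-- The absolute value of x - v.
distance : ℝ → ℚ → ℝ
distance x v = real-≤ (λ k → ∣ seq x k - v ∣) λ m n → ∣-∣-shift (seq x m) (seq x n) (2⁻ m + 2⁻ n) v (regular-≤ x m n)
  (ℚ.≤-trans (regular-≤ x n m) (ℚ.≤-reflexive (cong (seq x m +_) (ℚ.+-comm (2⁻ n) (2⁻ m)))))

≤ᴿ-refl : ∀ {x} → x ≤ᴿ x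
≤ᴿ-refl {x} = regular-≤ x

≤ᴿ-trans : ∀ {x y z} → x ≤ᴿ y → y ≤ᴿ z → x ≤ᴿ z
≤ᴿ-trans {x} {y} {z} h h′ m n = ≤-limit₂ λ k → by-difference (ℚ.+-mono-≤ (h m k) (h′ k n))
  (solve 6 (λ x y z m n k → z :+ (m :+ n) :+ (k :+ k) :- x
              := y :+ (m :+ k) :+ (z :+ (k :+ n)) :- (x :+ y)) refl
    (seq x m) (seq y k) (seq z n) (2⁻ m) (2⁻ n) (2⁻ k))

≈ᴿ-refl : ∀ {x} → x ≈ᴿ x
≈ᴿ-refl {x} = ≤ᴿ-refl {x} , ≤ᴿ-refl {x}

≤ι-intro : ∀ x q → (∀ m → seq x m ≤ q + 2⁻ m) → x ≤ᴿ ι q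
≤ι-intro x q h m n = by-difference (ℚ.+-mono-≤ (h m) (0≤2⁻ n))
  (solve 4 (λ x q a b → q :+ (a :+ b) :- x := q :+ a :+ b :- (x :+ con 0ℚ)) refl
    (seq x m) q (2⁻ m) (2⁻ n))

≤ι-elim : ∀ x q → x ≤ᴿ ι q → ∀ m → seq x m ≤ q + 2⁻ m
≤ι-elim x q h m = ≤-limit λ n → by-difference (h m n)
  (solve 4 (λ x q a b → q :+ a :+ b :- x := q :+ (a :+ b) :- x) refl (seq x m) q (2⁻ m) (2⁻ n))

≤ι-upper : ∀ x k → x ≤ᴿ ι (seq x k + 2⁻ k)
≤ι-upper x k = ≤ι-intro x (seq x k + 2⁻ k) λ m → by-difference (regular-≤ x m k)
  (solve 4 (λ x y a b → y :+ b :+ a :- x := y :+ (a :+ b) :- x) refl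
    (seq x m) (seq x k) (2⁻ m) (2⁻ k))

≤ι-weaken : ∀ {x q r} → x ≤ᴿ ι q → q ≤ r → x ≤ᴿ ι r
≤ι-weaken h q≤r m n = ℚ.≤-trans (h m n) (ℚ.+-monoˡ-≤ (2⁻ m + 2⁻ n) q≤r)

<ι⇒≤ι : ∀ {x q} → x <ᴿ ι q → ∃[ r ] r < q × x ≤ᴿ ι r
<ι⇒≤ι {x} {q} (m , n , h) = seq x m + 2⁻ m ,
  by-difference-< (ℚ.+-mono-< h (2⁻-positive n))
    (solve 4 (λ x q a b → q :- (x :+ a) := q :+ b :- (x :+ (a :+ b) :+ con 0ℚ)) refl
      (seq x m) q (2⁻ m) (2⁻ n)) ,
  ≤ι-upper x m

≤ι⇒<ι : ∀ {x q r} → x ≤ᴿ ι r → r < q → x <ᴿ ι q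
≤ι⇒<ι {x} {q} {r} h r<q =
  let (k , small) = archimedean {q - r} (by-difference-< r<q
                      (solve 2 (λ q r → q :- r :- con 0ℚ := q :- r) refl q r))
  in 2 ℕ.+ k , 2 ℕ.+ k ,
     lemma (seq x (2 ℕ.+ k)) (2⁻ (2 ℕ.+ k)) (2⁻-quarter k) (≤ι-elim x r h (2 ℕ.+ k)) (0≤2⁻ (2 ℕ.+ k)) small
  where
  lemma : ∀ a e {k} → k ≡ (e + e) + (e + e) → a ≤ r + e → 0ℚ ≤ e → k < q - r → a + (e + e) < q
  lemma a e refl h₁ h₂ h₃ = by-difference-< (ℚ.+-mono-<-≤ h₃ (ℚ.+-mono-≤ h₁ h₂))
    (solve 4 (λ a e q r → q :- (a :+ (e :+ e))
       := q :- r :+ (r :+ e :+ e) :- (((e :+ e) :+ (e :+ e)) :+ (a :+ con 0ℚ))) refl a e q r)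

-- The numbering of ℚ by fractions (i - j) / (d + 1).
ν : ℕ → ℚ
ν k = let (a , d) = unpair k
          (i , j) = unpair a
      in (i ⊖ j) / suc d

ν-surjective : ∀ q → ∃[ k ] ν k ≡ q
ν-surjective q@(mkℚ num d _) = let (i , j , eq) = difference num in pair (pair i j) d , lemma i j eq
  where
  difference : ∀ z → ∃₂ λ i j → i ⊖ j ≡ z
  difference (ℤ.+ i)      = i , 0 , refl
  difference ℤ.-[1+ j ] = 0 , suc j , refl
  lemma : ∀ i j → i ⊖ j ≡ num → ν (pair (pair i j) d) ≡ q
  lemma i j eq rewrite unpair-pair (pair i j) d | unpair-pair i j | eq = ℚ.↥p/↧p≡p q

ℝʳ : RepresentedSpace 0ℓ 0ℓ 0ℓ
ℝʳ = record
  { points = record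
    { Carrier       = ℝ
    ; _≈_           = _≈ᴿ_
    ; isEquivalence = record
      { refl  = λ {x} → ≈ᴿ-refl {x}
      ; sym   = λ (h , h′) → h′ , h
      ; trans = λ {x} {y} {z} (h , h′) (k , k′) → ≤ᴿ-trans {x} {y} {z} h k , ≤ᴿ-trans {z} {y} {x} k′ h′
      }
    }
  ; names              = Names
  ; names-resp         = λ {p} {q} {x} {y} → respects {p} {q} {x} {y}
  ; names-singleValued = λ {p} {x} {y} nx ny → below {p} {x} {y} nx ny , below {p} {y} {x} ny nx
  ; names-surjective   = λ x → (λ k → proj₁ (ν-surjective (seq x (suc k)))) , named x
  }
  where
  Names : Baire → ℝ → Set
  Names p x = ∀ k → distance x (ν (p k)) <ᴿ ι (2⁻ k)

  respects : ∀ {p q x y} → p ≗ q → x ≈ᴿ y → Names p x → Names q y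
  respects {p} {q} {x} {y} p≗q (x≤y , y≤x) nx k rewrite sym (p≗q k) =
    let (r , r< , h) = <ι⇒≤ι {distance x (ν (p k))} (nx k)
    in ≤ι⇒<ι {distance y (ν (p k))}
         (≤ᴿ-trans {distance y (ν (p k))} {distance x (ν (p k))} {ι r} closer h) r<
    where
    closer : distance y (ν (p k)) ≤ᴿ distance x (ν (p k))
    closer m n = ∣-∣-shift (seq y m) (seq x n) (2⁻ m + 2⁻ n) (ν (p k)) (y≤x m n) (ℚ.≤-trans (x≤y n m)
      (ℚ.≤-reflexive (cong (seq y m +_) (ℚ.+-comm (2⁻ n) (2⁻ m)))))

  below : ∀ {p x y} → Names p x → Names p y → x ≤ᴿ y
  below {p} {x} {y} nx ny m n = ≤-limit₂ λ k →
    let v            = ν (p k)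
        (r , r< , h)  = <ι⇒≤ι {distance x v} (nx k)
        (r′ , r<′ , h′) = <ι⇒≤ι {distance y v} (ny k)
        x≤ = ∣-∣≤⇒≤ {seq x m} {v} (≤ι-elim (distance x v) r h m)
        y≥ = ∣-∣≤⇒≤ {v} {seq y n} (ℚ.≤-trans (ℚ.≤-reflexive (trans (sym (ℚ.∣-p∣≡∣p∣ (v - seq y n)))
               (cong ∣_∣ (solve 2 (λ v q → :- (v :- q) := q :- v) refl v (seq y n)))))
               (≤ι-elim (distance y v) r′ h′ n))
    in by-difference (ℚ.+-mono-≤ (ℚ.+-mono-≤ x≤ y≥) (ℚ.+-mono-≤ (ℚ.<⇒≤ r<) (ℚ.<⇒≤ r<′)))
         (solve 8 (λ x y v r r′ a b e → y :+ (a :+ b) :+ (e :+ e) :- x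
             := v :+ (r :+ a) :+ (y :+ (r′ :+ b)) :+ (e :+ e) :- (x :+ v :+ (r :+ r′)))
           refl (seq x m) (seq y n) v r r′ (2⁻ m) (2⁻ n) (2⁻ k))

  named : ∀ x → Names (λ k → proj₁ (ν-surjective (seq x (suc k)))) x
  named x k rewrite proj₂ (ν-surjective (seq x (suc k))) =
    ≤ι⇒<ι {distance x (seq x (suc k))}
      (≤ι-intro (distance x (seq x (suc k))) (2⁻ suc k) λ m → ℚ.≤-trans (regular x m (suc k))
        (ℚ.≤-reflexive (ℚ.+-comm (2⁻ m) (2⁻ suc k))))
      (2⁻-suc-< k)

record Pseudometric : Set where
  field
    d        : ℕ → ℕ → ℝ
    zero-≈   : ∀ x → d x x ≈ᴿ ι 0ℚ
    nonNeg   : ∀ x y → ι 0ℚ ≤ᴿ d x y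
    symm     : ∀ x y → d x y ≈ᴿ d y x
    triangle-≤ : ∀ x y z → d x z ≤ᴿ d x y +ᴿ d y z

  asMap : Map (ℕʳ ×ʳ ℕʳ) ℝʳ
  asMap = record
    { to   = λ (x , y) → d x y
    ; cong = λ { {x , y} (refl , refl) → ≈ᴿ-refl {d x y} }
    }

module Completion (D : Pseudometric) where
  open Pseudometric D

  -- The limit of a sequence converging at a fixed rate.
  record Point : Set where
    constructor point
    field
      approx : ℕ → ℕ
      cauchy : ∀ m n → d (approx m) (approx n) ≤ᴿ ι (2⁻ m + 2⁻ n)

  open Point

  symm-ι : ∀ x y q → d x y ≤ᴿ ι q → d y x ≤ᴿ ι q
  symm-ι x y q h = ≤ᴿ-trans {d y x} {d x y} {ι q} (proj₁ (symm y x)) h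

  triangle-ι : ∀ x y z a b → d x y ≤ᴿ ι a → d y z ≤ᴿ ι b → d x z ≤ᴿ ι (a + b)
  triangle-ι x y z a b h h′ = ≤ι-intro (d x z) (a + b) λ m → ≤-limit₂ λ n →
    lemma (seq (d x z) m) (seq (d x y) (suc n)) (seq (d y z) (suc n)) (2⁻ m) (2⁻ suc n) (2⁻-half n)
      (triangle-≤ x y z m n) (≤ι-elim (d x y) a h (suc n)) (≤ι-elim (d y z) b h′ (suc n))
    where
    lemma : ∀ u v w m e {n} → e + e ≡ n → u ≤ v + w + (m + n) → v ≤ a + e → w ≤ b + e →
            u ≤ a + b + m + (n + n)
    lemma u v w m e refl h₁ h₂ h₃ = by-difference (ℚ.+-mono-≤ h₁ (ℚ.+-mono-≤ h₂ h₃))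
      (solve 7 (λ u v w m e a b → a :+ b :+ m :+ ((e :+ e) :+ (e :+ e)) :- u
         := v :+ w :+ (m :+ (e :+ e)) :+ (a :+ e :+ (b :+ e)) :- (u :+ (v :+ w)))
       refl u v w m e a b)

  around : ∀ x y m n q → d (approx x n) (approx y n) ≤ᴿ ι q →
           d (approx x m) (approx y m) ≤ᴿ ι ((2⁻ m + 2⁻ n) + (q + (2⁻ n + 2⁻ m)))
  around x y m n q h =
    triangle-ι (approx x m) (approx x n) (approx y m) (2⁻ m + 2⁻ n) (q + (2⁻ n + 2⁻ m)) (cauchy x m n)
      (triangle-ι (approx x n) (approx y n) (approx y m) q (2⁻ n + 2⁻ m) h (cauchy y n m))

  -- The extension of d to the completion: the limit of the distances between
  -- approximations.
  d̂ : Point → Point → ℝ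
  d̂ x y = real-≤ (λ k → seq (d (approx x (2 ℕ.+ k)) (approx y (2 ℕ.+ k))) (2 ℕ.+ k)) λ m n →
    let q = seq (d (approx x (2 ℕ.+ n)) (approx y (2 ℕ.+ n))) (2 ℕ.+ n)
        f = 2⁻ (2 ℕ.+ n)
        e = 2⁻ (2 ℕ.+ m)
    in lemma (seq (d (approx x (2 ℕ.+ m)) (approx y (2 ℕ.+ m))) (2 ℕ.+ m)) q e f
         (2⁻-quarter m) (2⁻-quarter n) (0≤2⁻ (2 ℕ.+ m)) (0≤2⁻ (2 ℕ.+ n))
         (≤ι-elim (d (approx x (2 ℕ.+ m)) (approx y (2 ℕ.+ m))) ((e + f) + (q + f + (f + e)))
           (around x y (2 ℕ.+ m) (2 ℕ.+ n) (q + f)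
             (≤ι-upper (d (approx x (2 ℕ.+ n)) (approx y (2 ℕ.+ n))) (2 ℕ.+ n))) (2 ℕ.+ m))
    where
    lemma : ∀ p q e f {m n} → m ≡ (e + e) + (e + e) → n ≡ (f + f) + (f + f) → 0ℚ ≤ e → 0ℚ ≤ f →
            p ≤ (e + f) + (q + f + (f + e)) + e → p ≤ q + (m + n)
    lemma p q e f refl refl 0≤e 0≤f h = by-difference (ℚ.+-mono-≤ h (ℚ.+-mono-≤ 0≤e 0≤f))
      (solve 4 (λ p q e f → q :+ ((e :+ e) :+ (e :+ e) :+ ((f :+ f) :+ (f :+ f))) :- p
         := (e :+ f) :+ (q :+ f :+ (f :+ e)) :+ e :+ (e :+ f) :- (p :+ (con 0ℚ :+ con 0ℚ)))
       refl p q e f)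

  d̂⇒d : ∀ x y q → d̂ x y ≤ᴿ ι q → ∀ k →
         d (approx x (2 ℕ.+ k)) (approx y (2 ℕ.+ k)) ≤ᴿ ι (q + (2⁻ k + 2⁻ k))
  d̂⇒d x y q h k =
    ≤ι-weaken {d (approx x (2 ℕ.+ k)) (approx y (2 ℕ.+ k))} {r + 2⁻ (2 ℕ.+ k)} {q + (2⁻ k + 2⁻ k)}
      (≤ι-upper (d (approx x (2 ℕ.+ k)) (approx y (2 ℕ.+ k))) (2 ℕ.+ k))
      (by-difference (ℚ.+-mono-≤ (≤ι-elim (d̂ x y) q h k) (2⁻-suc²-≤ k))
        (solve 4 (λ r q c e → q :+ (c :+ c) :- (r :+ e) := q :+ c :+ c :- (r :+ e))
          refl r q (2⁻ k) (2⁻ (2 ℕ.+ k))))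
    where
    r = seq (d (approx x (2 ℕ.+ k)) (approx y (2 ℕ.+ k))) (2 ℕ.+ k)

  d⇒d̂ : ∀ x y q →
         (∀ k → d (approx x (2 ℕ.+ k)) (approx y (2 ℕ.+ k)) ≤ᴿ ι (q + ((2⁻ k + 2⁻ k) + (2⁻ k + 2⁻ k)))) →
         d̂ x y ≤ᴿ ι q
  d⇒d̂ x y q h = ≤ι-intro (d̂ x y) q λ m → ≤-limit₈ λ k →
    let c = 2⁻ k
        e = 2⁻ (2 ℕ.+ k)
        f = 2⁻ (2 ℕ.+ m)
        q′ = q + ((c + c) + (c + c))
    in lemma (seq (d̂ x y) m) c e f (2⁻-quarter m) (0≤2⁻ (2 ℕ.+ m)) (0≤2⁻ k) (2⁻-suc²-≤ k)
         (≤ι-elim (d (approx x (2 ℕ.+ m)) (approx y (2 ℕ.+ m))) ((f + e) + (q′ + (e + f)))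
           (around x y (2 ℕ.+ m) (2 ℕ.+ k) q′ (h k)) (2 ℕ.+ m))
    where
    lemma : ∀ r c e f {m} → m ≡ (f + f) + (f + f) → 0ℚ ≤ f → 0ℚ ≤ c → e ≤ c →
            r ≤ (f + e) + (q + ((c + c) + (c + c)) + (e + f)) + f →
            r ≤ q + m + (((c + c) + (c + c)) + ((c + c) + (c + c)))
    lemma r c e f refl 0≤f 0≤c e≤c h =
      by-difference (ℚ.+-mono-≤ h (ℚ.+-mono-≤ 0≤f (ℚ.+-mono-≤ (ℚ.+-mono-≤ 0≤c 0≤c) (ℚ.+-mono-≤ e≤c e≤c))))
        (solve 5 (λ r c e f q →
           q :+ ((f :+ f) :+ (f :+ f)) :+ (((c :+ c) :+ (c :+ c)) :+ ((c :+ c) :+ (c :+ c))) :- r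
             := (f :+ e) :+ (q :+ ((c :+ c) :+ (c :+ c)) :+ (e :+ f)) :+ f :+ (f :+ ((c :+ c) :+ (c :+ c)))
                  :- (r :+ (con 0ℚ :+ ((con 0ℚ :+ con 0ℚ) :+ (e :+ e)))))
         refl r c e f q)

  d̂-zero : ∀ x → d̂ x x ≤ᴿ ι 0ℚ
  d̂-zero x = d⇒d̂ x x 0ℚ λ k →
    ≤ι-weaken {d (approx x (2 ℕ.+ k)) (approx x (2 ℕ.+ k))} {0ℚ}
      (proj₁ (zero-≈ (approx x (2 ℕ.+ k))))
      (ℚ.+-mono-≤ (ℚ.≤-refl {0ℚ}) (ℚ.+-mono-≤ (ℚ.+-mono-≤ (0≤2⁻ k) (0≤2⁻ k)) (ℚ.+-mono-≤ (0≤2⁻ k) (0≤2⁻ k))))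

  d̂-symm : ∀ x y q → d̂ x y ≤ᴿ ι q → d̂ y x ≤ᴿ ι q
  d̂-symm x y q h = d⇒d̂ y x q λ k →
    ≤ι-weaken {d (approx y (2 ℕ.+ k)) (approx x (2 ℕ.+ k))} {q + (2⁻ k + 2⁻ k)}
      {q + ((2⁻ k + 2⁻ k) + (2⁻ k + 2⁻ k))}
      (symm-ι (approx x (2 ℕ.+ k)) (approx y (2 ℕ.+ k)) (q + (2⁻ k + 2⁻ k)) (d̂⇒d x y q h k))
      (by-difference (ℚ.+-mono-≤ (0≤2⁻ k) (0≤2⁻ k))
        (solve 2 (λ q c → q :+ ((c :+ c) :+ (c :+ c)) :- (q :+ (c :+ c))
                    := c :+ c :- (con 0ℚ :+ con 0ℚ)) refl q (2⁻ k)))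

  d̂-triangle : ∀ x y z a b → d̂ x y ≤ᴿ ι a → d̂ y z ≤ᴿ ι b → d̂ x z ≤ᴿ ι (a + b)
  d̂-triangle x y z a b h h′ = d⇒d̂ x z (a + b) λ k →
    ≤ι-weaken {d (approx x (2 ℕ.+ k)) (approx z (2 ℕ.+ k))} {(a + (2⁻ k + 2⁻ k)) + (b + (2⁻ k + 2⁻ k))}
      (triangle-ι (approx x (2 ℕ.+ k)) (approx y (2 ℕ.+ k)) (approx z (2 ℕ.+ k))
        (a + (2⁻ k + 2⁻ k)) (b + (2⁻ k + 2⁻ k)) (d̂⇒d x y a h k) (d̂⇒d y z b h′ k))
      (ℚ.≤-reflexive (solve 3 (λ a b c → (a :+ (c :+ c)) :+ (b :+ (c :+ c)) := a :+ b :+ ((c :+ c) :+ (c :+ c)))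
        refl a b (2⁻ k)))

  d̂-nonNeg : ∀ x y → ι 0ℚ ≤ᴿ d̂ x y
  d̂-nonNeg x y m n = ℚ.≤-trans
    (nonNeg (approx x (2 ℕ.+ n)) (approx y (2 ℕ.+ n)) m (2 ℕ.+ n))
    (ℚ.+-monoʳ-≤ (seq (d̂ x y) n) (ℚ.+-monoʳ-≤ (2⁻ m) (2⁻-suc²-≤ n)))

  d̂-≈0 : ∀ x y → d̂ x y ≤ᴿ ι 0ℚ → d̂ x y ≈ᴿ ι 0ℚ
  d̂-≈0 x y h = h , d̂-nonNeg x y

  η : ℕ → Point
  η k = point (const k) λ m n → ≤ι-weaken {d k k} {0ℚ} (proj₁ (zero-≈ k))
    (ℚ.+-mono-≤ (0≤2⁻ m) (0≤2⁻ n))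

  𝐗 : RepresentedSpace 0ℓ 0ℓ 0ℓ
  𝐗 = record
    { points = record
      { Carrier       = Point
      ; _≈_           = λ x y → d̂ x y ≈ᴿ ι 0ℚ
      ; isEquivalence = record
        { refl  = λ {x} → d̂-≈0 x x (d̂-zero x)
        ; sym   = λ {x} {y} (h , _) → d̂-≈0 y x (d̂-symm x y 0ℚ h)
        ; trans = λ {x} {y} {z} (h , _) (h′ , _) → d̂-≈0 x z (d̂-triangle x y z 0ℚ 0ℚ h h′)
        }
      }
    ; names              = Names
    ; names-resp         = λ {p} {q} {x} {y} → respects {p} {q} {x} {y}
    ; names-singleValued = λ {p} {x} {y} → single {p} {x} {y}
    ; names-surjective   = λ x → (λ k → approx x (suc k)) , named x
    }
    where
    Names : Baire → Point → Set
    Names p x = ∀ k → d̂ (η (p k)) x <ᴿ ι (2⁻ k)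

    respects : ∀ {p q x y} → p ≗ q → d̂ x y ≈ᴿ ι 0ℚ → Names p x → Names q y
    respects {p} {q} {x} {y} p≗q (h , _) nx k rewrite sym (p≗q k) =
      let (r , r< , h′) = <ι⇒≤ι {d̂ (η (p k)) x} {2⁻ k} (nx k)
      in ≤ι⇒<ι {d̂ (η (p k)) y} {2⁻ k} {r + 0ℚ} (d̂-triangle (η (p k)) x y r 0ℚ h′ h)
           (ℚ.≤-<-trans (ℚ.≤-reflexive (ℚ.+-identityʳ r)) r<)

    single : ∀ {p x y} → Names p x → Names p y → d̂ x y ≈ᴿ ι 0ℚ
    single {p} {x} {y} nx ny = d̂-≈0 x y (≤ι-intro (d̂ x y) 0ℚ λ m → ≤-limit₂ λ k →
      let z = η (p k)
          (r  , r<  , h)  = <ι⇒≤ι {d̂ z x} {2⁻ k} (nx k)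
          (r′ , r′< , h′) = <ι⇒≤ι {d̂ z y} {2⁻ k} (ny k)
      in lemma (seq (d̂ x y) m) r r′ (2⁻ m) (2⁻ k) (ℚ.<⇒≤ r<) (ℚ.<⇒≤ r′<)
           (≤ι-elim (d̂ x y) (r + r′) (d̂-triangle x z y r r′ (d̂-symm z x r h) h′) m))
      where
      lemma : ∀ u r r′ m k → r ≤ k → r′ ≤ k → u ≤ r + r′ + m → u ≤ 0ℚ + m + (k + k)
      lemma u r r′ m k h h′ h″ = by-difference (ℚ.+-mono-≤ h″ (ℚ.+-mono-≤ h h′))
        (solve 5 (λ u r r′ m k → con 0ℚ :+ m :+ (k :+ k) :- u := r :+ r′ :+ m :+ (k :+ k) :- (u :+ (r :+ r′)))
          refl u r r′ m k)

    named : ∀ x → Names (λ k → approx x (suc k)) x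
    named x k = ≤ι⇒<ι {d̂ (η (approx x (suc k))) x} {2⁻ k} {2⁻ suc k}
      (d⇒d̂ (η (approx x (suc k))) x (2⁻ suc k) λ i →
        ≤ι-weaken {d (approx x (suc k)) (approx x (2 ℕ.+ i))} {2⁻ suc k + 2⁻ (2 ℕ.+ i)}
          {2⁻ suc k + ((2⁻ i + 2⁻ i) + (2⁻ i + 2⁻ i))}
          (cauchy x (suc k) (2 ℕ.+ i))
          (by-difference (ℚ.+-mono-≤ (2⁻-suc²-≤ i) (ℚ.+-mono-≤ (0≤2⁻ i) (ℚ.+-mono-≤ (0≤2⁻ i) (0≤2⁻ i))))
            (solve 3 (λ a c e → a :+ ((c :+ c) :+ (c :+ c)) :- (a :+ e)
               := c :+ (c :+ (c :+ c)) :- (e :+ (con 0ℚ :+ (con 0ℚ :+ con 0ℚ)))) refl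
              (2⁻ suc k) (2⁻ i) (2⁻ (2 ℕ.+ i)))))
      (2⁻-suc-< k)

CompleteComputableMetric : RepresentedSpace c e n → Set (c ⊔ e ⊔ n)
CompleteComputableMetric X = Σ[ D ∈ Pseudometric ]
  Computable (ℕʳ ×ʳ ℕʳ) ℝʳ (Pseudometric.asMap D) × X ≅ Completion.𝐗 D

S : Pred ℕ 0ℓ → RepresentedSpace 0ℓ 0ℓ 0ℓ
S A = Subspace (ℕʳ ×ʳ 𝕊) λ (k , s) → (A k × s ≡ ⊤ˢ) ⊎ (¬ A k × s ≡ ⊥ˢ)

{-# OPTIONS --safe #-}
module Submission where

-- Everything reduces to machines for (6).  If A is enumerable, p ↦ (p(0), p(0), …)
-- and p ↦ ⟨(p(0), p(0), …), search for p(0) in A⟩ realise the projection S A → ℕ and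
-- its inverse, and the same two machines give isomorphisms with I(=) and with the
-- completion of ℕ under the discrete metric, since in those spaces too the first
-- entry of a name determines the point.  For overtness, a name of U is run on these
-- names of all points of S A.  Conversely, a dense computable sequence in S A
-- enumerates A by waiting for a nonzero entry in the second component; the sequence
-- of centres of a complete metric space is dense because a machine consults finitely
-- many entries of a name; and overtness applied to the open sets {(n , ⊤)} ∩ S A
-- semidecides membership in A.
--
-- The machines come from primitive recursive terms with oracles, compiled to a
-- counter language and then to machines, and from a universal program in that
-- language, which turns machines back into oracles.

open import Defs
open import Axiom.ExcludedMiddle using (ExcludedMiddle)
open import Data.Bool.Base using (if_then_else_; true; false)
open import Data.Fin.Base using (Fin; zero; suc)
open import Data.Fin.Patterns using (0F; 1F; 2F; 3F)
open import Data.Integer.Base using (+≤+)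
open import Data.List.Base using (List; []; _∷_; _++_; length; replicate)
open import Data.List.Properties using (length-++)
open import Data.Maybe.Base using (just; nothing)
open import Data.Maybe.Properties using (just-injective)
open import Data.Nat using (ℕ)
open import Data.Nat.Base
  using (zero; suc; pred; _+_; _*_; _∸_; _⊓_; _⊔_; _≤_; _<_; _≤′_; z≤n; s≤s; s≤s⁻¹; ≤′-refl; ≤′-step)
open import Data.Nat.Properties
open import Data.Product using (_×_)
open import Data.Product.Base using (_,_; proj₁; proj₂; ∃-syntax)
open import Data.Rational.Base using (ℚ; 0ℚ; 1ℚ; *≤*)
import Data.Rational.Base as ℚ
import Data.Rational.Properties as ℚ
open import Data.Rational.Solver using (module +-*-Solver)
open import Data.Sum.Base using (_⊎_; inj₁; inj₂)
open import Data.Vec.Functional using () renaming (_∷_ to _◂_)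
open import Function.Base using (_∘_; const; id; case_of_)
open import Function.Bundles using (_⇔_; mk⇔; Func; Inverse; Equivalence)
open import Level using (0ℓ) renaming (_⊔_ to _⊔ˡ_)
open import Relation.Binary.Bundles using (Setoid)
open import Relation.Binary.PropositionalEquality
  using (_≡_; _≢_; _≗_; refl; sym; trans; cong; cong₂; subst; subst₂; ≢-sym)
open import Relation.Nullary.Decidable using (dec-true; dec-false; decidable-stable)
open import Relation.Nullary.Decidable.Core using (Dec; yes; no; does)
open import Relation.Nullary.Negation.Core using (¬_; contradiction)
open import Relation.Unary using (Pred)

open RepresentedSpace
open +-*-Solver using (solve; con; _:=_; _:+_; _:-_)

-- Counter programs

-- The definitions quantify over concrete multitape machines. A machine that is asked for must be
-- exhibited as a program and proved correct, and a machine that is given, by a realiser or as the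
-- number at the head of a name, is arbitrary; hence both a compiler and an interpreter. Total
-- functions therefore suffice everywhere except in the loop of the interpreter, whose termination
-- comes from a halting derivation. Excluded middle serves the correctness proofs, for instance in
-- finding the nonzero entry of a name of ⊤; a program depends on it only in `enumerable`, which has
-- to know whether `A` is empty and to fix an element of it.

infixr 6 _⨾_
infix 9 _⟨_↦_⟩

-- Commands of an oracle counter machine; counter t is the number on tape t.
data Cmd : Set where
  inc dec consult : ℕ → Cmd
  _⨾_             : Cmd → Cmd → Cmd
  while           : ℕ → Cmd → Cmd

_⟨_↦_⟩ : Baire → ℕ → ℕ → Baire
(σ ⟨ t ↦ v ⟩) u = if does (u ≟ t) then v else σ u

↦-same : ∀ σ t {v} → (σ ⟨ t ↦ v ⟩) t ≡ v
↦-same σ t rewrite dec-true (t ≟ t) refl = refl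

↦-other : ∀ σ {t u v} → u ≢ t → (σ ⟨ t ↦ v ⟩) u ≡ σ u
↦-other σ {t} {u} u≢t rewrite dec-false (u ≟ t) u≢t = refl

data Run (α : Baire) : Cmd → Baire → Baire → Set where
  inc        : ∀ {t σ} → Run α (inc t) σ (σ ⟨ t ↦ suc (σ t) ⟩)
  dec        : ∀ {t σ} → Run α (dec t) σ (σ ⟨ t ↦ pred (σ t) ⟩)
  consult    : ∀ {t σ} → Run α (consult t) σ (σ ⟨ t ↦ α (σ t) ⟩)
  _⨾_        : ∀ {c c′ σ τ υ} → Run α c σ τ → Run α c′ τ υ → Run α (c ⨾ c′) σ υ
  while-stop : ∀ {t c σ} → σ t ≡ 0 → Run α (while t c) σ σ
  while-step : ∀ {t c σ τ υ} → σ t ≢ 0 → Run α c σ τ → Run α (while t c) τ υ →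
               Run α (while t c) σ υ

size : Cmd → ℕ
size (inc t)     = 2
size (dec t)     = 1
size (consult t) = 1
size (c ⨾ c′)    = size c + size c′
size (while t c) = suc (size c + 1)

goto : ℕ → Symbol → Action
goto q s = action s stay q

-- The instructions for a command, placed from position a of the program on.
-- Control leaves them at position a + size c.
assemble : Cmd → ℕ → Machine
assemble (inc t) a =
  scan t (action blank left (1 + a)) (action mark left (1 + a)) ∷
  scan t (goto (2 + a) mark) (goto (2 + a) mark) ∷ []
assemble (dec t) a = scan t (goto (1 + a) blank) (action mark right (1 + a)) ∷ []
assemble (consult t) a = query t (1 + a) ∷ []
assemble (c ⨾ c′) a = assemble c a ++ assemble c′ (size c + a)
assemble (while t c) a =
  scan t (goto (size (while t c) + a) blank) (goto (1 + a) mark) ∷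
  assemble c (1 + a) ++ scan t (goto a blank) (goto a mark) ∷ []

length-assemble : ∀ c a → length (assemble c a) ≡ size c
length-assemble (inc t) a     = refl
length-assemble (dec t) a     = refl
length-assemble (consult t) a = refl
length-assemble (c ⨾ c′) a
  rewrite length-++ (assemble c a) {assemble c′ (size c + a)}
        | length-assemble c a | length-assemble c′ (size c + a) = refl
length-assemble (while t c) a
  rewrite length-++ (assemble c (1 + a)) {scan t (goto a blank) (goto a mark) ∷ []}
        | length-assemble c (1 + a) = refl

record Contains (M : Machine) (a : ℕ) (L : Machine) : Set where
  constructor contains
  field
    fetched : ∀ i {x} → fetch L i ≡ just x → fetch M (i + a) ≡ just x

contains-head : ∀ {M a x L} → Contains M a (x ∷ L) → fetch M a ≡ just x
contains-head (contains f) = f 0 refl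

contains-tail : ∀ {M a x L} → Contains M a (x ∷ L) → Contains M (1 + a) L
contains-tail {M} {a} (contains f) = contains λ i {x} eq →
  subst (λ j → fetch M j ≡ just x) (sym (+-suc i a)) (f (suc i) eq)

contains-++ˡ : ∀ {M a} L {L′} → Contains M a (L ++ L′) → Contains M a L
contains-++ˡ L (contains f) = contains λ i eq → f i (fetch-++ L i eq)
  where
  fetch-++ : ∀ L {L′} i {x} → fetch L i ≡ just x → fetch (L ++ L′) i ≡ just x
  fetch-++ (_ ∷ _) zero    eq = eq
  fetch-++ (_ ∷ L) (suc i) eq = fetch-++ L i eq

contains-++ʳ : ∀ {M a} L {L′} → Contains M a (L ++ L′) → Contains M (length L + a) L′
contains-++ʳ []      C = C
contains-++ʳ {M} {a} (_ ∷ L) {L′} C =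
  subst (λ j → Contains M j L′) (+-suc (length L) a) (contains-++ʳ L (contains-tail C))

infix 4 _≈ᵗ_

-- Only the block of marks at the head counts, so the marks that `dec` leaves behind on the left are
-- invisible to the counters.
_≈ᵗ_ : (ℕ → Tape) → Baire → Set
ts ≈ᵗ σ = ∀ u → value (ts u) ≡ σ u

≈ᵗ-update : ∀ {ts σ} t x {v} → ts ≈ᵗ σ → value x ≡ v → ts [ t ≔ x ] ≈ᵗ σ ⟨ t ↦ v ⟩
≈ᵗ-update t x ts≈σ eq u with does (u ≟ t)
... | true  = eq
... | false = ts≈σ u

value-unary : ∀ k → value (unary k) ≡ k
value-unary zero          = refl
value-unary (suc zero)    = refl
value-unary (suc (suc k)) = cong suc (value-unary (suc k))

-- The cell to the left may still carry a symbol from an earlier `dec`; the second action overwrites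
-- it, so its content does not matter.
value-pushed : ∀ x {q q′} → let s = Tape.scanned x in
               value (act (goto q mark) (act (action s left q′) x)) ≡ suc (value x)
value-pushed (tape [] _ r)      = refl
value-pushed (tape (_ ∷ _) _ r) = refl

value-right : ∀ l r → value (shift right (tape l mark r)) ≡ pred (value (tape l mark r))
value-right l []      = refl
value-right l (_ ∷ r) = refl

value-mark : ∀ x → Tape.scanned x ≡ mark → value x ≢ 0
value-mark (tape l _ []) refl ()
value-mark (tape l _ (_ ∷ _)) refl ()

execute-blank : ∀ {α t b m} ts → Tape.scanned (ts t) ≡ blank →
                execute α (scan t b m) ts ≡ config (Action.next b) (ts [ t ≔ act b (ts t) ])
execute-blank ts eq rewrite eq = refl

execute-mark : ∀ {α t b m} ts → Tape.scanned (ts t) ≡ mark →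
               execute α (scan t b m) ts ≡ config (Action.next m) (ts [ t ≔ act m (ts t) ])
execute-mark ts eq rewrite eq = refl

module _ {M : Machine} {α : Baire} where

  -- Control reaches `exit` with the counters τ, in continuation-passing style.
  Reaches : (entry : ℕ) (σ : Baire) (exit : ℕ) (τ : Baire) → Set
  Reaches entry σ exit τ = ∀ {m ts} → ts ≈ᵗ σ →
    (∀ {ts′} → ts′ ≈ᵗ τ → Halts M α (config exit ts′) m) → Halts M α (config entry ts) m

  step-blank : ∀ {q t b m} ts → fetch M q ≡ just (scan t b m) → Tape.scanned (ts t) ≡ blank →
               step M α (config q ts) ≡ just (config (Action.next b) (ts [ t ≔ act b (ts t) ]))
  step-blank {t = t} {b} {m} ts eq eq′ rewrite eq = cong just (execute-blank {α} {t} {b} {m} ts eq′)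

  step-mark : ∀ {q t b m} ts → fetch M q ≡ just (scan t b m) → Tape.scanned (ts t) ≡ mark →
              step M α (config q ts) ≡ just (config (Action.next m) (ts [ t ≔ act m (ts t) ]))
  step-mark {t = t} {b} {m} ts eq eq′ rewrite eq = cong just (execute-mark {α} {t} {b} {m} ts eq′)

  step-query : ∀ {q t r} ts → fetch M q ≡ just (query t r) →
               step M α (config q ts) ≡ just (config r (ts [ t ≔ unary (α (value (ts t))) ]))
  step-query ts eq rewrite eq = refl

  reaches-scan : ∀ {q t b m exit σ τ} → fetch M q ≡ just (scan t b m) →
    (∀ x → Tape.scanned x ≡ blank → value x ≡ σ t →
       ∃[ v ] value (act b x) ≡ v × Reaches (Action.next b) (σ ⟨ t ↦ v ⟩) exit τ) →
    (∀ x → Tape.scanned x ≡ mark → value x ≡ σ t →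
       ∃[ v ] value (act m x) ≡ v × Reaches (Action.next m) (σ ⟨ t ↦ v ⟩) exit τ) →
    Reaches q σ exit τ
  reaches-scan {t = t} eq onBlank onMark {ts = ts} ts≈σ k with Tape.scanned (ts t) in eq′
  ... | blank = let (v , eqv , r) = onBlank (ts t) eq′ (ts≈σ t) in
    steps (step-blank ts eq eq′) (r (≈ᵗ-update t _ ts≈σ eqv) k)
  ... | mark  = let (v , eqv , r) = onMark (ts t) eq′ (ts≈σ t) in
    steps (step-mark ts eq eq′) (r (≈ᵗ-update t _ ts≈σ eqv) k)

  reaches-resp : ∀ {q σ τ} → σ ≗ τ → Reaches q σ q τ
  reaches-resp σ≗τ ts≈σ k = k λ u → trans (ts≈σ u) (σ≗τ u)

  reaches-trans : ∀ {p q r σ τ υ} → Reaches p σ q τ → Reaches q τ r υ → Reaches p σ r υ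
  reaches-trans f g ts≈ k = f ts≈ λ ts′≈ → g ts′≈ k

  reaches-idle : ∀ {q t exit σ τ} b m → fetch M q ≡ just (scan t (goto b blank) (goto m mark)) →
    (σ t ≡ 0 → Reaches b σ exit τ) → (σ t ≢ 0 → Reaches m σ exit τ) → Reaches q σ exit τ
  reaches-idle {t = t} {σ = σ} b m eq onZero onNonzero = reaches-scan eq
    (λ { (tape l _ r) refl eqv → σ t , eqv , reaches-trans (reaches-resp unchanged) (onZero (sym eqv)) })
    (λ { x@(tape l _ r) refl eqv → σ t , eqv , reaches-trans (reaches-resp unchanged)
           (onNonzero λ z → value-mark x refl (trans eqv z)) })
    where
    unchanged : σ ⟨ t ↦ σ t ⟩ ≗ σ
    unchanged u with u ≟ t
    ... | yes refl = ↦-same σ t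
    ... | no u≢t   = ↦-other σ u≢t

  reaches-inc : ∀ {a t σ} → Contains M a (assemble (inc t) a) → Reaches a σ (2 + a) (σ ⟨ t ↦ suc (σ t) ⟩)
  reaches-inc {a} {t} {σ} C {ts = ts} ts≈σ k = steps first (steps second (k incremented))
    where
    x   = ts t
    y   = act (action (Tape.scanned x) left (1 + a)) x
    ts₁ = ts [ t ≔ y ]
    z   = act (goto (2 + a) mark) (ts₁ t)

    first : step M α (config a ts) ≡ just (config (1 + a) ts₁)
    first = scanned-cases (Tape.scanned x) refl
      where
      scanned-cases : ∀ s → Tape.scanned x ≡ s →
        step M α (config a ts) ≡ just (config (1 + a) (ts [ t ≔ act (action s left (1 + a)) x ]))
      scanned-cases blank = step-blank ts (contains-head C)
      scanned-cases mark  = step-mark ts (contains-head C)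

    second : step M α (config (1 + a) ts₁) ≡ just (config (2 + a) (ts₁ [ t ≔ z ]))
    second with Tape.scanned (ts₁ t) in eq
    ... | blank = step-blank ts₁ (contains-head (contains-tail C)) eq
    ... | mark  = step-mark ts₁ (contains-head (contains-tail C)) eq

    pushed : ts₁ t ≡ y
    pushed rewrite dec-true (t ≟ t) refl = refl

    incremented : ts₁ [ t ≔ z ] ≈ᵗ σ ⟨ t ↦ suc (σ t) ⟩
    incremented u with does (u ≟ t)
    ... | true  = trans (cong (value ∘ act (goto (2 + a) mark)) pushed)
                    (trans (value-pushed x {2 + a} {1 + a}) (cong suc (ts≈σ t)))
    ... | false = ts≈σ u

  reaches-while : ∀ {t c a σ τ} → Contains M a (assemble (while t c) a) →
                  Run α (while t c) σ τ → Reaches a σ (size (while t c) + a) τ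

  reaches : ∀ {c a σ τ} → Contains M a (assemble c a) → Run α c σ τ → Reaches a σ (size c + a) τ
  reaches C inc = reaches-inc C
  reaches C (dec {t} {σ}) = reaches-scan (contains-head C)
    (λ { (tape l _ r) refl eqv → pred (σ t) , cong pred eqv , reaches-resp λ _ → refl })
    (λ { (tape l _ r) refl eqv → pred (σ t) , trans (value-right l r) (cong pred eqv) , reaches-resp λ _ → refl })
  reaches C (consult {t} {σ}) {ts = ts} ts≈σ k = steps (step-query ts (contains-head C))
    (k (≈ᵗ-update t _ ts≈σ (trans (value-unary _) (cong α (ts≈σ t)))))
  reaches {c ⨾ c′} {a} {σ} {τ} C (_⨾_ {τ = υ} r r′) = reaches-trans (reaches (contains-++ˡ (assemble c a) C) r)
    (subst (λ e → Reaches (size c + a) υ e τ) exit (reaches second r′))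
    where
    second : Contains M (size c + a) (assemble c′ (size c + a))
    second = subst (λ l → Contains M (l + a) (assemble c′ (size c + a))) (length-assemble c a)
               (contains-++ʳ (assemble c a) C)
    exit : size c′ + (size c + a) ≡ size c + size c′ + a
    exit = trans (sym (+-assoc (size c′) (size c) a)) (cong (_+ a) (+-comm (size c′) (size c)))
  reaches C r@(while-stop _)     = reaches-while C r
  reaches C r@(while-step _ _ _) = reaches-while C r

  reaches-while {t} {c} {a} C (while-stop z) =
    reaches-idle (size (while t c) + a) (1 + a) (contains-head C)
      (λ _ → reaches-resp λ _ → refl) (λ nz → contradiction z nz)
  reaches-while {t} {c} {a} {τ = υ} C (while-step {τ = τ} nz r r′) =
    reaches-idle (size (while t c) + a) (1 + a) (contains-head C)
      (λ z → contradiction z nz)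
      (λ _ → reaches-trans (reaches (contains-++ˡ (assemble c (1 + a)) (contains-tail C)) r)
               -- The closing instruction of the loop is an unconditional jump: both of its actions
               -- lead back to `a`.
               (reaches-idle a a (contains-head back) (λ _ → again) (λ _ → again)))
    where
    again : Reaches a τ (size (while t c) + a) υ
    again = reaches-while C r′
    back : Contains M (size c + suc a) (scan t (goto a blank) (goto a mark) ∷ [])
    back = subst (λ l → Contains M (l + suc a) _) (length-assemble c (1 + a))
             (contains-++ʳ (assemble c (1 + a)) (contains-tail C))

initialCounters : ℕ → Baire
initialCounters n zero    = n
initialCounters n (suc _) = 0

run-halts : ∀ {c α n σ} → Run α c (initialCounters n) σ →
            Halts (assemble c 0) α (initial n) (σ 0)
run-halts {c} {α} {n} {σ} r = reaches whole r (λ { zero → value-unary n ; (suc _) → refl }) λ {ts} ts≈σ →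
  subst (Halts (assemble c 0) α _) (ts≈σ 0) (halted (outside ts))
  where
  fetch-outside : ∀ L → fetch L (length L + 0) ≡ nothing
  fetch-outside []      = refl
  fetch-outside (_ ∷ L) = fetch-outside L
  outside : ∀ ts → step (assemble c 0) α (config (size c + 0) ts) ≡ nothing
  outside ts rewrite sym (length-assemble c 0) | fetch-outside (assemble c 0) = refl
  whole : Contains (assemble c 0) 0 (assemble c 0)
  whole = contains λ i {x} eq → subst (λ j → fetch (assemble c 0) j ≡ just x) (sym (+-identityʳ i)) eq

clear : ℕ → Cmd
clear t = while t (dec t)

clear-runs : ∀ α σ t → ∃[ τ ] Run α (clear t) σ τ × τ t ≡ 0 × (∀ {u} → u ≢ t → τ u ≡ σ u)
clear-runs α σ t = go (σ t) σ refl
  where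
  go : ∀ k σ → σ t ≡ k → ∃[ τ ] Run α (clear t) σ τ × τ t ≡ 0 × (∀ {u} → u ≢ t → τ u ≡ σ u)
  go zero    σ eq = σ , while-stop eq , eq , λ _ → refl
  go (suc k) σ eq =
    let (τ , r , z , same) = go k (σ ⟨ t ↦ pred (σ t) ⟩) (trans (↦-same σ t) (cong pred eq))
    in τ , while-step (λ z → contradiction (trans (sym eq) z) λ ()) dec r , z
         , λ u≢t → trans (same u≢t) (↦-other σ u≢t)

-- Reading a counter destroys it, so its content goes to two targets: one keeps the copy, the other
-- allows the source to be restored.
drain : ℕ → ℕ → ℕ → Cmd
drain x y z = while x (dec x ⨾ inc y ⨾ inc z)

Drained : (x y z : ℕ) (σ τ : Baire) → Set
Drained x y z σ τ = τ x ≡ 0 × τ y ≡ σ x + σ y × τ z ≡ σ x + σ z ×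
                    (∀ {u} → u ≢ x → u ≢ y → u ≢ z → τ u ≡ σ u)

drain-runs : ∀ α σ {x y z} → x ≢ y → x ≢ z → y ≢ z → ∃[ τ ] Run α (drain x y z) σ τ × Drained x y z σ τ
drain-runs α σ {x} {y} {z} x≢y x≢z y≢z = go (σ x) σ refl
  where
  go : ∀ k σ → σ x ≡ k → ∃[ τ ] Run α (drain x y z) σ τ × Drained x y z σ τ
  go zero    σ eq = σ , while-stop eq , eq , cong (_+ σ y) (sym eq) , cong (_+ σ z) (sym eq) , λ _ _ _ → refl
  go (suc k) σ eq =
    let σ₁ = σ ⟨ x ↦ pred (σ x) ⟩
        σ₂ = σ₁ ⟨ y ↦ suc (σ₁ y) ⟩
        σ₃ = σ₂ ⟨ z ↦ suc (σ₂ z) ⟩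
        x₃ = trans (↦-other σ₂ x≢z) (trans (↦-other σ₁ x≢y) (trans (↦-same σ x) (cong pred eq)))
        y₃ = trans (↦-other σ₂ y≢z) (trans (↦-same σ₁ y) (cong suc (↦-other σ (≢-sym x≢y))))
        z₃ = trans (↦-same σ₂ z) (cong suc (trans (↦-other σ₁ (≢-sym y≢z)) (↦-other σ (≢-sym x≢z))))
        (τ , r , τx , τy , τz , same) = go k σ₃ x₃
        add : ∀ {w w₃ v} → w ≡ σ₃ x + w₃ → w₃ ≡ suc v → w ≡ σ x + v
        add h h′ = trans h (trans (cong₂ _+_ x₃ h′) (trans (+-suc k _) (cong (_+ _) (sym eq))))
    in τ , while-step (λ z → contradiction (trans (sym eq) z) λ ()) (dec ⨾ inc ⨾ inc) r
         , τx , add τy y₃ , add τz z₃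
         , λ u≢x u≢y u≢z → trans (same u≢x u≢y u≢z)
             (trans (↦-other σ₂ u≢z) (trans (↦-other σ₁ u≢y) (↦-other σ u≢x)))

infix 4 _≈⟨<_⟩_

_≈⟨<_⟩_ : Baire → ℕ → Baire → Set
τ ≈⟨< d ⟩ σ = ∀ {u} → u < d → τ u ≡ σ u

-- The counters from `y` on are scratch space with unknown content, so the two that matter are
-- cleared; `2 + y` merely absorbs the spare output of the restoring `drain`.
copy : ℕ → ℕ → Cmd
copy x y = clear y ⨾ clear (1 + y) ⨾ drain x y (1 + y) ⨾ drain (1 + y) x (2 + y)

copy-runs : ∀ α σ {x y} → x < y → ∃[ τ ] Run α (copy x y) σ τ × τ ≈⟨< y ⟩ σ × τ y ≡ σ x
copy-runs α σ {x} {y} x<y =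
  let (σ₁ , r₁ , y₁ , same₁) = clear-runs α σ y
      (σ₂ , r₂ , t₂ , same₂) = clear-runs α σ₁ (1 + y)
      (σ₃ , r₃ , x₃ , y₃ , t₃ , same₃) = drain-runs α σ₂ (<⇒≢ x<y) (<⇒≢ x<t) (<⇒≢ y<t)
      (σ₄ , r₄ , t₄ , x₄ , s₄ , same₄) = drain-runs α σ₃ (>⇒≢ x<t) (<⇒≢ t<s) (<⇒≢ (<-trans x<t t<s))
      x₂ : σ₂ x ≡ σ x
      x₂ = trans (same₂ (<⇒≢ x<t)) (same₁ (<⇒≢ x<y))
      y₂ : σ₂ y ≡ 0
      y₂ = trans (same₂ (<⇒≢ y<t)) y₁
      kept : ∀ {u} → u < y → σ₄ u ≡ σ u
      kept {u} u<y = case u ≟ x of λ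
        { (yes refl) → trans x₄ (trans (cong₂ _+_ (trans t₃ (cong₂ _+_ x₂ t₂)) x₃)
                         (trans (+-identityʳ _) (+-identityʳ _)))
        ; (no u≢x)   → trans (same₄ (<⇒≢ (m<n⇒m<1+n u<y)) u≢x (<⇒≢ (m<n⇒m<1+n (m<n⇒m<1+n u<y))))
                         (trans (same₃ u≢x (<⇒≢ u<y) (<⇒≢ (m<n⇒m<1+n u<y)))
                         (trans (same₂ (<⇒≢ (m<n⇒m<1+n u<y))) (same₁ (<⇒≢ u<y))))
        }
  in σ₄ , (r₁ ⨾ r₂ ⨾ r₃ ⨾ r₄) , kept
        , trans (same₄ (<⇒≢ y<t) (>⇒≢ x<y) (<⇒≢ (<-trans y<t t<s)))
            (trans y₃ (trans (cong₂ _+_ x₂ y₂) (+-identityʳ _)))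
  where

  y<t = n<1+n y
  t<s = n<1+n (1 + y)
  x<t = <-trans x<y y<t

move : ℕ → ℕ → Cmd
move x y = clear y ⨾ drain x y (1 + x)

move-runs : ∀ α σ {x y} → y < x →
            ∃[ τ ] Run α (move x y) σ τ × τ y ≡ σ x × (∀ {u} → u < x → u ≢ y → τ u ≡ σ u)
move-runs α σ {x} {y} y<x =
  let (σ₁ , r₁ , y₁ , same₁) = clear-runs α σ y
      (σ₂ , r₂ , x₂ , y₂ , s₂ , same₂) =
        drain-runs α σ₁ (>⇒≢ y<x) (<⇒≢ (n<1+n x)) (<⇒≢ (m<n⇒m<1+n y<x))
  in σ₂ , (r₁ ⨾ r₂)
        , trans y₂ (trans (cong₂ _+_ (same₁ (>⇒≢ y<x)) y₁) (+-identityʳ _))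
        , λ u<x u≢y → trans (same₂ (<⇒≢ u<x) u≢y (<⇒≢ (m<n⇒m<1+n u<x))) (same₁ u≢y)

-- Recursive functions

-- Code for a function of n arguments: given the counters holding the arguments,
-- all below d, it puts the value in counter d and changes no counter below d.
Code : ℕ → Set
Code n = (args : Fin n → ℕ) (d : ℕ) → Cmd

record Correct {n} (α : Baire) (c : Code n) (f : (Fin n → ℕ) → ℕ) : Set where
  field
    runs : ∀ {args d σ ρ} → (∀ i → args i < d) → (∀ i → σ (args i) ≡ ρ i) →
           ∃[ τ ] Run α (c args d) σ τ × τ ≈⟨< d ⟩ σ × τ d ≡ f ρ

open Correct

-- Pairs code with any extensionally equal function, so that the denotation of a larger term reduces
-- to the intended function and not to its recursion scheme.
record Primitive (n : ℕ) : Set where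
  field
    code     : Code n
    function : (Fin n → ℕ) → ℕ
    correct  : ∀ α → Correct α code function

primRec : ℕ → (ℕ → ℕ → ℕ) → ℕ → ℕ
primRec z s zero    = z
primRec z s (suc k) = s (primRec z s k) k

primRec-nonzero : ∀ {x} v → v ≢ 0 → primRec 0 (λ _ _ → suc x) v ≡ suc x
primRec-nonzero zero    v≢0 = contradiction refl v≢0
primRec-nonzero (suc v) _   = refl

-- Terms for primitive recursive functions of n variables relative to m binary
-- oracles.  In the step of `rec`, variable 0 is the previous value and
-- variable 1 the index.
data Term (m : ℕ) : ℕ → Set where
  var  : ∀ {n} → Fin n → Term m n
  zer  : ∀ {n} → Term m n
  succ : ∀ {n} → Term m n → Term m n
  bind : ∀ {n} → Term m n → Term m (1 + n) → Term m n
  ren  : ∀ {k n} → (Fin k → Fin n) → Term m k → Term m n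
  rec  : ∀ {n} → Term m n → Term m n → Term m (2 + n) → Term m n
  prim : ∀ {n} → Primitive n → Term m n
  ask  : Fin m → Term m 2

Oracles : ℕ → Set
Oracles m = Fin m → ℕ → ℕ → ℕ

⟦_⟧ : ∀ {m n} → Term m n → Oracles m → (Fin n → ℕ) → ℕ
⟦ var i ⟧     O ρ = ρ i
⟦ zer ⟧       O ρ = 0
⟦ succ t ⟧    O ρ = suc (⟦ t ⟧ O ρ)
⟦ bind t u ⟧  O ρ = ⟦ u ⟧ O (⟦ t ⟧ O ρ ◂ ρ)
⟦ ren r t ⟧   O ρ = ⟦ t ⟧ O (ρ ∘ r)
⟦ rec k z s ⟧ O ρ = primRec (⟦ z ⟧ O ρ) (λ v i → ⟦ s ⟧ O (v ◂ i ◂ ρ)) (⟦ k ⟧ O ρ)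
⟦ prim p ⟧    O ρ = Primitive.function p ρ
⟦ ask j ⟧     O ρ = O j (ρ zero) (ρ (suc zero))

compile : ∀ {m n} → (Fin m → Code 2) → Term m n → Code n
compile I (var i)     args d = copy (args i) d
compile I zer         args d = clear d
compile I (succ t)    args d = compile I t args d ⨾ inc d
compile I (bind t u)  args d = compile I t args d ⨾ compile I u (d ◂ args) (1 + d) ⨾ move (1 + d) d
compile I (ren r t)   args d = compile I t (args ∘ r) d
-- Counter `d` holds the running value, `1 + d` the index and `2 + d` the number of rounds left.
compile I (rec k z s) args d =
  compile I z args d ⨾ clear (1 + d) ⨾ compile I k args (2 + d) ⨾
  while (2 + d) (dec (2 + d) ⨾ compile I s (d ◂ (1 + d) ◂ args) (3 + d) ⨾ move (3 + d) d ⨾ inc (1 + d))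
compile I (prim p)    args d = Primitive.code p args d
compile I (ask j)     args d = I j args d

module _ {α m} {I : Fin m → Code 2} {O : Oracles m}
         (I-correct : ∀ j → Correct α (I j) (λ ρ → O j (ρ zero) (ρ (suc zero)))) where

  compile-correct : ∀ {n} (t : Term m n) → Correct α (compile I t) (⟦ t ⟧ O)
  compile-correct (var i) .runs {args} {σ = σ} below eq =
    let (τ , r , same , τd) = copy-runs α σ (below i) in τ , r , same , trans τd (eq i)
  compile-correct zer .runs {d = d} {σ} below eq =
    let (τ , r , τd , same) = clear-runs α σ d in τ , r , same ∘ <⇒≢ , τd
  compile-correct (succ t) .runs {d = d} below eq =
    let (τ , r , same , τd) = compile-correct t .runs below eq
    in τ ⟨ d ↦ suc (τ d) ⟩ , (r ⨾ inc)
         , (λ u<d → trans (↦-other τ (<⇒≢ u<d)) (same u<d))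
         , trans (↦-same τ d) (cong suc τd)
  compile-correct (bind t u) .runs {d = d} below eq =
    let (σ₁ , r₁ , same₁ , d₁) = compile-correct t .runs below eq
        (σ₂ , r₂ , same₂ , d₂) = compile-correct u .runs
          (λ { zero → n<1+n d ; (suc i) → m<n⇒m<1+n (below i) })
          (λ { zero → d₁ ; (suc i) → trans (same₁ (below i)) (eq i) })
        (σ₃ , r₃ , d₃ , same₃) = move-runs α σ₂ (n<1+n d)
    in σ₃ , (r₁ ⨾ r₂ ⨾ r₃)
          , (λ u<d → trans (same₃ (m<n⇒m<1+n u<d) (<⇒≢ u<d)) (trans (same₂ (m<n⇒m<1+n u<d)) (same₁ u<d)))
          , trans d₃ d₂
  compile-correct (ren r t) .runs below eq = compile-correct t .runs (below ∘ r) (eq ∘ r)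
  compile-correct (rec {n} k z s) .runs {args} {d} {σ} {ρ} below eq =
    let (σ₁ , r₁ , same₁ , d₁) = compile-correct z .runs below eq
        (σ₂ , r₂ , i₂ , same₂) = clear-runs α σ₁ (1 + d)
        below₂ : ∀ i → args i < 2 + d
        below₂ i = m<n⇒m<1+n (m<n⇒m<1+n (below i))
        σ₂≈σ : σ₂ ≈⟨< d ⟩ σ
        σ₂≈σ u<d = trans (same₂ (<⇒≢ (m<n⇒m<1+n u<d))) (same₁ u<d)
        (σ₃ , r₃ , same₃ , c₃) = compile-correct k .runs below₂ (λ i → trans (σ₂≈σ (below i)) (eq i))
        σ₃≈σ : σ₃ ≈⟨< d ⟩ σ
        σ₃≈σ u<d = trans (same₃ (m<n⇒m<1+n (m<n⇒m<1+n u<d))) (σ₂≈σ u<d)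
        (σ₄ , r₄ , same₄ , d₄) = iterates (⟦ k ⟧ O ρ) 0 σ₃ c₃
          (trans (same₃ (m<n⇒m<1+n (n<1+n d))) (trans (same₂ (<⇒≢ (n<1+n d))) d₁))
          (trans (same₃ (n<1+n (1 + d))) i₂)
          (λ i → trans (σ₃≈σ (below i)) (eq i))
    in σ₄ , (r₁ ⨾ r₂ ⨾ r₃ ⨾ r₄)
          , (λ u<d → trans (same₄ u<d) (σ₃≈σ u<d))
          , trans d₄ (cong value-at (+-identityʳ (⟦ k ⟧ O ρ)))
    where
    value-at : ℕ → ℕ
    value-at = primRec (⟦ z ⟧ O ρ) (λ v i → ⟦ s ⟧ O (v ◂ i ◂ ρ))
    body = dec (2 + d) ⨾ compile I s (d ◂ (1 + d) ◂ args) (3 + d) ⨾ move (3 + d) d ⨾ inc (1 + d)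
    d<1 = n<1+n d
    d<2 = m<n⇒m<1+n d<1
    d<3 = m<n⇒m<1+n d<2

    iterates : ∀ c j σ → σ (2 + d) ≡ c → σ d ≡ value-at j → σ (1 + d) ≡ j → (∀ i → σ (args i) ≡ ρ i) →
               ∃[ τ ] Run α (while (2 + d) body) σ τ × τ ≈⟨< d ⟩ σ × τ d ≡ value-at (c + j)
    iterates zero    j σ c≡ d≡ i≡ eq = σ , while-stop c≡ , (λ _ → refl) , d≡
    iterates (suc c) j σ c≡ d≡ i≡ eq =
      let σ₁ = σ ⟨ 2 + d ↦ pred (σ (2 + d)) ⟩
          σ₁≈σ : σ₁ ≈⟨< 2 + d ⟩ σ
          σ₁≈σ u< = ↦-other σ (<⇒≢ u<)
          (σ₂ , r₂ , same₂ , v₂) = compile-correct s .runs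
            (λ { zero → d<3 ; (suc zero) → s≤s d<2 ; (suc (suc i)) → m<n⇒m<1+n (m<n⇒m<1+n (m<n⇒m<1+n (below i))) })
            (λ { zero → trans (σ₁≈σ d<2) d≡ ; (suc zero) → trans (σ₁≈σ (n<1+n _)) i≡
               ; (suc (suc i)) → trans (σ₁≈σ (m<n⇒m<1+n (m<n⇒m<1+n (below i)))) (eq i) })
          (σ₃ , r₃ , d₃ , same₃) = move-runs α σ₂ d<3
          σ₄ = σ₃ ⟨ 1 + d ↦ suc (σ₃ (1 + d)) ⟩
          i₃ : σ₃ (1 + d) ≡ j
          i₃ = trans (same₃ (s≤s d<2) (>⇒≢ d<1)) (trans (same₂ (s≤s d<2)) (trans (σ₁≈σ (n<1+n _)) i≡))
          c₄ : σ₄ (2 + d) ≡ c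
          c₄ = trans (↦-other σ₃ (>⇒≢ (n<1+n _))) (trans (same₃ (n<1+n _) (>⇒≢ d<2))
                 (trans (same₂ (n<1+n _)) (trans (↦-same σ (2 + d)) (cong pred c≡))))
          d₄ : σ₄ d ≡ value-at (suc j)
          d₄ = trans (↦-other σ₃ (<⇒≢ d<1)) (trans d₃ v₂)
          σ₄≈σ : σ₄ ≈⟨< d ⟩ σ
          σ₄≈σ u<d = trans (↦-other σ₃ (<⇒≢ (m<n⇒m<1+n u<d)))
            (trans (same₃ (m<n⇒m<1+n (m<n⇒m<1+n (m<n⇒m<1+n u<d))) (<⇒≢ u<d))
            (trans (same₂ (m<n⇒m<1+n (m<n⇒m<1+n (m<n⇒m<1+n u<d)))) (σ₁≈σ (m<n⇒m<1+n (m<n⇒m<1+n u<d)))))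
          (τ , r , same , τd) = iterates c (suc j) σ₄ c₄ d₄ (trans (↦-same σ₃ (1 + d)) (cong suc i₃))
            (λ i → trans (σ₄≈σ (below i)) (eq i))
      in τ , while-step (λ z → contradiction (trans (sym c≡) z) λ ()) (dec ⨾ r₂ ⨾ r₃ ⨾ inc) r
           , (λ u<d → trans (same u<d) (σ₄≈σ u<d))
           , trans τd (cong value-at (+-suc c j))
  compile-correct (prim p) = Primitive.correct p α
  compile-correct (ask j)  = I-correct j

none : Oracles 0
none ()

compile₀ : ∀ {n} → Term 0 n → Code n
compile₀ = compile λ ()

compile₀-correct : ∀ {α n} (t : Term 0 n) → Correct α (compile₀ t) (⟦ t ⟧ none)
compile₀-correct = compile-correct λ ()

correct-resp : ∀ {n α f g} {c : Code n} → (∀ ρ → f ρ ≡ g ρ) → Correct α c f → Correct α c g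
correct-resp f≗g correct .runs below eq =
  let (τ , r , same , τd) = runs correct below eq in τ , r , same , trans τd (f≗g _)

asPrimitive : ∀ {n} (t : Term 0 n) (f : (Fin n → ℕ) → ℕ) → (∀ ρ → ⟦ t ⟧ none ρ ≡ f ρ) → Primitive n
asPrimitive t f eq = record
  { code     = compile₀ t
  ; function = f
  ; correct  = λ α → correct-resp {c = compile₀ t} eq (compile₀-correct t)
  }

-- The oracles of a term are binary so that they can be families of sequences; the oracle of the
-- machine itself becomes a constant family.
consultCode : Code 2
consultCode args d = copy (args (suc zero)) d ⨾ consult d

consultCode-correct : ∀ α → Correct α consultCode (λ ρ → α (ρ (suc zero)))
consultCode-correct α .runs {d = d} {σ} below eq =
  let (τ , r , same , τd) = copy-runs α σ (below (suc zero))
  in τ ⟨ d ↦ α (τ d) ⟩ , (r ⨾ consult)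
       , (λ u<d → trans (↦-other τ (<⇒≢ u<d)) (same u<d))
       , trans (↦-same τ d) (cong α (trans τd (eq (suc zero))))

-- A termination proof for an unbounded loop; recursion on it constructs the run of `loopCode`.
data Iterates (test next : ℕ → ℕ) : ℕ → ℕ → Set where
  done  : ∀ {x} → test x ≡ 0 → Iterates test next x x
  again : ∀ {x y} → test x ≢ 0 → Iterates test next (next x) y → Iterates test next x y

loopCode : ∀ {n} (init : Code n) (test next out : Code (1 + n)) → Code n
loopCode init test next out args d =
  init args d ⨾ test (d ◂ args) (1 + d) ⨾
  while (1 + d) (next (d ◂ args) (1 + d) ⨾ move (1 + d) d ⨾ test (d ◂ args) (1 + d)) ⨾
  out (d ◂ args) (1 + d) ⨾ move (1 + d) d

loopCode-correct : ∀ {n α} {init : Code n} {test next out : Code (1 + n)} {fi ft fn fo g} →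
  Correct α init fi → Correct α test ft → Correct α next fn → Correct α out fo →
  (∀ ρ → ∃[ y ] Iterates (λ x → ft (x ◂ ρ)) (λ x → fn (x ◂ ρ)) (fi ρ) y × fo (y ◂ ρ) ≡ g ρ) →
  Correct α (loopCode init test next out) g
loopCode-correct {n} {α} {init} {test} {next} {out} {fi} {ft} {fn} {fo} {g} ci ct cn co iterates .runs
    {args} {d} {σ} {ρ} below eq =
  let (y , its , yields) = iterates ρ
      (σ₁ , r₁ , same₁ , d₁) = runs ci below eq
      (σ₂ , r₂ , same₂ , t₂) = runs ct below′ (env′ σ₁ d₁ λ i → trans (same₁ (below i)) (eq i))
      (σ₃ , r₃ , same₃ , d₃) = loop its σ₂ (trans (same₂ (n<1+n d)) d₁) t₂
        (λ i → trans (same₂ (m<n⇒m<1+n (below i))) (trans (same₁ (below i)) (eq i)))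
      σ₃≈σ : σ₃ ≈⟨< d ⟩ σ
      σ₃≈σ u<d = trans (same₃ u<d) (trans (same₂ (m<n⇒m<1+n u<d)) (same₁ u<d))
      (σ₄ , r₄ , same₄ , o₄) = runs co below′ (env′ σ₃ d₃ λ i → trans (σ₃≈σ (below i)) (eq i))
      (σ₅ , r₅ , d₅ , same₅) = move-runs α σ₄ (n<1+n d)
  in σ₅ , (r₁ ⨾ r₂ ⨾ r₃ ⨾ r₄ ⨾ r₅)
        , (λ u<d → trans (same₅ (m<n⇒m<1+n u<d) (<⇒≢ u<d)) (trans (same₄ (m<n⇒m<1+n u<d)) (σ₃≈σ u<d)))
        , trans d₅ (trans o₄ yields)
  where
  below′ : ∀ i → (d ◂ args) i < 1 + d
  below′ zero    = n<1+n d
  below′ (suc i) = m<n⇒m<1+n (below i)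

  env′ : ∀ σ {x} → σ d ≡ x → (∀ i → σ (args i) ≡ ρ i) → ∀ i → σ ((d ◂ args) i) ≡ (x ◂ ρ) i
  env′ σ d≡ eq zero    = d≡
  env′ σ d≡ eq (suc i) = eq i

  body = next (d ◂ args) (1 + d) ⨾ move (1 + d) d ⨾ test (d ◂ args) (1 + d)

  loop : ∀ {x y} → Iterates (λ x → ft (x ◂ ρ)) (λ x → fn (x ◂ ρ)) x y →
         ∀ σ → σ d ≡ x → σ (1 + d) ≡ ft (x ◂ ρ) → (∀ i → σ (args i) ≡ ρ i) →
         ∃[ τ ] Run α (while (1 + d) body) σ τ × τ ≈⟨< d ⟩ σ × τ d ≡ y
  loop (done z)     σ d≡ t≡ eq = σ , while-stop (trans t≡ z) , (λ _ → refl) , d≡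
  loop (again nz it) σ d≡ t≡ eq =
    let (σ₁ , r₁ , same₁ , n₁) = runs cn below′ (env′ σ d≡ eq)
        (σ₂ , r₂ , d₂ , same₂) = move-runs α σ₁ (n<1+n d)
        σ₂≈σ : σ₂ ≈⟨< d ⟩ σ
        σ₂≈σ u<d = trans (same₂ (m<n⇒m<1+n u<d) (<⇒≢ u<d)) (same₁ (m<n⇒m<1+n u<d))
        (σ₃ , r₃ , same₃ , t₃) = runs ct below′ (env′ σ₂ (trans d₂ n₁) λ i → trans (σ₂≈σ (below i)) (eq i))
        (τ , r , same , τd) = loop it σ₃ (trans (same₃ (n<1+n d)) (trans d₂ n₁)) t₃
          (λ i → trans (same₃ (m<n⇒m<1+n (below i))) (trans (σ₂≈σ (below i)) (eq i)))
    in τ , while-step (λ z → nz (trans (sym t≡) z)) (r₁ ⨾ r₂ ⨾ r₃) r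
         , (λ u<d → trans (same u<d) (trans (same₃ (m<n⇒m<1+n u<d)) (σ₂≈σ u<d))) , τd

opaque
  -- Input and output share counter 0, while code needs a destination above its arguments; hence the
  -- final `move`.
  toMachine : Code 1 → Machine
  toMachine c = assemble (c (const 0) 1 ⨾ move 1 0) 0

  toMachine-computes : ∀ {α c f} → Correct α c f → Φ (toMachine c) α (λ n → f (const n))
  toMachine-computes {α} {c} correct n =
    let (σ₁ , r₁ , _ , v₁) = runs correct {args = const 0} {1} {initialCounters n} {const n} (λ _ → n<1+n 0) (λ _ → refl)
        (σ₂ , r₂ , v₂ , _) = move-runs α σ₁ (n<1+n 0)
    in subst (Halts (toMachine c) α (initial n)) (trans v₂ v₁) (run-halts (r₁ ⨾ r₂))

-- Primitive recursive arithmetic and pairing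

op₁ : ∀ {m n} → Primitive 1 → Term m n → Term m n
op₁ p t = bind t (ren (λ _ → 0F) (prim p))

-- Two successive bindings leave the argument bound last at variable 0, hence the exchange.
swap : ∀ {n} → Fin 2 → Fin (2 + n)
swap 0F = 1F
swap 1F = 0F

call₂ : ∀ {m n} → Term m 2 → Term m n → Term m n → Term m n
call₂ f t u = bind t (bind (ren suc u) (ren swap f))

op₂ : ∀ {m n} → Primitive 2 → Term m n → Term m n → Term m n
op₂ p = call₂ (prim p)

-- The second branch has the predecessor of the scrutinee as variable 0.
caseT : ∀ {m n} → Term m n → Term m n → Term m (1 + n) → Term m n
caseT t z s = rec t z (ren suc s)

ifZero : ∀ {m n} → Term m n → Term m n → Term m n → Term m n
ifZero t z s = caseT t z (ren suc s)

plusP : Primitive 2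
plusP = asPrimitive (rec (var 0F) (var 1F) (succ (var 0F))) (λ ρ → ρ 0F + ρ 1F) λ ρ → lemma (ρ 1F) (ρ 0F)
  where
  lemma : ∀ y x → primRec y (λ v _ → suc v) x ≡ x + y
  lemma y zero    = refl
  lemma y (suc x) = cong suc (lemma y x)

predP : Primitive 1
predP = asPrimitive (rec (var 0F) zer (var 1F)) (λ ρ → pred (ρ 0F)) λ ρ → lemma (ρ 0F)
  where
  lemma : ∀ x → primRec 0 (λ _ i → i) x ≡ pred x
  lemma zero    = refl
  lemma (suc x) = refl

monusP : Primitive 2
monusP = asPrimitive (rec (var 1F) (var 0F) (op₁ predP (var 0F))) (λ ρ → ρ 0F ∸ ρ 1F) λ ρ → lemma (ρ 0F) (ρ 1F)
  where
  lemma : ∀ x y → primRec x (λ v _ → pred v) y ≡ x ∸ y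
  lemma x zero    = refl
  lemma x (suc y) = trans (cong pred (lemma x y)) (pred[m∸n]≡m∸[1+n] x y)

triangleP : Primitive 1
triangleP = asPrimitive (rec (var 0F) zer (succ (op₂ plusP (var 1F) (var 0F)))) (λ ρ → triangle (ρ 0F)) λ ρ → lemma (ρ 0F)
  where
  lemma : ∀ x → primRec 0 (λ v i → suc (i + v)) x ≡ triangle x
  lemma zero    = refl
  lemma (suc x) = cong (λ v → suc (x + v)) (lemma x)

infixl 6 _⊕_ _⊝_

_⊕_ _⊝_ : ∀ {m n} → Term m n → Term m n → Term m n
_⊕_ = op₂ plusP
_⊝_ = op₂ monusP

pairP : Primitive 2
pairP = asPrimitive (var 0F ⊕ op₁ triangleP (var 0F ⊕ var 1F)) (λ ρ → pair (ρ 0F) (ρ 1F)) λ ρ → refl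

π₁ π₂ : ℕ → ℕ
π₁ = proj₁ ∘ unpair
π₂ = proj₂ ∘ unpair

pair-unpair : ∀ k → pair (π₁ k) (π₂ k) ≡ k
pair-unpair zero = refl
pair-unpair (suc k) with unpair k | pair-unpair k
... | a , zero  | eq rewrite +-identityʳ a = cong suc eq
... | a , suc b | eq rewrite +-suc a b = cong suc eq

-- The index of the anti-diagonal on which k lies.
diagonal : ℕ → ℕ
diagonal = primRec 0 λ v i → primRec (suc v) (λ _ _ → v) (v + triangle v ∸ i)

-- The pairs with sum `s` have the numbers from `triangle s` to `s + triangle s`, so the recursion
-- moves to the next diagonal only at the last of them.
diagonal-step : ∀ s k → suc k ≤ s + triangle s → primRec (suc s) (λ _ _ → s) (s + triangle s ∸ k) ≡ s
diagonal-step s k k< with s + triangle s ∸ k in eq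
... | suc _ = refl
... | zero  = contradiction (≤-trans k< (m∸n≡0⇒m≤n eq)) 1+n≰n

diagonal-unpair : ∀ k → diagonal k ≡ π₁ k + π₂ k
diagonal-unpair zero = refl
diagonal-unpair (suc k) rewrite diagonal-unpair k with unpair k | pair-unpair k
... | a , zero  | refl rewrite +-identityʳ a | n∸n≡0 (a + triangle a) = refl
... | a , suc b | refl rewrite +-suc a b =
  diagonal-step (suc (a + b)) (a + triangle (suc (a + b))) (s≤s (+-monoˡ-≤ (triangle (suc (a + b))) (m≤m+n a b)))

diagonalP : Primitive 1
diagonalP = asPrimitive
  (rec (var 0F) zer (ifZero (var 0F ⊕ op₁ triangleP (var 0F) ⊝ var 1F) (succ (var 0F)) (var 0F)))
  (λ ρ → π₁ (ρ 0F) + π₂ (ρ 0F)) λ ρ → diagonal-unpair (ρ 0F)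

π₁P : Primitive 1
π₁P = asPrimitive (var 0F ⊝ op₁ triangleP (op₁ diagonalP (var 0F))) (λ ρ → π₁ (ρ 0F)) λ ρ → lemma (ρ 0F)
  where
  lemma : ∀ k → k ∸ triangle (π₁ k + π₂ k) ≡ π₁ k
  lemma k = trans (cong (_∸ triangle (π₁ k + π₂ k)) (sym (pair-unpair k))) (m+n∸n≡m (π₁ k) (triangle (π₁ k + π₂ k)))

fstT : ∀ {m n} → Term m n → Term m n
fstT = op₁ π₁P

π₂P : Primitive 1
π₂P = asPrimitive (op₁ diagonalP (var 0F) ⊝ fstT (var 0F)) (λ ρ → π₂ (ρ 0F)) λ ρ → m+n∸m≡n (π₁ (ρ 0F)) (π₂ (ρ 0F))

sndT : ∀ {m n} → Term m n → Term m n
sndT = op₁ π₂P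

pairT : ∀ {m n} → Term m n → Term m n → Term m n
pairT = op₂ pairP

lit : ∀ {m n} → ℕ → Term m n
lit zero    = zer
lit (suc k) = succ (lit k)

⟦lit⟧ : ∀ {m n} k (O : Oracles m) (ρ : Fin n → ℕ) → ⟦ lit k ⟧ O ρ ≡ k
⟦lit⟧ zero    O ρ = refl
⟦lit⟧ (suc k) O ρ = cong suc (⟦lit⟧ k O ρ)

parity half : ℕ → ℕ
parity = primRec 0 λ v _ → 1 ∸ v
half   = primRec 0 λ v i → v + parity i

parityP halfP : Primitive 1
parityP = asPrimitive (rec (var 0F) zer (lit 1 ⊝ var 0F)) (λ ρ → parity (ρ 0F)) λ ρ → refl
halfP   = asPrimitive (rec (var 0F) zer (var 0F ⊕ op₁ parityP (var 1F))) (λ ρ → half (ρ 0F)) λ ρ → refl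

parity-suc² : ∀ k → parity (2 + k) ≡ parity k
parity-suc² zero          = refl
parity-suc² (suc zero)    = refl
parity-suc² (suc (suc k)) = cong (λ v → 1 ∸ (1 ∸ v)) (parity-suc² k)

half-suc² : ∀ k → half (2 + k) ≡ suc (half k)
half-suc² k = trans (+-assoc (half k) (parity k) (1 ∸ parity k))
  (trans (cong (half k +_) (lemma k)) (+-comm (half k) 1))
  where
  lemma : ∀ k → parity k + (1 ∸ parity k) ≡ 1
  lemma zero          = refl
  lemma (suc zero)    = refl
  lemma (suc (suc k)) rewrite parity-suc² k = lemma k

interleave : ℕ → ℕ → ℕ → ℕ
interleave w x y = primRec x (λ _ _ → y) (parity w)

⟨⟩-interleave : ∀ p q w → ⟨ p , q ⟩ w ≡ interleave w (p (half w)) (q (half w))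
⟨⟩-interleave p q 0 = refl
⟨⟩-interleave p q 1 = refl
⟨⟩-interleave p q (suc (suc w)) rewrite parity-suc² w | half-suc² w = ⟨⟩-interleave (p ∘ suc) (q ∘ suc) w

interleaveT : ∀ {m n} → Term m n → Term m n → Term m n → Term m n
interleaveT w x y = ifZero (op₁ parityP w) x y

halfT : ∀ {m n} → Term m n → Term m n
halfT = op₁ halfP

-- The universal program

π₁-pair : ∀ a b → π₁ (pair a b) ≡ a
π₁-pair a b = cong proj₁ (unpair-pair a b)

π₂-pair : ∀ a b → π₂ (pair a b) ≡ b
π₂-pair a b = cong proj₂ (unpair-pair a b)

-- A number codes the infinite stack with top π₁ x above the stack coded by
-- π₂ x; since unpair 0 = (0 , 0), the number 0 codes the stack of zeros.
drop : ℕ → ℕ → ℕ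
drop k x = primRec x (λ v _ → π₂ v) k

nth : ℕ → ℕ → ℕ
nth k x = π₁ (drop k x)

drop-suc : ∀ k x → drop (suc k) x ≡ drop k (π₂ x)
drop-suc zero    x = refl
drop-suc (suc k) x = cong π₂ (drop-suc k x)

drop-zero : ∀ k → drop k 0 ≡ 0
drop-zero zero    = refl
drop-zero (suc k) = cong π₂ (drop-zero k)

dropP nthP : Primitive 2
dropP = asPrimitive (rec (var 0F) (var 1F) (sndT (var 0F))) (λ ρ → drop (ρ 0F) (ρ 1F)) λ ρ → refl
nthP  = asPrimitive (fstT (prim dropP)) (λ ρ → nth (ρ 0F) (ρ 1F)) λ ρ → refl

put : ℕ → ℕ → ℕ → ℕ
put zero    x T = pair x (π₂ T)
put (suc t) x T = pair (π₁ T) (put t x (π₂ T))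

nth-put : ∀ u t x T → nth u (put t x T) ≡ (if does (u ≟ t) then x else nth u T)
nth-put zero    zero    x T = π₁-pair x (π₂ T)
nth-put zero    (suc t) x T = π₁-pair (π₁ T) (put t x (π₂ T))
nth-put (suc u) zero    x T = trans (cong π₁ (drop-suc u (pair x (π₂ T))))
  (trans (cong (nth u) (π₂-pair x (π₂ T))) (sym (cong π₁ (drop-suc u T))))
nth-put (suc u) (suc t) x T = trans (cong π₁ (drop-suc u (pair (π₁ T) (put t x (π₂ T)))))
  (trans (cong (nth u) (π₂-pair (π₁ T) (put t x (π₂ T))))
  (trans (nth-put u t x (π₂ T)) (cong (if does (u ≟ t) then x else_) (sym (cong π₁ (drop-suc u T))))))

-- The recursion of `put` changes its last argument, which `rec` cannot do; the stack is therefore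
-- rebuilt from depth `t` upwards.
putP : Primitive 3
putP = asPrimitive
  (rec (var 0F) (pairT (var 1F) (op₂ dropP (succ (var 0F)) (var 2F)))
    (pairT (op₂ nthP (var 2F ⊝ succ (var 1F)) (var (suc (suc (suc 1F))))) (var 0F)))
  (λ ρ → put (ρ 0F) (ρ 1F) (ρ 2F)) λ ρ → whole (ρ 0F) (ρ 1F) (ρ 2F)
  where
  module _ (t x T : ℕ) where
    partial : ℕ → ℕ
    partial = primRec (pair x (drop (suc t) T)) (λ v i → pair (nth (t ∸ suc i) T) v)

    -- After j steps the top j + 1 entries below the first t ∸ j are in place.
    partial-put : ∀ j → j ≤ t → partial j ≡ put j x (drop (t ∸ j) T)
    partial-put zero    j≤t = refl
    partial-put (suc j) j<t = cong (pair (nth (t ∸ suc j) T))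
      (trans (partial-put j (<⇒≤ j<t)) (cong (λ k → put j x (drop k T)) (+-∸-assoc 1 j<t)))

    whole : partial t ≡ put t x T
    whole = trans (partial-put t ≤-refl) (cong (λ k → put t x (drop k T)) (n∸n≡0 t))

bit : Symbol → ℕ
bit blank = 0
bit mark  = 1

encodeList : List Symbol → ℕ
encodeList []      = 0
encodeList (s ∷ l) = pair (bit s) (encodeList l)

-- [] and blank ∷ [] have the same code, as they should.
encodeTape : Tape → ℕ
encodeTape (tape l s r) = pair (encodeList l) (encodeList (s ∷ r))

marks : List Symbol → ℕ
marks []      = 0
marks (s ∷ r) = marksFrom s r

marks-mark : ∀ l → marks (mark ∷ l) ≡ suc (marks l)
marks-mark []      = refl
marks-mark (_ ∷ l) = refl

marks≤code : ∀ l → marks l ≤ encodeList l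
marks≤code []          = z≤n
marks≤code (blank ∷ l) = z≤n
marks≤code (mark ∷ l) rewrite marks-mark l =
  s≤s (≤-trans (marks≤code l) (m≤n⇒m≤1+n (m≤m+n (encodeList l) (triangle (encodeList l)))))

nth-code-suc : ∀ c s l → nth (suc c) (encodeList (s ∷ l)) ≡ nth c (encodeList l)
nth-code-suc c s l = trans (cong π₁ (drop-suc c (encodeList (s ∷ l)))) (cong (nth c) (π₂-pair (bit s) (encodeList l)))

nth-marked : ∀ c l → c < marks l → nth c (encodeList l) ≡ 1
nth-marked c       (blank ∷ l) ()
nth-marked zero    (mark ∷ l) c< = π₁-pair 1 (encodeList l)
nth-marked (suc c) (mark ∷ l) c< rewrite marks-mark l with c<
... | s≤s c<′ = trans (nth-code-suc c mark l) (nth-marked c l c<′)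

nth-marks : ∀ l → nth (marks l) (encodeList l) ≡ 0
nth-marks []          = refl
nth-marks (blank ∷ l) = π₁-pair 0 (encodeList l)
nth-marks (mark ∷ l) rewrite marks-mark l = trans (nth-code-suc (marks l) mark l) (nth-marks l)

-- A bounded search for the end of the block: the candidate `c` advances as long as entry `c` is
-- nonzero and then stays. By `marks≤code` the code itself is a sufficient number of rounds.
count : ℕ → ℕ
count x = primRec 0 (λ c _ → primRec c (λ _ _ → suc c) (nth c x)) x

countP : Primitive 1
countP = asPrimitive
  (rec (var 0F) zer (ifZero (op₂ nthP (var 0F) (var 2F)) (var 0F) (succ (var 0F))))
  (λ ρ → count (ρ 0F)) λ ρ → refl

count-code : ∀ l → count (encodeList l) ≡ marks l
count-code l = trans (bounded (encodeList l)) (m≥n⇒m⊓n≡n (marks≤code l))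
  where
  bounded : ∀ N → primRec 0 (λ c _ → primRec c (λ _ _ → suc c) (nth c (encodeList l))) N ≡ N ⊓ marks l
  bounded zero = refl
  bounded (suc N) rewrite bounded N with N <? marks l
  ... | yes N< rewrite m≤n⇒m⊓n≡m (<⇒≤ N<) | nth-marked N l N< = sym (m≤n⇒m⊓n≡m N<)
  ... | no N≮  rewrite m≥n⇒m⊓n≡n (≮⇒≥ N≮) | nth-marks l = sym (m≥n⇒m⊓n≡n (m≤n⇒m≤1+n (≮⇒≥ N≮)))

block : ℕ → ℕ
block = primRec 0 (λ v _ → pair 1 v)

blockP : Primitive 1
blockP = asPrimitive (rec (var 0F) zer (pairT (lit 1) (var 0F))) (λ ρ → block (ρ 0F)) λ ρ → refl

unaryCode : ℕ → ℕ
unaryCode k = pair 0 (block k)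

unaryP : Primitive 1
unaryP = asPrimitive (pairT zer (op₁ blockP (var 0F))) (λ ρ → unaryCode (ρ 0F)) λ ρ → refl

encode-unary : ∀ k → encodeTape (unary k) ≡ unaryCode k
encode-unary zero    = refl
encode-unary (suc k) = cong (λ x → pair 0 (pair 1 x)) (lemma k)
  where
  lemma : ∀ k → encodeList (replicate k mark) ≡ block k
  lemma zero    = refl
  lemma (suc k) = cong (pair 1) (lemma k)

shiftCode : ℕ → ℕ → ℕ → ℕ
shiftCode m l r =
  primRec (pair (π₂ l) (pair (π₁ l) r))
    (λ _ m → primRec (pair (pair (π₁ r) l) (π₂ r)) (λ _ _ → pair l r) m) m

shiftP : Primitive 3
shiftP = asPrimitive
  (caseT (var 0F) (pairT (sndT (var 1F)) (pairT (fstT (var 1F)) (var 2F)))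
    (ifZero (var 0F) (pairT (pairT (fstT (var 3F)) (var 2F)) (sndT (var 3F))) (pairT (var 2F) (var 3F))))
  (λ ρ → shiftCode (ρ 0F) (ρ 1F) (ρ 2F)) λ ρ → refl

-- An exhausted side of the tape needs no test: 0 unpairs to (0 , 0), so popping it yields a blank
-- and again the empty stack.
shift-code : ∀ m l s r →
  encodeTape (shift (toMove m) (tape l s r)) ≡ shiftCode m (encodeList l) (encodeList (s ∷ r))
shift-code 0 [] s r = refl
shift-code 0 (x ∷ l) s r rewrite unpair-pair (bit x) (encodeList l) = refl
shift-code 1 l s [] rewrite unpair-pair (bit s) 0 = refl
shift-code 1 l s (x ∷ r) rewrite unpair-pair (bit s) (encodeList (x ∷ r)) = refl
shift-code (suc (suc m)) l s r = refl

sign : ℕ → ℕ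
sign = primRec 0 (λ _ _ → 1)

sign-symbol : ∀ w → bit (toSymbol w) ≡ sign w
sign-symbol zero    = refl
sign-symbol (suc w) = refl

actCode : ℕ → ℕ → ℕ
actCode a x = shiftCode (π₂ (π₁ a)) (π₁ x) (pair (sign (π₁ (π₁ a))) (π₂ (π₂ x)))

swap₃ : ∀ {n} → Fin 3 → Fin (3 + n)
swap₃ 0F = 2F
swap₃ 1F = 1F
swap₃ 2F = 0F

op₃ : ∀ {m n} → Primitive 3 → Term m n → Term m n → Term m n → Term m n
op₃ p t u v = bind t (bind (ren suc u) (bind (ren (λ i → suc (suc i)) v) (ren swap₃ (prim p))))

actP : Primitive 2
actP = asPrimitive
  (op₃ shiftP (sndT (fstT (var 0F))) (fstT (var 1F))
    (pairT (ifZero (fstT (fstT (var 0F))) zer (lit 1)) (sndT (sndT (var 1F)))))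
  (λ ρ → actCode (ρ 0F) (ρ 1F)) λ ρ → refl

act-code : ∀ a x → encodeTape (act (toAction a) x) ≡ actCode a (encodeTape x)
act-code a (tape l s r)
  rewrite unpair-pair (encodeList l) (encodeList (s ∷ r)) | unpair-pair (bit s) (encodeList r)
        | sym (sign-symbol (π₁ (π₁ a))) = shift-code (π₂ (π₁ a)) l (toSymbol (π₁ (π₁ a))) r

-- The configuration with code c is in state π₁ c and has the stack of tapes π₂ c.
queryCode : ℕ → ℕ → ℕ → ℕ
queryCode answer j T = pair (π₂ j) (put (π₁ j) (unaryCode answer) T)

queryP : Primitive 3
queryP = asPrimitive
  (pairT (sndT (var 1F)) (op₃ putP (fstT (var 1F)) (op₁ unaryP (var 0F)) (var 2F)))
  (λ ρ → queryCode (ρ 0F) (ρ 1F) (ρ 2F)) λ ρ → refl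

chosen : ℕ → ℕ → ℕ
chosen j T = primRec (π₁ (π₂ j)) (λ _ _ → π₂ (π₂ j)) (π₁ (π₂ (nth (π₁ j) T)))

scanCode : ℕ → ℕ → ℕ
scanCode j T = pair (π₂ (chosen j T)) (put (π₁ j) (actCode (chosen j T) (nth (π₁ j) T)) T)

chosenP scanP : Primitive 2
chosenP = asPrimitive
  (ifZero (fstT (sndT (op₂ nthP (fstT (var 0F)) (var 1F)))) (fstT (sndT (var 0F))) (sndT (sndT (var 0F))))
  (λ ρ → chosen (ρ 0F) (ρ 1F)) λ ρ → refl
scanP = asPrimitive
  (pairT (sndT (prim chosenP))
    (op₃ putP (fstT (var 0F)) (op₂ actP (prim chosenP) (op₂ nthP (fstT (var 0F)) (var 1F))) (var 1F)))
  (λ ρ → scanCode (ρ 0F) (ρ 1F)) λ ρ → refl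

tapeValue : ℕ → ℕ → ℕ
tapeValue t T = count (π₂ (nth t T))

tapeValueP : Primitive 2
tapeValueP = asPrimitive (op₁ countP (sndT (prim nthP))) (λ ρ → tapeValue (ρ 0F) (ρ 1F)) λ ρ → refl

executeCode : Baire → ℕ → ℕ → ℕ
executeCode β i T =
  primRec (queryCode (β (tapeValue (π₁ (π₂ i)) T)) (π₂ i) T) (λ _ _ → scanCode (π₂ i) T) (π₁ i)

record Represents (c : ℕ) (k : Config) : Set where
  constructor represents
  field
    state : π₁ c ≡ Config.state k
    tapes : ∀ u → nth u (π₂ c) ≡ encodeTape (Config.tapes k u)

open Represents

represents-put : ∀ {T ts} q t x → (∀ u → nth u T ≡ encodeTape (ts u)) →
  ∀ {y} → y ≡ encodeTape x → Represents (pair q (put t y T)) (config q (ts [ t ≔ x ]))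
represents-put {T} {ts} q t x eq {y} y≡ = represents (π₁-pair q (put t y T)) λ u →
  trans (cong (nth u) (π₂-pair q (put t y T))) (trans (nth-put u t y T) (cases u))
  where
  cases : ∀ u → (if does (u ≟ t) then y else nth u T) ≡ encodeTape ((ts [ t ≔ x ]) u)
  cases u with does (u ≟ t)
  ... | true  = y≡
  ... | false = eq u

value-code : ∀ x → count (π₂ (encodeTape x)) ≡ value x
value-code (tape l s r) = trans (cong count (π₂-pair (encodeList l) (encodeList (s ∷ r)))) (count-code (s ∷ r))

scanned-code : ∀ x → π₁ (π₂ (encodeTape x)) ≡ bit (Tape.scanned x)
scanned-code (tape l s r) = trans (cong π₁ (π₂-pair (encodeList l) (encodeList (s ∷ r)))) (π₁-pair (bit s) (encodeList r))

module _ (β : Baire) {T : ℕ} {ts : ℕ → Tape} (eq : ∀ u → nth u T ≡ encodeTape (ts u)) where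

  query-code : ∀ j → Represents (queryCode (β (tapeValue (π₁ j) T)) j T) (execute β (query (π₁ j) (π₂ j)) ts)
  query-code j = represents-put (π₂ j) (π₁ j) (unary (β (value (ts (π₁ j))))) eq
    (trans (cong (unaryCode ∘ β) (trans (cong (count ∘ π₂) (eq (π₁ j))) (value-code (ts (π₁ j)))))
      (sym (encode-unary (β (value (ts (π₁ j)))))))

  scan-code : ∀ j → let t = π₁ j ; b = toAction (π₁ (π₂ j)) ; m = toAction (π₂ (π₂ j)) in
              Represents (scanCode j T) (execute β (scan t b m) ts)
  scan-code j = bySymbol (Tape.scanned (ts t)) refl
    where
    t = π₁ j
    instruction = scan t (toAction (π₁ (π₂ j))) (toAction (π₂ (π₂ j)))

    performs : ∀ a → chosen j T ≡ a →
      execute β instruction ts ≡ config (Action.next (toAction a)) (ts [ t ≔ act (toAction a) (ts t) ]) →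
      Represents (scanCode j T) (execute β instruction ts)
    performs a chosen≡ execute≡ =
      subst₂ (λ a′ k → Represents (pair (π₂ a′) (put t (actCode a′ (nth t T)) T)) k) (sym chosen≡) (sym execute≡)
        (represents-put (π₂ a) t (act (toAction a) (ts t)) eq
          (trans (cong (actCode a) (eq t)) (sym (act-code a (ts t)))))

    scannedBit : ∀ {s} → Tape.scanned (ts t) ≡ s → π₁ (π₂ (nth t T)) ≡ bit s
    scannedBit h = trans (cong (π₁ ∘ π₂) (eq t)) (trans (scanned-code (ts t)) (cong bit h))

    bySymbol : ∀ s → Tape.scanned (ts t) ≡ s → Represents (scanCode j T) (execute β instruction ts)
    bySymbol blank h = performs (π₁ (π₂ j)) (cong (primRec (π₁ (π₂ j)) (λ _ _ → π₂ (π₂ j))) (scannedBit h))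
      (execute-blank {β} {t} {toAction (π₁ (π₂ j))} {toAction (π₂ (π₂ j))} ts h)
    bySymbol mark h = performs (π₂ (π₂ j)) (cong (primRec (π₁ (π₂ j)) (λ _ _ → π₂ (π₂ j))) (scannedBit h))
      (execute-mark {β} {t} {toAction (π₁ (π₂ j))} {toAction (π₂ (π₂ j))} ts h)

  execute-code : ∀ i → Represents (executeCode β i T) (execute β (toInstruction i) ts)
  execute-code i with unpair i
  ... | zero  , j = query-code j
  ... | suc _ , j = scan-code j

nextCode : ℕ → Baire → ℕ → ℕ
nextCode i β c = executeCode β (nth (π₁ c) (π₂ i)) (π₂ c)

-- Nonzero as long as the state is a position in the program.
running : ℕ → ℕ → ℕ
running i c = π₁ i ∸ π₁ c

initialCode : ℕ → ℕ
initialCode n = pair 0 (pair (unaryCode n) 0)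

-- A blank tape has code 0, and so has an infinite stack of blank tapes; only tape 0 has to be
-- written.
initial-code : ∀ n → Represents (initialCode n) (initial n)
initial-code n = represents (π₁-pair 0 (pair (unaryCode n) 0)) λ u →
  trans (cong (nth u) (π₂-pair 0 (pair (unaryCode n) 0))) (stack u)
  where
  stack : ∀ u → nth u (pair (unaryCode n) 0) ≡ encodeTape (Config.tapes (initial n) u)
  stack zero    = trans (π₁-pair (unaryCode n) 0) (sym (encode-unary n))
  stack (suc u) = trans (cong π₁ (trans (drop-suc u (pair (unaryCode n) 0))
    (trans (cong (drop u) (π₂-pair (unaryCode n) 0)) (drop-zero u)))) refl

fetch-running : ∀ l p q {x} → fetch (toProgram l p) q ≡ just x → l ∸ q ≢ 0 × x ≡ toInstruction (nth q p)
fetch-running (suc l) p zero    eq = (λ ()) , sym (just-injective eq)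
fetch-running (suc l) p (suc q) eq =
  let (r , eq′) = fetch-running l (π₂ p) q eq
  in r , trans eq′ (cong (toInstruction ∘ π₁) (sym (drop-suc q p)))

fetch-outside : ∀ l p q → fetch (toProgram l p) q ≡ nothing → l ∸ q ≡ 0
fetch-outside zero    p q       eq = n∸q q
  where
  n∸q : ∀ q → 0 ∸ q ≡ 0
  n∸q zero    = refl
  n∸q (suc q) = refl
fetch-outside (suc l) p (suc q) eq = fetch-outside l (π₂ p) q eq

-- Recursion on the halting derivation: each of its steps is one round of the loop, so the
-- derivation bounds the iteration.
simulates : ∀ {i β k m} → Halts (machine i) β k m → ∀ {c} → Represents c k →
            ∃[ y ] Iterates (running i) (nextCode i β) c y × tapeValue 0 (π₂ y) ≡ m
simulates {i} {β} {config q ts} (halted h) {c} R with fetch (machine i) q in eq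
... | nothing = c , done (trans (cong (π₁ i ∸_) (state R)) (fetch-outside (π₁ i) (π₂ i) q eq))
                  , trans (cong (count ∘ π₂) (tapes R 0)) (value-code (ts 0))
simulates {i} {β} {config q ts} (steps h r) {c} R with fetch (machine i) q in eq
... | just x with fetch-running (π₁ i) (π₂ i) q eq
...   | nz , refl with just-injective h
...     | refl =
  let (y , its , out) = simulates {i} {β} r
        (subst (λ q′ → Represents (executeCode β (nth q′ (π₂ i)) (π₂ c)) (execute β (toInstruction (nth q (π₂ i))) ts))
          (sym (state R)) (execute-code β (tapes R) (nth q (π₂ i))))
  in y , again (λ z → nz (trans (cong (π₁ i ∸_) (sym (state R))) z)) its , out

-- The index is a term and not a numeral because the machine to be run may be known only through an
-- oracle, as the first entry of a name of an open set.
module _ {m} (index : Term (1 + m) 2) where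

  private
    initT : Term (1 + m) 2
    initT = pairT zer (pairT (op₁ unaryP (var 1F)) zer)

    indexT runningT nextT outT instructionT : Term (1 + m) 3
    indexT = ren suc index
    runningT = fstT indexT ⊝ fstT (var 0F)
    instructionT = op₂ nthP (fstT (var 0F)) (sndT indexT)
    -- Compiled code evaluates the first branch in any case, so the oracle is asked at scan
    -- instructions too; as oracles are total, this does no harm.
    nextT = ifZero (fstT instructionT)
      (op₃ queryP (call₂ (ask 0F) (var 1F) (op₂ tapeValueP (fstT (sndT instructionT)) (sndT (var 0F))))
        (sndT instructionT) (sndT (var 0F)))
      (op₂ scanP (sndT instructionT) (sndT (var 0F)))
    outT = op₂ tapeValueP zer (sndT (var 0F))

  opaque
    -- On (x , n): the machine with the given index, run on input n with the
    -- oracle I 0 (x , -).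
    runCode : (Fin (1 + m) → Code 2) → Code 2
    runCode I = loopCode (compile I initT) (compile I runningT) (compile I nextT) (compile I outT)

    runCode-correct : ∀ {α I O} → (∀ j → Correct α (I j) (λ ρ → O j (ρ 0F) (ρ 1F))) →
      ∀ {i} {h : ℕ → ℕ → ℕ} → (∀ ρ → ⟦ index ⟧ O ρ ≡ i) → (∀ x n → Halts (machine i) (O 0F x) (initial n) (h x n)) →
      Correct α (runCode I) (λ ρ → h (ρ 0F) (ρ 1F))
    runCode-correct {O = O} I-correct {h = h} index≡ halts =
      loopCode-correct (compile-correct {O = O} I-correct initT) (compile-correct {O = O} I-correct runningT)
        (compile-correct {O = O} I-correct nextT) (compile-correct {O = O} I-correct outT)
        λ ρ → simulates {⟦ index ⟧ O ρ} {O 0F (ρ 0F)}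
          (subst (λ i → Halts (machine i) (O 0F (ρ 0F)) (initial (ρ 1F)) (h (ρ 0F) (ρ 1F)))
            (sym (index≡ ρ)) (halts (ρ 0F) (ρ 1F)))
          (initial-code (ρ 1F))

-- Enumerability

Correct₂ : Baire → Code 2 → (ℕ → ℕ → ℕ) → Set
Correct₂ α C f = Correct α C (λ ρ → f (ρ 0F) (ρ 1F))

compile₁ : ∀ {n} → Code 2 → Term 1 n → Code n
compile₁ C = compile (λ _ → C)

compile₁-correct : ∀ {α C f n} → Correct₂ α C f → (t : Term 1 n) → Correct α (compile₁ C t) (⟦ t ⟧ (λ _ → f))
compile₁-correct C-correct = compile-correct (λ _ → C-correct)

choose₂ : ∀ {a} {A : Set a} → A → A → Fin 2 → A
choose₂ x y 0F = x
choose₂ x y 1F = y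

compile₂ : ∀ {n} → Code 2 → Code 2 → Term 2 n → Code n
compile₂ C D = compile (choose₂ C D)

compile₂-correct : ∀ {α C D f g n} → Correct₂ α C f → Correct₂ α D g → (t : Term 2 n) →
                   Correct α (compile₂ C D t) (⟦ t ⟧ (choose₂ f g))
compile₂-correct cf cg = compile-correct λ { 0F → cf ; 1F → cg }

computes₁ : ∀ {α C} f → Correct₂ α C f → (t : Term 1 1) →
            Φ (toMachine (compile₁ C t)) α (λ k → ⟦ t ⟧ (λ _ → f) (const k))
computes₁ {C = C} f cf t = toMachine-computes {c = compile₁ C t} {⟦ t ⟧ (λ _ → f)} (compile₁-correct {f = f} cf t)

computes₂ : ∀ {α C D} f g → Correct₂ α C f → Correct₂ α D g → (t : Term 2 1) →
            Φ (toMachine (compile₂ C D t)) α (λ k → ⟦ t ⟧ (choose₂ f g) (const k))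
computes₂ {C = C} {D} f g cf cg t =
  toMachine-computes {c = compile₂ C D t} {⟦ t ⟧ (choose₂ f g)} (compile₂-correct {f = f} {g} cf cg t)

ask₀ : ∀ {m n} → Term (1 + m) n → Term (1 + m) n → Term (1 + m) n
ask₀ = call₂ (ask 0F)

ask₁ : ∀ {m n} → Term (2 + m) n → Term (2 + m) n → Term (2 + m) n
ask₁ = call₂ (ask 1F)

gap : ℕ → ℕ → ℕ
gap x y = (x ∸ y) + (y ∸ x)

gapT : ∀ {m n} → Term m n → Term m n → Term m n
gapT t u = (t ⊝ u) ⊕ (u ⊝ t)

gap-refl : ∀ x → gap x x ≡ 0
gap-refl x rewrite n∸n≡0 x = refl

gap-≡ : ∀ x y → gap x y ≡ 0 → x ≡ y
gap-≡ x y eq = ≤-antisym (m∸n≡0⇒m≤n (m+n≡0⇒m≡0 (x ∸ y) eq)) (m∸n≡0⇒m≤n (m+n≡0⇒n≡0 (x ∸ y) eq))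

ifEqual : ℕ → ℕ → ℕ → ℕ → ℕ
ifEqual x y u v = primRec u (λ _ _ → v) (gap x y)

ifEqual-≡ : ∀ {x y} u v → x ≡ y → ifEqual x y u v ≡ u
ifEqual-≡ {x} u v refl rewrite gap-refl x = refl

ifEqual-≢ : ∀ {x y} u v → x ≢ y → ifEqual x y u v ≡ v
ifEqual-≢ {x} {y} u v x≢y with gap x y in eq
... | zero  = contradiction (gap-≡ x y eq) x≢y
... | suc _ = refl

ifEqualT : ∀ {m n} (t t′ u v : Term m n) → Term m n
ifEqualT t t′ u v = ifZero (gapT t t′) u v

-- Has the shape to which `suc (2 * k)` reduces, so that denotations agree with `odds` by
-- computation.
oddT : ∀ {m n} → Term m n → Term m n
oddT t = succ (t ⊕ (t ⊕ zer))

startingWith : ℕ → ℕ → Baire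
startingWith i x = primRec i (λ _ _ → x)

startingWith-computable : ∀ i → ComputableSequence (startingWith i 0)
startingWith-computable i = toMachine code ,
  λ k → subst (Halts _ _ _) (cong (λ j → startingWith j 0 k) (⟦lit⟧ i none (const k)))
    (toMachine-computes {c = code} {⟦ t ⟧ none} (compile₀-correct t) k)
  where
  t : Term 0 1
  t = ifZero (var 0F) (lit i) zer
  code : Code 1
  code = compile₀ t

-- The given machine need not be a compiled program and expects the zero oracle; interpreting it
-- with a simulated zero oracle makes it usable inside terms, whatever the actual oracle `α` is.
sequenceCode : ∀ {f} → ComputableSequence f → ∃[ C ] ∀ α → Correct₂ α C (λ _ → f)
sequenceCode {f} (M , Φf) with machineIndex M
... | i , refl = runCode {0} (lit i) (λ _ → compile₀ zer) , λ α →
  runCode-correct {0} (lit i) {O = λ _ _ _ → 0} (λ _ → compile₀-correct zer)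
    (⟦lit⟧ i (λ _ _ _ → 0)) (λ _ → Φf)

module _ {A : Pred ℕ 0ℓ} (lem : ExcludedMiddle 0ℓ) where

  -- Here `g` enumerates with pauses, 0 meaning no output. The pauses are filled with a fixed
  -- element `a`, so it must be known whether `A` has one.
  enumerable : ∀ {C : Code 1} {g : Baire} → Correct (const 0) C (λ ρ → g (ρ 0F)) → (∀ n → A n ⇔ (∃[ k ] g k ≡ suc n)) →
               ComputablyEnumerable A
  enumerable {C} {g} C-correct spec with lem {∃[ a ] A a}
  ... | no empty     = inj₁ λ n a → empty (n , a)
  ... | yes (a , Aa) = inj₂ (f , (toMachine code , λ k → subst (Halts _ _ _)
                                   (cong (λ a → primRec a (λ _ n → n) (g k)) (⟦lit⟧ a O (const k)))
                                   (computes₁ {C = C′} (λ _ → g) lifted t k))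
                               , λ n → mk⇔ (sound n) (λ (k , eq) → complete n k (g k) refl eq))
    where
    open Equivalence
    O = λ _ _ → g
    C′ : Code 2
    C′ args = C λ _ → args 1F
    f : ℕ → ℕ
    f k = primRec a (λ _ n → n) (g k)
    t : Term 1 1
    t = caseT (ask₀ zer (var 0F)) (lit a) (var 0F)
    lifted : Correct₂ (const 0) C′ (λ _ → g)
    lifted .Correct.runs below eq = Correct.runs C-correct (λ _ → below 1F) (λ _ → eq 1F)
    code : Code 1
    code = compile₁ C′ t
    sound : ∀ n → A n → ∃[ k ] f k ≡ n
    sound n An = let (k , eq) = to (spec n) An in k , cong (primRec a λ _ n → n) eq
    complete : ∀ n k v → g k ≡ v → primRec a (λ _ n → n) v ≡ n → A n
    complete n k zero    _  refl = Aa
    complete n k (suc v) eq refl = from (spec v) (k , eq)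

-- Each `evidence n` is a name in 𝕊 of the truth value of `A n`, computed uniformly in `n` and under
-- every oracle.
record Semidecision (A : Pred ℕ 0ℓ) : Set where
  field
    evidence : ℕ → ℕ → ℕ
    code     : Code 2
    correct  : ∀ α → Correct₂ α code evidence
    spec     : ∀ n → A n ⇔ (∃[ k ] evidence n k ≢ 0)

semidecision : ∀ {A} → ComputablyEnumerable A → Semidecision A
semidecision (inj₁ empty) = record
  { evidence = λ _ _ → 0
  ; code     = compile₀ zer
  ; correct  = λ α → compile₀-correct zer
  ; spec     = λ n → mk⇔ (λ a → contradiction a (empty n)) (λ (_ , nz) → contradiction refl nz)
  }
semidecision (inj₂ (f , computable , spec)) = record
  { evidence = λ n k → ifEqual (f k) n 1 0
  ; code     = compile₁ (proj₁ (sequenceCode computable)) t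
  ; correct  = λ α → compile₁-correct {f = λ _ → f} (proj₂ (sequenceCode computable) α) t
  ; spec     = λ n → mk⇔
      (λ a → let (k , eq) = to (spec n) a in k , λ z → contradiction (trans (sym (ifEqual-≡ 1 0 eq)) z) λ ())
      (λ (k , nz) → from (spec n) (k , decidable-stable (f k ≟ n) λ ne → nz (ifEqual-≢ 1 0 ne)))
  }
  where
  open Equivalence
  t : Term 1 2
  t = ifEqualT (ask₀ zer (var 1F)) (var 0F) (lit 1) zer

-- An instance of Markov's principle, here obtained from excluded middle.
nonzero : ExcludedMiddle 0ℓ → ∀ {p : Baire} → ¬ p ≗ const 0 → ∃[ j ] p j ≢ 0
nonzero lem {p} ¬0 with lem {∃[ j ] p j ≢ 0}
... | yes h = h
... | no h  = contradiction (λ j → decidable-stable (p j ≟ 0) λ nz → h (j , nz)) ¬0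

⊤⇒nonzero : ∀ {p x} → SierpinskiName p x → x ≡ ⊤ˢ → ¬ p ≗ const 0
⊤⇒nonzero (names-⊤ nz) refl = nz

≢⊤⇒zero : ∀ {p x} → SierpinskiName p x → x ≢ ⊤ˢ → p ≗ const 0
≢⊤⇒zero (names-⊥ z) _   = z
≢⊤⇒zero (names-⊤ _) ⊤≢⊤ = contradiction refl ⊤≢⊤

entry⇒⊤ : ∀ {p x} k {v} → SierpinskiName p x → p k ≡ suc v → x ≡ ⊤ˢ
entry⇒⊤ k (names-⊤ _) _  = refl
entry⇒⊤ k (names-⊥ z) eq = contradiction (trans (sym eq) (z k)) λ ()

-- The points of `S A` and their names

module _ {A : Pred ℕ 0ℓ} where

  number : Carrier (S A) → ℕ
  number ((n , _) , _) = n

  -- Membership in `A` determines the second component.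
  number-injective : ∀ x y → number x ≡ number y → _≈_ (S A) x y
  number-injective (_ , inj₁ (_ , refl)) (_ , inj₁ (_ , refl)) refl = refl , refl
  number-injective (_ , inj₁ (a , _))    (_ , inj₂ (¬a , _))   refl = contradiction a ¬a
  number-injective (_ , inj₂ (¬a , _))   (_ , inj₁ (a , _))    refl = contradiction a ¬a
  number-injective (_ , inj₂ (_ , refl)) (_ , inj₂ (_ , refl)) refl = refl , refl

  module _ (lem : ExcludedMiddle 0ℓ) where

    ptAt : ∀ {n} → Dec (A n) → Carrier (S A)
    ptAt {n} (yes a) = (n , ⊤ˢ) , inj₁ (a , refl)
    ptAt {n} (no ¬a) = (n , ⊥ˢ) , inj₂ (¬a , refl)

    pt : ℕ → Carrier (S A)
    pt n = ptAt {n} lem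

    number-pt : ∀ n → number (pt n) ≡ n
    number-pt n with lem {A n}
    ... | yes _ = refl
    ... | no _  = refl

    module _ (E : Semidecision A) where
      open Semidecision E
      open Equivalence

      -- Although `pt n` is chosen by cases on `A n`, one and the same sequence names it in both
      -- cases, so a machine need not decide membership.
      canonicalName : ℕ → Baire
      canonicalName n = ⟨ const n , evidence n ⟩

      canonicalName-names : ∀ n → names (S A) (canonicalName n) (pt n)
      canonicalName-names n with lem {A n}
      ... | yes a = refl , names-⊤ λ z → let (k , nz) = to (spec n) a in
                      nz (trans (sym (odds-⟨⟩ (const n) (evidence n) k)) (z k))
      ... | no ¬a = refl , names-⊥ λ k → trans (odds-⟨⟩ (const n) (evidence n) k)
                      (decidable-stable (evidence n k ≟ 0) λ nz → ¬a (from (spec n) (k , nz)))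

-- Spaces in which, as in ℕʳ, the first entry of a name determines the point.
record Numbered {c e n} (Y : RepresentedSpace c e n) : Set (c ⊔ˡ e ⊔ˡ n) where
  field
    point       : ℕ → Carrier Y
    index       : Carrier Y → ℕ
    index-cong  : ∀ {x y} → _≈_ Y x y → index x ≡ index y
    index-point : ∀ k → index (point k) ≡ k
    point-index : ∀ y → _≈_ Y (point (index y)) y
    named       : ∀ k → names Y (const k) (point k)
    first       : ∀ {p y} → names Y p y → p 0 ≡ index y

numbered-≅ : ∀ {c e n A} → ExcludedMiddle 0ℓ → ComputablyEnumerable A →
             {Y : RepresentedSpace c e n} → Numbered Y → S A ≅ Y
numbered-≅ {A = A} lem ce {Y} N = record
  { to        = point ∘ number
  ; from      = pt lem ∘ index
  ; to-cong   = λ (eq , _) → Y.reflexive (cong point eq)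
  ; from-cong = λ eq → X.reflexive (cong (pt lem) (index-cong eq))
  ; inverse   = (λ {y} {x} eq → Y.trans (Y.reflexive (cong point (trans (proj₁ eq) (number-pt lem (index y)))))
                                (point-index y))
              , (λ {x} {y} eq → number-injective (pt lem (index y)) x
                    (trans (number-pt lem (index y)) (trans (index-cong eq) (index-point (number x)))))
  } , (toMachine first₀ , λ {x} {p} (eq , _) → const (p 0) , computes₁ (λ _ → p) (consultCode-correct p) t₀ ,
        names-resp Y (λ _ → refl) (Y.reflexive (cong point eq)) (named (p 0)))
    , (toMachine restore , λ {y} {p} ny → canonicalName lem E (p 0) , restores p ,
        names-resp (S A) {p = canonicalName lem E (p 0)} {x = pt lem (p 0)} {y = pt lem (index y)}
          (λ _ → refl) (X.reflexive (cong (pt lem) (first ny)))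
          (canonicalName-names lem E (p 0)))
  where
  open Numbered N
  module X = Setoid (points (S A))
  module Y = Setoid (points Y)
  E = semidecision ce
  open Semidecision E

  t₀ : Term 1 1
  t₀ = ask₀ zer zer
  first₀ : Code 1
  first₀ = compile₁ consultCode t₀

  t : Term 2 1
  t = interleaveT (var 0F) (ask₁ zer zer) (ask₀ (ask₁ zer zer) (halfT (var 0F)))
  restore : Code 1
  restore = compile₂ code consultCode t
  restores : ∀ p → Φ (toMachine restore) p (canonicalName lem E (p 0))
  restores p w = subst (Halts _ _ _) (sym (⟨⟩-interleave (const (p 0)) (evidence (p 0)) w))
    (computes₂ evidence (λ _ → p) (correct p) (consultCode-correct p) t w)

module _ {A : Pred ℕ 0ℓ} (lem : ExcludedMiddle 0ℓ) where

  -- The pairs (k , j) at which the name of s k shows a nonzero entry enumerate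
  -- the first components of the points of the sequence s that lie on ⊤.
  dense⇒enumerable : ∀ M (s : ℕ → Carrier (S A)) → (∀ k → ∃[ q ] Φ M (const k) q × names (S A) q (s k)) →
    (∀ n → A n → ∃[ k ] proj₁ (s k) ≡ (n , ⊤ˢ)) → ComputablyEnumerable A
  dense⇒enumerable M s realised dense with machineIndex M
  ... | i , refl = enumerable lem {C = compile₁ H-code t} {g} (compile₁-correct {f = H} H-correct t)
                     λ n → mk⇔ (complete n) (λ (w , eq) → sound n w eq)
    where
    H : ℕ → Baire
    H k = proj₁ (realised k)

    -- The machine for `s` is run on the constant sequence `k` as a name of `k`.
    oracle : Term 0 2
    oracle = var 0F

    H-code : Code 2
    H-code = runCode {0} (lit i) (λ _ → compile₀ oracle)

    H-correct : Correct₂ (const 0) H-code H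
    H-correct = runCode-correct {0} (lit i) {O = λ _ k _ → k} (λ _ → compile₀-correct oracle)
      (⟦lit⟧ i (λ _ k _ → k)) (λ k → proj₁ (proj₂ (realised k)))

    t : Term 1 1
    t = ifZero (ask₀ (fstT (var 0F)) (oddT (sndT (var 0F)))) zer (succ (ask₀ (fstT (var 0F)) zer))

    g : Baire
    g w = primRec 0 (λ _ _ → suc (H (π₁ w) 0)) (odds (H (π₁ w)) (π₂ w))

    complete : ∀ n → A n → ∃[ w ] g w ≡ suc n
    complete n An =
      let (k , eq) = dense n An
          (num , sier) = proj₂ (proj₂ (realised k))
          (j , nz) = nonzero lem (⊤⇒nonzero sier (cong proj₂ eq))
      in pair k j , subst₂ (λ k′ j′ → primRec 0 (λ _ _ → suc (H k′ 0)) (odds (H k′) j′) ≡ suc n)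
                      (sym (π₁-pair k j)) (sym (π₂-pair k j))
                      (trans (primRec-nonzero (odds (H k) j) nz) (cong suc (trans num (cong proj₁ eq))))

    sound : ∀ n w → g w ≡ suc n → A n
    sound n w eq with odds (H (π₁ w)) (π₂ w) in nz
    sound n w () | zero
    sound n w refl | suc _ = onTop (s (π₁ w)) (proj₂ (proj₂ (realised (π₁ w))))
      where
      onTop : ∀ x → names (S A) (H (π₁ w)) x → A (H (π₁ w) 0)
      onTop (_ , inj₁ (a , _))    (refl , _) = a
      onTop (_ , inj₂ (_ , refl)) (_ , sier)   = contradiction (entry⇒⊤ (π₂ w) sier nz) λ ()

-- Open subsets of `S A` and overtness

restrict : ∀ {P : Set} → Dec P → Sierpinski → Sierpinski
restrict (yes _) s = s
restrict (no _)  s = ⊥ˢ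

module _ (A : Pred ℕ 0ℓ) where

  -- The open set {(n , ⊤)} ∩ S A, and a machine that realises its
  -- characteristic function when the oracle starts with n.
  topT : Term 1 1
  topT = ifEqualT (ask₀ zer zer) (ask₀ zer (lit 1)) (ask₀ zer (oddT (oddT (var 0F)))) zer

  topMachine : Machine
  topMachine = toMachine (compile₁ consultCode topT)

  top : ℕ → Map (S A) 𝕊
  top n = record
    { to   = λ ((m , s) , _) → restrict (n ≟ m) s
    ; cong = λ { (refl , refl) → refl }
    }

  top-realised : ∀ n → Realises (S A) 𝕊 (λ q → Φ topMachine ⟨ const n , q ⟩) (top n)
  top-realised n {(m , s) , _} {q} (refl , ns) = _ , computes₁ (λ _ → ⟨ const n , q ⟩) (consultCode-correct _) topT
    , decide (n ≟ m)
    where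
    -- The name `q` is at the odd positions of the oracle and the truth value at the odd positions
    -- of `q`, hence the doubly odd position.
    value-at : ∀ k → ifEqual n m (⟨ const n , q ⟩ (suc (2 * suc (2 * k)))) 0 ≡ ifEqual n m (odds q k) 0
    value-at k = cong (λ v → ifEqual n m v 0) (odds-⟨⟩ (const n) q (suc (2 * k)))
    decide : (d : Dec (n ≡ m)) →
             SierpinskiName (λ k → ifEqual n m (⟨ const n , q ⟩ (suc (2 * suc (2 * k)))) 0) (restrict d s)
    decide (yes eq) = names-resp 𝕊 (λ k → sym (trans (value-at k) (ifEqual-≡ _ 0 eq))) refl ns
    decide (no ne)  = names-⊥ λ k → trans (value-at k) (ifEqual-≢ _ 0 ne)

  topSet : ℕ → Carrier (𝒪 (S A))
  topSet n = top n , topMachine , const n , λ {x} → top-realised n {x}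

  topSet-nonEmpty : ∀ n → NonEmpty (S A) (topSet n) ⇔ A n
  topSet-nonEmpty n = mk⇔ (λ (x , x∈) → ∈⇒member x x∈) λ a → ((n , ⊤ˢ) , inj₁ (a , refl)) , self (n ≟ n)
    where
    self : (d : Dec (n ≡ n)) → restrict d ⊤ˢ ≡ ⊤ˢ
    self (yes _) = refl
    self (no ne) = contradiction refl ne
    ∈⇒member : ∀ x → Func.to (top n) x ≡ ⊤ˢ → A n
    ∈⇒member ((m , s) , v) eq with n ≟ m
    ∈⇒member (_ , inj₁ (a , _))    eq | yes refl = a
    ∈⇒member (_ , inj₂ (_ , refl)) () | yes refl
    ∈⇒member ((m , s) , v) () | no _

  topSet-∈ : ∀ n x → _∈_ (S A) x (topSet n) → proj₁ x ≡ (n , ⊤ˢ)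
  topSet-∈ n ((m , s) , _) eq with n ≟ m
  ... | yes refl = cong (n ,_) eq
  topSet-∈ n ((m , s) , _) () | no _

  opaque
    topIndex : ℕ
    topIndex = proj₁ (machineIndex topMachine)

    machine-topIndex : machine topIndex ≡ topMachine
    machine-topIndex = proj₂ (machineIndex topMachine)

  -- One machine serves all `n`, which enters only as advice after the index; the name is therefore
  -- computable uniformly in `n`.
  topSet-named : ∀ n → names (𝒪 (S A)) (startingWith topIndex n) (topSet n)
  topSet-named n {x} {p} nx = subst (λ M → ∃[ t ] Φ M ⟨ const n , p ⟩ t × SierpinskiName t (Func.to (top n) x))
    (sym machine-topIndex) (top-realised n {x} {p} nx)

module _ {A : Pred ℕ 0ℓ} (lem : ExcludedMiddle 0ℓ) where

  separable⇒enumerable : ComputablySeparable (S A) → ComputablyEnumerable A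
  separable⇒enumerable (s , (M , realises) , dense) = dense⇒enumerable lem M (Func.to s) (λ k → realises refl)
    λ n a → let (k , k∈) = dense (topSet A n) (Equivalence.from (topSet-nonEmpty A n) a)
            in k , topSet-∈ A n (Func.to s k) k∈

  ≅ℕ⇒separable : S A ≅ ℕʳ → ComputablySeparable (S A)
  ≅ℕ⇒separable (i , _ , computable) = record { to = from ; cong = from-cong } , computable ,
    λ (χ , _) (x , x∈) → to x , trans (Func.cong χ {from (to x)} {x} (inverseʳ refl)) x∈
    where open Inverse i

  overt⇒enumerable : ComputablyOvert (S A) → ComputablyEnumerable A
  overt⇒enumerable ((U , _) , U-spec , p , p-computable , p-names) =
    enumerable lem {C = compile₁ H-code t} {g} (compile₁-correct {f = H} H-correct t)
      λ n → mk⇔ (complete n) (λ (w , eq) → sound n w eq)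
    where
    e₀ = topIndex A

    -- Running the overtness realiser on the name of `topSet A n` gives a name of the truth value of
    -- `A n`.
    realised : ∀ n → ∃[ q ] Φ (machine (p 0)) ⟨ p ∘ suc , startingWith e₀ n ⟩ q ×
                      SierpinskiName q (Func.to U (topSet A n))
    realised n = p-names {topSet A n} {startingWith e₀ n} (λ {x} {r} → topSet-named A n {x} {r})

    H : ℕ → Baire
    H n = proj₁ (realised n)

    P-code = proj₁ (sequenceCode p-computable)

    oracleT : Term 1 2
    oracleT = interleaveT (var 1F) (ask₀ zer (succ (halfT (var 1F))))
                (ifZero (halfT (var 1F)) (lit e₀) (var 0F))

    oracle-correct : Correct₂ (const 0) (compile₁ P-code oracleT) (λ n → ⟨ p ∘ suc , startingWith e₀ n ⟩)
    oracle-correct = correct-resp {c = compile₁ P-code oracleT}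
      (λ ρ → trans (cong (λ e → interleave (ρ 1F) (p (suc (half (ρ 1F)))) (startingWith e (ρ 0F) (half (ρ 1F))))
                     (⟦lit⟧ e₀ (λ _ _ → p) ρ))
               (sym (⟨⟩-interleave (p ∘ suc) (startingWith e₀ (ρ 0F)) (ρ 1F))))
      (compile₁-correct {f = λ _ → p} (proj₂ (sequenceCode p-computable) (const 0)) oracleT)

    H-code : Code 2
    H-code = runCode {0} (lit (p 0)) (λ _ → compile₁ P-code oracleT)

    H-correct : Correct₂ (const 0) H-code H
    H-correct = runCode-correct {0} (lit (p 0)) {O = λ _ n → ⟨ p ∘ suc , startingWith e₀ n ⟩} (λ _ → oracle-correct)
      (⟦lit⟧ (p 0) (λ _ n → ⟨ p ∘ suc , startingWith e₀ n ⟩)) (λ n → proj₁ (proj₂ (realised n)))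

    t : Term 1 1
    t = ifZero (ask₀ (fstT (var 0F)) (sndT (var 0F))) zer (succ (fstT (var 0F)))

    g : Baire
    g w = primRec 0 (λ _ _ → suc (π₁ w)) (H (π₁ w) (π₂ w))

    open Equivalence

    complete : ∀ n → A n → ∃[ w ] g w ≡ suc n
    complete n a =
      let (j , nz) = nonzero lem (⊤⇒nonzero (proj₂ (proj₂ (realised n)))
                       (from (U-spec (topSet A n)) (from (topSet-nonEmpty A n) a)))
      in pair n j , subst₂ (λ n′ j′ → primRec 0 (λ _ _ → suc n′) (H n′ j′) ≡ suc n)
                      (sym (π₁-pair n j)) (sym (π₂-pair n j)) (primRec-nonzero (H n j) nz)

    sound : ∀ n w → g w ≡ suc n → A n
    sound n w eq with H (π₁ w) (π₂ w) in nz
    sound n w () | zero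
    sound n w refl | suc _ = to (topSet-nonEmpty A n)
      (to (U-spec (topSet A n)) (entry⇒⊤ (π₂ w) (proj₂ (proj₂ (realised n))) nz))

  enumerable⇒overt : ComputablyEnumerable A → ComputablyOvert (S A)
  enumerable⇒overt ce = (χ , M , const 0 , λ {U} → realises {U}) ,
    (λ U → mk⇔ (sound lem) (complete lem)) ,
    -- The realiser needs no advice, so its index followed by zeros is a name.
    startingWith (proj₁ (machineIndex M)) 0 , startingWith-computable (proj₁ (machineIndex M)) ,
    λ {U} {p} nU → subst (λ M → ∃[ q ] Φ M ⟨ const 0 , p ⟩ q × SierpinskiName q (Func.to χ U))
      (sym (proj₂ (machineIndex M))) (realises {U} nU)
    where
    E = semidecision ce
    open Semidecision E
    name = canonicalName lem E

    answer : ∀ {P : Set} → Dec P → Sierpinski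
    answer (yes _) = ⊤ˢ
    answer (no _)  = ⊥ˢ

    sound : ∀ {P : Set} (d : Dec P) → answer d ≡ ⊤ˢ → P
    sound (yes p) _ = p

    complete : ∀ {P : Set} (d : Dec P) → P → answer d ≡ ⊤ˢ
    complete (yes _) _ = refl
    complete (no ¬p) p = contradiction p ¬p

    answer-cong : ∀ {P Q : Set} (d : Dec P) (d′ : Dec Q) → (P → Q) → (Q → P) → answer d ≡ answer d′
    answer-cong (yes _) (yes _) _ _ = refl
    answer-cong (yes p) (no ¬q) f _ = contradiction (f p) ¬q
    answer-cong (no ¬p) (yes q) _ g = contradiction (g q) ¬p
    answer-cong (no _)  (no _)  _ _ = refl

    χ : Map (𝒪 (S A)) 𝕊
    χ = record
      { to   = λ U → answer (lem {NonEmpty (S A) U})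
      ; cong = λ U≈V → answer-cong lem lem (λ (x , x∈) → x , trans (sym (U≈V x)) x∈)
                                           (λ (x , x∈) → x , trans (U≈V x) x∈)
      }

    -- The name `p` of the open set is at the odd positions of `⟨ const 0 , p ⟩`, and its own advice
    -- begins at `p 1`; hence the odd position with index one higher.
    oracleT : Term 2 2
    oracleT = interleaveT (var 1F) (ask₁ zer (oddT (succ (halfT (var 1F)))))
                (interleaveT (halfT (var 1F)) (var 0F) (ask₀ (var 0F) (halfT (halfT (var 1F)))))

    oracle-code : Code 2
    oracle-code = compile₂ code consultCode oracleT

    -- Position 1 of `⟨ const 0 , p ⟩` is `p 0`, the index of the machine that `p` codes.
    indexT : Term 2 2
    indexT = ask₁ zer (lit 1)

    H-code : Code 2
    H-code = runCode {1} indexT (choose₂ oracle-code consultCode)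

    t : Term 1 1
    t = ask₀ (fstT (var 0F)) (sndT (var 0F))

    M : Machine
    M = toMachine (compile₁ H-code t)

    realises : Realises (𝒪 (S A)) 𝕊 (λ p → Φ M ⟨ const 0 , p ⟩) χ
    realises {U , _} {p} U-named = (λ w → H (π₁ w) (π₂ w)) , computes₁ H H-correct t , named lem
      where
      β : Baire
      β = ⟨ const 0 , p ⟩

      realised : ∀ n → ∃[ q ] Φ (machine (p 0)) ⟨ p ∘ suc , name n ⟩ q × SierpinskiName q (Func.to U (pt lem n))
      realised n = U-named {pt lem n} {name n} (canonicalName-names lem E n)

      H : ℕ → Baire
      H n = proj₁ (realised n)

      oracle-correct : Correct₂ β oracle-code (λ n → ⟨ p ∘ suc , name n ⟩)
      oracle-correct = correct-resp {c = oracle-code}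
        (λ ρ → trans (cong₂ (interleave (ρ 1F)) (odds-⟨⟩ (const 0) p (suc (half (ρ 1F))))
                        (sym (⟨⟩-interleave (const (ρ 0F)) (evidence (ρ 0F)) (half (ρ 1F)))))
                 (sym (⟨⟩-interleave (p ∘ suc) (name (ρ 0F)) (ρ 1F))))
        (compile₂-correct {f = evidence} {λ _ → β} (correct β) (consultCode-correct β) oracleT)

      H-correct : Correct₂ β H-code H
      H-correct = runCode-correct {1} indexT {O = choose₂ (λ n → ⟨ p ∘ suc , name n ⟩) (λ _ → β)}
        (λ { 0F → oracle-correct ; 1F → consultCode-correct β })
        (λ _ → refl) (λ n → proj₁ (proj₂ (realised n)))

      Hw = λ w → H (π₁ w) (π₂ w)

      -- A countable disjunction in 𝕊: pairing merges the names into one sequence, which is zero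
      -- exactly if all of them are. The `pt lem n` exhaust `S A` up to equality.
      named : (d : Dec (∃[ x ] Func.to U x ≡ ⊤ˢ)) → SierpinskiName Hw (answer d)
      named (yes (x , x∈)) = names-⊤ λ z →
        ⊤⇒nonzero (proj₂ (proj₂ (realised (number x))))
          (trans (Func.cong U {pt lem (number x)} {x}
                   (number-injective {A} (pt lem (number x)) x (number-pt lem (number x)))) x∈)
          λ j → trans (sym (cong₂ H (π₁-pair (number x) j) (π₂-pair (number x) j))) (z (pair (number x) j))
      named (no empty) = names-⊥ λ w →
        ≢⊤⇒zero (proj₂ (proj₂ (realised (π₁ w)))) (λ h → empty (pt lem (π₁ w) , h)) (π₂ w)

  enumerable⇒≅ℕ : ComputablyEnumerable A → S A ≅ ℕʳ
  enumerable⇒≅ℕ ce = numbered-≅ {A = A} lem ce {ℕʳ} record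
    { point       = id
    ; index       = id
    ; index-cong  = id
    ; index-point = λ _ → refl
    ; point-index = λ _ → refl
    ; named       = λ _ → refl
    ; first       = id
    }

  enumerable⇒quasiPolish : ComputablyEnumerable A → ComputablyQuasiPolish lem (S A)
  enumerable⇒quasiPolish ce =
    (_≡_ , inj₂ (id , id , identity , identity
         , λ x y → mk⇔ (λ eq → x , refl , eq) λ (k , eq , eq′) → trans (sym eq) eq′)
         , trans , numbered-≅ {A = A} lem ce {𝐈 lem _≡_} record
      { point       = λ k → record
        { member   = k ≡_
        ; nonEmpty = k , refl
        ; lower    = λ x≡y eq → trans eq (sym x≡y)
        ; directed = λ eq eq′ → k , refl , sym eq , sym eq′
        }
      ; index       = λ I → proj₁ (nonEmpty I)
      ; index-cong  = λ {I} {J} I≈J → unique J (to (I≈J (proj₁ (nonEmpty I))) (proj₂ (nonEmpty I))) (proj₂ (nonEmpty J))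
      ; index-point = λ _ → refl
      ; point-index = λ I k → mk⇔ (λ eq → subst (member I) eq (proj₂ (nonEmpty I))) (unique I (proj₂ (nonEmpty I)))
      ; named       = λ _ _ → mk⇔ (0 ,_) proj₂
      ; first       = λ {p} {I} np → unique I (from (np (p 0)) (0 , refl)) (proj₂ (nonEmpty I))
      })
    , enumerable⇒overt ce
    where
    open Ideal
    open Equivalence
    identity : ComputableSequence id
    -- The empty program halts at once, with its input still on tape 0.
    identity = [] , λ k → subst (Halts [] (const 0) (initial k)) (value-unary k) (halted refl)
    -- Directedness yields an upper bound of both members, which for the relation `_≡_` means a
    -- common value; the ideals are thus the singletons.
    unique : ∀ (I : Ideal _≡_) {x y} → member I x → member I y → x ≡ y
    unique I mx my = let (z , _ , x≡z , y≡z) = directed I mx my in trans x≡z (sym y≡z)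

-- Metric completions

infix 4 _≗⟨<_⟩_

_≗⟨<_⟩_ : Baire → ℕ → Baire → Set
α ≗⟨< u ⟩ β = ∀ i → i < u → α i ≡ β i

step-use : ∀ M α k → ∃[ u ] ∀ β → α ≗⟨< u ⟩ β → step M α k ≡ step M β k
step-use M α (config q ts) with fetch M q
... | nothing           = 0 , λ _ _ → refl
... | just (scan t b m) = 0 , λ _ _ → refl
... | just (query t r)  = suc (value (ts t)) , λ β α≗β →
  cong (λ v → just (config r (ts [ t ≔ unary v ]))) (α≗β (value (ts t)) (n<1+n _))

-- The use principle: a halting run has finitely many steps, each of which consults at most one
-- entry, and the bound is the maximum over them.
Halts-use : ∀ {M α k m} → Halts M α k m → ∃[ u ] ∀ β → α ≗⟨< u ⟩ β → Halts M β k m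
Halts-use {M} {α} {k} (halted s) =
  let (u , same) = step-use M α k in u , λ β α≗β → halted (trans (sym (same β α≗β)) s)
Halts-use {M} {α} {k} (steps s h) =
  let (u , same)  = step-use M α k
      (v , halts) = Halts-use h
  in u ⊔ v , λ β α≗β →
       steps (trans (sym (same β λ i i< → α≗β i (<-≤-trans i< (m≤m⊔n u v)))) s)
             (halts β λ i i< → α≗β i (<-≤-trans i< (m≤n⊔m u v)))

2⁻-antitone : ∀ {m n} → m ≤ n → 2⁻ n ℚ.≤ 2⁻ m
2⁻-antitone m≤n = go (≤⇒≤′ m≤n)
  where
  go : ∀ {m n} → m ≤′ n → 2⁻ n ℚ.≤ 2⁻ m
  go ≤′-refl                 = ℚ.≤-refl
  go {m} {suc n} (≤′-step h) = ℚ.≤-trans {2⁻ suc n} {2⁻ n} {2⁻ m} (ℚ.<⇒≤ (2⁻-suc-< n)) (go h)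

module _ (D : Pseudometric) where
  open Completion D

  -- Far enough along a name p of x, the entry p K is so close to x that the
  -- first u entries of p may serve as the beginning of a name of p K.
  close : ∀ {p x} → names 𝐗 p x → ∀ u →
          ∃[ K ] ∀ k → K ≤ k → ∀ i → i < u → d̂ (η (p i)) (η (p k)) <ᴿ ι (2⁻ i)
  close nx zero = 0 , λ _ _ _ ()
  close {p} {x} nx (suc u) =
    let (K , near)    = close {p} {x} nx u
        (r , r< , h)  = <ι⇒≤ι {d̂ (η (p u)) x} {2⁻ u} (nx u)
        -- Names approximate strictly, which leaves the slack `2⁻ u - r` at entry `u`; from index
        -- `L` on, the entries of `p` are closer to `x` than this slack.
        (L , small)   = archimedean (by-difference-< r<
                          (solve 2 (λ a b → a :- b :- con 0ℚ := a :- b) refl (2⁻ u) r))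
    in K ⊔ L , λ k K⊔L≤k i i<1+u → split K near r h L small k K⊔L≤k i (m≤n⇒m<n∨m≡n (s≤s⁻¹ i<1+u))
    where
    split : ∀ K → (∀ k → K ≤ k → ∀ i → i < u → d̂ (η (p i)) (η (p k)) <ᴿ ι (2⁻ i)) →
            ∀ r → d̂ (η (p u)) x ≤ᴿ ι r → ∀ L → 2⁻ L ℚ.< 2⁻ u ℚ.- r →
            ∀ k → K ⊔ L ≤ k → ∀ i → i < u ⊎ i ≡ u → d̂ (η (p i)) (η (p k)) <ᴿ ι (2⁻ i)
    split K near r h L small k ≤k i (inj₁ i<u)  = near k (≤-trans (m≤m⊔n K L) ≤k) i i<u
    split K near r h L small k ≤k i (inj₂ refl) =
      let (s , s< , h′) = <ι⇒≤ι {d̂ (η (p k)) x} {2⁻ k} (nx k)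
      in ≤ι⇒<ι {d̂ (η (p u)) (η (p k))} {2⁻ u} {r ℚ.+ s}
           (d̂-triangle (η (p u)) x (η (p k)) r s h (d̂-symm (η (p k)) x s h′))
           (by-difference-< (ℚ.<-trans s< (ℚ.≤-<-trans (2⁻-antitone (≤-trans (m≤n⊔m K L) ≤k)) small))
             (solve 3 (λ e r s → e :- (r :+ s) := e :- r :- s) refl (2⁻ u) r s))

  splice : Baire → ℕ → ℕ → Baire
  splice p u k i with i <? u
  ... | yes _ = p i
  ... | no _  = k

  splice-agrees : ∀ p u k → p ≗⟨< u ⟩ splice p u k
  splice-agrees p u k i i<u with i <? u
  ... | yes _  = refl
  ... | no i≮u = contradiction i<u i≮u

  splice-names : ∀ {p x} → names 𝐗 p x → ∀ u → ∃[ K ] names 𝐗 (splice p u (p K)) (η (p K))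
  splice-names {p} {x} nx u = let (K , near) = close {p} {x} nx u in K , named K (near K ≤-refl)
    where
    named : ∀ K → (∀ i → i < u → d̂ (η (p i)) (η (p K)) <ᴿ ι (2⁻ i)) → names 𝐗 (splice p u (p K)) (η (p K))
    named K near i with i <? u
    ... | yes i<u = near i i<u
    ... | no _    = ≤ι⇒<ι {d̂ (η (p K)) (η (p K))} {2⁻ i} {0ℚ} (d̂-zero (η (p K))) (2⁻-positive i)

  η-named : ∀ k → names 𝐗 (const k) (η k)
  η-named k i = ≤ι⇒<ι {d̂ (η k) (η k)} {2⁻ i} {0ℚ} (d̂-zero (η k)) (2⁻-positive i)

module _ {A : Pred ℕ 0ℓ} (lem : ExcludedMiddle 0ℓ) where

  metric⇒enumerable : CompleteComputableMetric (S A) → ComputablyEnumerable A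
  metric⇒enumerable (D , _ , i , _ , (M , realises)) =
    dense⇒enumerable lem M (from ∘ η) (λ k → realises {η k} {const k} (η-named D k)) dense
    where
    open Completion D
    open Inverse i
    dense : ∀ n → A n → ∃[ k ] proj₁ (from (η k)) ≡ (n , ⊤ˢ)
    dense n a =
      let x = (n , ⊤ˢ) , inj₁ (a , refl)
          (p , np) = names-surjective 𝐗 (to x)
          (q , Φq , nq) = realises {to x} {p} np
          (num , sier)  = names-resp (S A) {q} {q} {from (to x)} {x} (λ _ → refl)
                            (inverseʳ {x} {to x} (Setoid.refl (points 𝐗) {to x})) nq
          (j , nz)      = nonzero lem (⊤⇒nonzero sier refl)
          -- Two output entries determine the point: entry 0 is its number, and the nonzero entry at
          -- `suc (2 * j)` shows ⊤. A spliced name that agrees with `p` on the uses of both runs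
          -- produces the same two entries.
          (u , halts₀)  = Halts-use (Φq 0)
          (v , halts₁)  = Halts-use (Φq (suc (2 * j)))
          (K , nK)      = splice-names D {p} {to x} np (u ⊔ v)
          r             = splice D p (u ⊔ v) (p K)
          agree         = splice-agrees D p (u ⊔ v) (p K)
          (q′ , Φq′ , nq′) = realises {η (p K)} {r} nK
          q₀ = Halts-deterministic (halts₀ r λ i i< → agree i (<-≤-trans i< (m≤m⊔n u v))) (Φq′ 0)
          q₁ = Halts-deterministic (halts₁ r λ i i< → agree i (<-≤-trans i< (m≤n⊔m u v))) (Φq′ (suc (2 * j)))
      in p K , onTop (from (η (p K))) {q′} {j} nq′ (trans (sym q₀) num) (λ z → nz (trans q₁ z))
      where
      onTop : ∀ y {q j} → names (S A) q y → q 0 ≡ n → odds q j ≢ 0 → proj₁ y ≡ (n , ⊤ˢ)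
      onTop ((m , ⊤ˢ) , _) (refl , _)         refl nz = refl
      onTop ((m , ⊥ˢ) , _) {j = j} (_ , names-⊥ z) _ nz = contradiction (z j) nz

-- The discrete metric on ℕ

separation : ℕ → ℕ → ℚ
separation x y with x ≟ y
... | yes _ = 0ℚ
... | no _  = 1ℚ

0≤1 : 0ℚ ℚ.≤ 1ℚ
0≤1 = *≤* (+≤+ z≤n)

separation-refl : ∀ x → separation x x ≡ 0ℚ
separation-refl x with x ≟ x
... | yes _  = refl
... | no x≢x = contradiction refl x≢x

separation-≥0 : ∀ x y → 0ℚ ℚ.≤ separation x y
separation-≥0 x y with x ≟ y
... | yes _ = ℚ.≤-refl
... | no _  = 0≤1

separation-symm : ∀ x y → separation x y ℚ.≤ separation y x
separation-symm x y with x ≟ y | y ≟ x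
... | yes _  | yes _  = ℚ.≤-refl
... | yes _  | no _   = 0≤1
... | no x≢y | yes eq = contradiction (sym eq) x≢y
... | no _   | no _   = ℚ.≤-refl

separation-triangle : ∀ x y z → separation x z ℚ.≤ separation x y ℚ.+ separation y z
separation-triangle x y z with x ≟ y
... | yes refl = ℚ.≤-reflexive (sym (ℚ.+-identityˡ (separation x z)))
... | no _     = ℚ.≤-trans ≤1 (ℚ.≤-trans (ℚ.≤-reflexive (sym (ℚ.+-identityʳ 1ℚ))) (ℚ.+-monoʳ-≤ 1ℚ (separation-≥0 y z)))
  where
  ≤1 : separation x z ℚ.≤ 1ℚ
  ≤1 with x ≟ z
  ... | yes _ = 0≤1
  ... | no _  = ℚ.≤-refl

ι-mono : ∀ {q r} → q ℚ.≤ r → ι q ≤ᴿ ι r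
ι-mono {q} {r} = ≤ι-weaken {ι q} {q} {r} (≤ᴿ-refl {ι q})

ι-cancel : ∀ {q r} → ι q ≤ᴿ ι r → q ℚ.≤ r
ι-cancel {q} {r} h = ≤-limit (≤ι-elim (ι q) r h)

discrete : Pseudometric
discrete = record
  { d          = λ x y → ι (separation x y)
  ; zero-≈     = λ x → ι-mono (ℚ.≤-reflexive (separation-refl x)) , ι-mono (ℚ.≤-reflexive (sym (separation-refl x)))
  ; nonNeg     = λ x y → ι-mono (separation-≥0 x y)
  ; symm       = λ x y → ι-mono (separation-symm x y) , ι-mono (separation-symm y x)
  ; triangle-≤ = λ x y z → ι-mono (separation-triangle x y z)
  }

open Completion discrete hiding (point)
open Point

separation<1 : ∀ {x y q} → ι (separation x y) ≤ᴿ ι q → q ℚ.< 1ℚ → x ≡ y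
separation<1 {x} {y} {q} h q<1 with x ≟ y
... | yes eq = eq
... | no _   = contradiction (ℚ.≤-<-trans (ι-cancel {1ℚ} {q} h) q<1) (ℚ.<-irrefl refl)

-- From index 2 on, approximations are within 2⁻ 2 + 2⁻ 2 = 1/2 of each other, and the only discrete
-- distance below 1 is 0.
approx-settled : ∀ x {k} → 2 ≤ k → approx x 2 ≡ approx x k
approx-settled x {k} 2≤k = separation<1 {approx x 2} {approx x k} {2⁻ 2 ℚ.+ 2⁻ k} (cauchy x 2 k)
  (ℚ.≤-<-trans (ℚ.+-monoʳ-≤ (2⁻ 2) (2⁻-antitone 2≤k))
    (ℚ.≤-<-trans (ℚ.≤-reflexive (2⁻-half 1)) (2⁻-suc-< 0)))

d̂<1 : ∀ x y {q} → d̂ x y ≤ᴿ ι q → q ℚ.< 1ℚ → approx x 2 ≡ approx y 2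
d̂<1 x y {q} h q<1 =
  -- Passing from `d̂` to the approximations at stage `suc k` costs 2⁻ suc k + 2⁻ suc k = 2⁻ k,
  -- which is made smaller than 1 - q.
  let (k , small) = archimedean {1ℚ ℚ.- q} (by-difference-< q<1
                      (solve 2 (λ a b → a :- b :- con 0ℚ := a :- b) refl 1ℚ q))
  in trans (approx-settled x (m≤m+n 2 (suc k)))
       (trans (separation<1 {approx x (3 + k)} {approx y (3 + k)} {q ℚ.+ (2⁻ suc k ℚ.+ 2⁻ suc k)} (d̂⇒d x y q h (suc k))
                (by-difference-< small
                  (trans (cong (λ e → 1ℚ ℚ.- (q ℚ.+ e)) (2⁻-half k))
                    (solve 3 (λ a b e → a :- (b :+ e) := a :- b :- e) refl 1ℚ q (2⁻ k)))))
         (sym (approx-settled y (m≤m+n 2 (suc k)))))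

numbered-𝐗 : Numbered 𝐗
numbered-𝐗 = record
  { point       = η
  ; index       = λ x → approx x 2
  ; index-cong  = λ {x} {y} (h , _) → d̂<1 x y {0ℚ} h (2⁻-positive 0)
  ; index-point = λ _ → refl
  ; point-index = λ x → d̂-≈0 (η (approx x 2)) x (d⇒d̂ (η (approx x 2)) x 0ℚ λ k →
      ι-mono (ℚ.≤-trans (ℚ.≤-reflexive
          (trans (cong (separation (approx x 2)) (sym (approx-settled x (m≤m+n 2 k)))) (separation-refl (approx x 2))))
        (ℚ.+-mono-≤ (ℚ.≤-refl {0ℚ}) (ℚ.+-mono-≤ (ℚ.+-mono-≤ (0≤2⁻ k) (0≤2⁻ k)) (ℚ.+-mono-≤ (0≤2⁻ k) (0≤2⁻ k))))))
  ; named       = η-named discrete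
  -- The first entry of a name is closer than 2⁻ 0 = 1, exactly the threshold of the discrete
  -- metric.
  ; first       = λ {p} {x} nx → let (r , r< , h) = <ι⇒≤ι {d̂ (η (p 0)) x} {2⁻ 0} (nx 0)
                                 in d̂<1 (η (p 0)) x {r} h r<
  }

constant-names : ∀ {v q} → (∀ k → ν (q k) ≡ v) → names ℝʳ q (ι v)
constant-names {v} {q} eq k rewrite eq k = ≤ι⇒<ι {distance (ι v) v} {2⁻ k} {0ℚ}
  (≤ι-intro (distance (ι v) v) 0ℚ λ m → ℚ.≤-trans (ℚ.≤-reflexive (cong ℚ.∣_∣ (ℚ.+-inverseʳ v)))
    (ℚ.≤-trans (0≤2⁻ m) (ℚ.≤-reflexive (sym (ℚ.+-identityˡ (2⁻ m))))))
  (2⁻-positive k)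

discrete-computable : Computable (ℕʳ ×ʳ ℕʳ) ℝʳ (Pseudometric.asMap discrete)
-- Any codes of the rationals 0 and 1 will do: repeating one of them forever names the corresponding
-- real.
discrete-computable = computable (ν-surjective 0ℚ) (ν-surjective 1ℚ)
  where
  computable : ∃[ k ] ν k ≡ 0ℚ → ∃[ k ] ν k ≡ 1ℚ → Computable (ℕʳ ×ʳ ℕʳ) ℝʳ (Pseudometric.asMap discrete)
  computable (c₀ , ν₀) (c₁ , ν₁) = toMachine (compile₁ consultCode t) , λ { {x , y} {p} (refl , refl) →
    _ , computes₁ (λ _ → p) (consultCode-correct p) t ,
    constant-names {separation (p 0) (p 1)} {⟦ t ⟧ (λ _ _ → p) ∘ const} (value-at p) }
    where
    t : Term 1 1
    t = ifEqualT (ask₀ zer zer) (ask₀ zer (lit 1)) (lit c₀) (lit c₁)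
    value-at : ∀ p k → ν (⟦ t ⟧ (λ _ _ → p) (const k)) ≡ separation (p 0) (p 1)
    value-at p k = trans (cong₂ (λ u v → ν (ifEqual (p 0) (p 1) u v)) (⟦lit⟧ c₀ (λ _ _ → p) _) (⟦lit⟧ c₁ (λ _ _ → p) _))
                     equal
      where
      equal : ν (ifEqual (p 0) (p 1) c₀ c₁) ≡ separation (p 0) (p 1)
      equal with p 0 ≟ p 1
      ... | yes eq = trans (cong ν (ifEqual-≡ c₀ c₁ eq)) ν₀
      ... | no ne  = trans (cong ν (ifEqual-≢ c₀ c₁ ne)) ν₁

enumerable⇒metric : ∀ {A : Pred ℕ 0ℓ} → ExcludedMiddle 0ℓ → ComputablyEnumerable A → CompleteComputableMetric (S A)
enumerable⇒metric lem ce = discrete , discrete-computable , numbered-≅ lem ce numbered-𝐗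

-- The equivalences

⇔-through : ∀ {p q r} {P : Set p} {Q : Set q} {R : Set r} → (P → R) → (R → P) → (Q → R) → (R → Q) → P ⇔ Q
⇔-through p⇒r r⇒p q⇒r r⇒q = mk⇔ (r⇒q ∘ p⇒r) (r⇒p ∘ q⇒r)

proposition22 : (lem : ExcludedMiddle 0ℓ) (A : Pred ℕ 0ℓ) →
    ((S A ≅ ℕʳ) ⇔ CompleteComputableMetric (S A)) ×
    (CompleteComputableMetric (S A) ⇔ ComputablyQuasiPolish lem (S A)) ×
    (ComputablyQuasiPolish lem (S A) ⇔ ComputablySeparable (S A)) ×
    (ComputablySeparable (S A) ⇔ ComputablyOvert (S A)) ×
    (ComputablyOvert (S A) ⇔ ComputablyEnumerable A)
proposition22 lem A =
  ⇔-through 1⇒6 6⇒1 2⇒6 6⇒2 , ⇔-through 2⇒6 6⇒2 3⇒6 6⇒3 , ⇔-through 3⇒6 6⇒3 4⇒6 6⇒4 ,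
  ⇔-through 4⇒6 6⇒4 5⇒6 6⇒5 , mk⇔ 5⇒6 6⇒5
  where
  5⇒6 : ComputablyOvert (S A) → ComputablyEnumerable A
  5⇒6 = overt⇒enumerable lem
  6⇒5 : ComputablyEnumerable A → ComputablyOvert (S A)
  6⇒5 = enumerable⇒overt lem
  4⇒6 : ComputablySeparable (S A) → ComputablyEnumerable A
  4⇒6 = separable⇒enumerable lem
  6⇒1 : ComputablyEnumerable A → S A ≅ ℕʳ
  6⇒1 = enumerable⇒≅ℕ lem
  6⇒4 : ComputablyEnumerable A → ComputablySeparable (S A)
  6⇒4 = ≅ℕ⇒separable lem ∘ 6⇒1
  1⇒6 : S A ≅ ℕʳ → ComputablyEnumerable A
  1⇒6 = 4⇒6 ∘ ≅ℕ⇒separable lem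
  2⇒6 : CompleteComputableMetric (S A) → ComputablyEnumerable A
  2⇒6 = metric⇒enumerable lem
  6⇒2 : ComputablyEnumerable A → CompleteComputableMetric (S A)
  6⇒2 = enumerable⇒metric lem
  3⇒6 : ComputablyQuasiPolish lem (S A) → ComputablyEnumerable A
  3⇒6 = 5⇒6 ∘ proj₂
  6⇒3 : ComputablyEnumerable A → ComputablyQuasiPolish lem (S A)
  6⇒3 = enumerable⇒quasiPolish lem
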